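{- Let $\mathbf{Q}=(Q_m)_{m\ge0}$ be a strictly increasing sequence of positive real numbers with $Q_0>1$, $Q_m\to\infty$ and $\inf_{m\ge0}Q_{m+1}/Q_m^{\tau}>0$ for some $\tau>1$. Put $$E=\Big\{(x,y)\in\mathbb{R}^2:\ \limsup_{Q\to+\infty}\ Q\cdot\min_{1\le q\le Q}\langle qx\rangle\langle qy\rangle>0\Big\},\qquad E_{\mathbf{Q}}=\Big\{(x,y)\in\mathbb{R}^2:\ \liminf_{m\to+\infty}\ Q_m\cdot\min_{1\le q\le Q_m}\langle qx\rangle\langle qy\rangle>0\Big\}.$$ Let $a,b\in\mathbb{R}$ and $\mathcal{C}=\{(x,y)\in\mathbb{R}^2:y=ax+b\}$. \begin{enumerate} \item If $a\ne0$ and for some $\varepsilon>0$ one has $$\liminf_{q\to+\infty}\ q^{2-\varepsilon}\cdot\max\{\langle qa\rangle,\langle qb\rangle\}>0,$$ then the sets $E\cap\mathcal{C}$ and $E_{\mathbf{Q}}\cap\mathcal{C}$ are absolutely winning on $\mathcal{C}$. \item If $a,b\in\mathbb{Q}$, then $\mathcal{C}\cap E=\mathcal{C}\cap E_{\mathbf{Q}}=\varnothing$. \end{enumerate}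
   Context: For $x\in\mathbb{R}$, $\langle x\rangle$ denotes the distance from $x$ to the nearest integer; $q$ ranges over positive integers. Hyperplane absolute winning (HAW). Let $U\subset\mathbb{R}^d$ be open, $S\subset\mathbb{R}^d$, $\beta\in(0,1/3)$. For an affine hyperplane $L\subset\mathbb{R}^d$ and $r>0$ put $L^{(r)}=\{z\in\mathbb{R}^d:\mathrm{dist}(z,L)\le r\}$. Bob first chooses a closed ball $B_0\subset U$ of radius $\rho_0>0$. After Bob chooses a closed ball $B_n$ of radius $\rho_n$, Alice chooses $L_n^{(r_n)}$ with $r_n\le\beta\rho_n$, and then Bob chooses a closed ball $B_{n+1}\subset B_n\setminus L_n^{(r_n)}$ of radius $\rho_{n+1}\ge\beta\rho_n$. Alice wins by default if at any time Bob has no legal move, or if $\rho_n\not\to0$; otherwise Alice wins iff $\bigcap_nB_n\cap S\ne\varnothing$. $S$ is HAW on $U$ if for every $\beta\in(0,1/3)$ Alice has a winning strategy. A subset $S$ of a $d$-dimensional $C^1$ manifold $M$ with $C^1$ atlas $\{(U_\alpha,\varphi_\alpha)\}$ is HAW on $M$ if $\varphi_\alpha(S\cap U_\alpha)$ is HAW on $\varphi_\alpha(U_\alpha)$ for each $\alpha$ (this is independent of the atlas). On a one-dimensional manifold (where affine hyperplanes of the chart space $\mathbb{R}$ are points), "absolutely winning" is equivalent to HAW. -}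

module Defs where

open import Level using (0ℓ; suc)
open import Algebra.Bundles using (CommutativeRing)
open import Axiom.ExcludedMiddle using (ExcludedMiddle)
open import Data.Fin.Base using (Fin)
open import Data.Integer.Base using (ℤ; +_; -[1+_])
open import Data.List.Base using (List; applyDownFrom)
open import Data.Nat.Base as ℕ using (ℕ)
open import Data.Product.Base using (_×_; _,_; ∃; ∃-syntax; Σ-syntax; proj₁; proj₂)
open import Data.Rational.Base using (ℚ; ↥_; ↧ₙ_)
open import Data.Unit.Base using (⊤)
open import Data.Vec.Functional using (Vector)
open import Function.Base using (_∘_)
open import Relation.Binary.Bundles using (TotalOrder)
open import Relation.Binary.Core using (Rel)
open import Relation.Binary.Structures using (IsTotalOrder)
open import Relation.Nullary using (¬_; yes; no)
open import Relation.Nullary.Construct.Add.Extrema using (_±; ⊥±; ⊤±; [_])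
open import Relation.Unary using (Pred; _∈_; _∉_; _⊆_; _∩_; Satisfiable)
import Algebra.Construct.NaturalChoice.Max as Max
import Algebra.Properties.Monoid.Sum as MonoidSum
import Algebra.Properties.Semiring.Exp as SemiringExp
import Algebra.Properties.Semiring.Mult as SemiringMult
import Relation.Binary.Construct.Add.Extrema.NonStrict as AddExtremaNonStrict
import Relation.Binary.Construct.Add.Extrema.Strict as AddExtremaStrict
import Relation.Binary.Construct.NonStrictToStrict as ToStrict

-- The real numbers, given by their axioms as a Dedekind-complete ordered field
-- (unique up to isomorphism).  Equality is a setoid equality, so that e.g.
-- Cauchy sequences of rationals form an instance under excluded middle.
record Reals : Set (suc 0ℓ) where
  infix 4 _≤_
  field
    commutativeRing : CommutativeRing 0ℓ 0ℓ
  open CommutativeRing commutativeRing renaming (Carrier to ℝ) public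
  field
    _≤_          : Rel ℝ 0ℓ
    isTotalOrder : IsTotalOrder _≈_ _≤_
    0≉1          : ¬ (0# ≈ 1#)
    inverse      : ∀ x → ¬ (x ≈ 0#) → ∃[ y ] (x * y ≈ 1#)
    +-monoˡ-≤    : ∀ {x y} z → x ≤ y → x + z ≤ y + z
    *-nonneg     : ∀ {x y} → 0# ≤ x → 0# ≤ y → 0# ≤ x * y

  UpperBound : Pred ℝ 0ℓ → Pred ℝ 0ℓ
  UpperBound P u = ∀ x → x ∈ P → x ≤ u

  LeastUpperBound : Pred ℝ 0ℓ → Pred ℝ 0ℓ
  LeastUpperBound P s = s ∈ UpperBound P × (∀ u → u ∈ UpperBound P → s ≤ u)

  field
    complete : ∀ (P : Pred ℝ 0ℓ) → Satisfiable P → Satisfiable (UpperBound P) →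
               Satisfiable (LeastUpperBound P)

-- Classical analysis: excluded middle is an explicit parameter.
module Analysis (lem : ExcludedMiddle 0ℓ) (R : Reals) where

  open Reals R public

  totalOrder : TotalOrder 0ℓ 0ℓ 0ℓ
  totalOrder = record { isTotalOrder = isTotalOrder }

  open ToStrict _≈_ _≤_ using (_<_) public
  open Max totalOrder using (_⊔_) public
  open SemiringExp semiring using (_^_) public
  open SemiringMult semiring using () renaming (_×_ to _·_) public
  open MonoidSum +-monoid using (sum) public
  open AddExtremaNonStrict _≤_ using (_≤±_) public
  open AddExtremaStrict _<_ using (_<±_) public

  ------------------------------------------------------------------------
  -- Field operations and embeddings

  ∣_∣ : ℝ → ℝ
  ∣ x ∣ = x ⊔ (- x)

  infix 8 _⁻¹

  -- 0 ⁻¹ is set to 0.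
  _⁻¹ : ℝ → ℝ
  x ⁻¹ with lem {x ≈ 0#}
  ... | yes _   = 0#
  ... | no  x≉0 = proj₁ (inverse x x≉0)

  infixl 7 _/_

  _/_ : ℝ → ℝ → ℝ
  x / y = x * y ⁻¹

  fromℕ : ℕ → ℝ
  fromℕ n = n · 1#

  fromℤ : ℤ → ℝ
  fromℤ (+ n)    = fromℕ n
  fromℤ -[1+ n ] = - fromℕ (ℕ.suc n)

  fromℚ : ℚ → ℝ
  fromℚ r = fromℤ (↥ r) / fromℕ (↧ₙ r)

  IsRational : Pred ℝ 0ℓ
  IsRational x = ∃[ r ] (x ≈ fromℚ r)

  ------------------------------------------------------------------------
  -- Suprema, infima and limits in the extended reals

  ℝ± : Set
  ℝ± = ℝ ±

  neg± : ℝ± → ℝ±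
  neg± ⊥±    = ⊤±
  neg± [ x ] = [ - x ]
  neg± ⊤±    = ⊥±

  -- Below f has the same supremum as f; it is empty when f is nowhere above -∞,
  -- and unbounded as soon as f takes the value +∞.
  Below : {I : Set} → (I → ℝ±) → Pred ℝ 0ℓ
  Below f x = ∃[ i ] ([ x ] ≤± f i)

  ⨆ : {I : Set} → (I → ℝ±) → ℝ±
  ⨆ f with lem {Satisfiable (Below f)} | lem {Satisfiable (UpperBound (Below f))}
  ... | no  _  | _      = ⊥±
  ... | yes _  | no  _  = ⊤±
  ... | yes ne | yes bd = [ proj₁ (complete (Below f) ne bd) ]

  ⨅ : {I : Set} → (I → ℝ±) → ℝ±
  ⨅ f = neg± (⨆ (neg± ∘ f))

  liminf : {I : Set} → Rel I 0ℓ → (I → ℝ) → ℝ±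
  liminf {I} _≼_ f = ⨆ λ (N : I) → ⨅ λ ((i , _) : ∃[ i ] (N ≼ i)) → [ f i ]

  limsup : {I : Set} → Rel I 0ℓ → (I → ℝ) → ℝ±
  limsup {I} _≼_ f = ⨅ λ (N : I) → ⨆ λ ((i , _) : ∃[ i ] (N ≼ i)) → [ f i ]

  -- Real-valued suprema and infima; the value is set to 0 when the extended one
  -- is infinite.
  toℝ : ℝ± → ℝ
  toℝ ⊥±    = 0#
  toℝ [ x ] = x
  toℝ ⊤±    = 0#

  sup inf : {I : Set} → (I → ℝ) → ℝ
  sup f = toℝ (⨆ ([_] ∘ f))
  inf f = toℝ (⨅ ([_] ∘ f))

  TendsToZero : Pred (ℕ → ℝ) 0ℓ
  TendsToZero u = ∀ ε → 0# < ε → ∃[ N ] (∀ n → N ℕ.≤ n → ∣ u n ∣ < ε)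

  TendsToInfinity : Pred (ℕ → ℝ) 0ℓ
  TendsToInfinity u = ∀ M → ∃[ N ] (∀ n → N ℕ.≤ n → M ≤ u n)

  ------------------------------------------------------------------------
  -- Roots and real powers

  -- The nonnegative n-th root, for n ≥ 1 and x ≥ 0.
  root : ℕ → ℝ → ℝ
  root n x = sup λ ((y , _) : ∃[ y ] (0# ≤ y × y ^ n ≤ x)) → y

  _^ℤ_ : ℝ → ℤ → ℝ
  x ^ℤ (+ n)    = x ^ n
  x ^ℤ -[1+ n ] = (x ^ ℕ.suc n) ⁻¹

  _^ℚ_ : ℝ → ℚ → ℝ
  x ^ℚ r = root (↧ₙ r) (x ^ℤ (↥ r))

  -- x ^ℝ t = sup { x ^ r : r rational, r ≤ t }.  This is the usual power for
  -- x ≥ 1 and is not meaningful for smaller x.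
  _^ℝ_ : ℝ → ℝ → ℝ
  x ^ℝ t = sup λ ((r , _) : ∃[ r ] (fromℚ r ≤ t)) → x ^ℚ r

  ------------------------------------------------------------------------
  -- Euclidean space

  Point : ℕ → Set
  Point d = Vector ℝ d

  dist : ∀ {d} → Point d → Point d → ℝ
  dist z w = root 2 (sum λ i → (z i - w i) ^ 2)

  record Ball (d : ℕ) : Set where
    field
      centre   : Point d
      radius   : ℝ
      positive : 0# < radius

    closed : Pred (Point d) 0ℓ
    closed z = dist z centre ≤ radius

  open Ball public

  record Hyperplane (d : ℕ) : Set where
    field
      normal  : Point d
      nonzero : ∃[ i ] ¬ (normal i ≈ 0#)
      offset  : ℝ

    points : Pred (Point d) 0ℓ
    points w = sum (λ i → normal i * w i) ≈ offset

  open Hyperplane public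

  neighbourhood : ∀ {d} → Hyperplane d → ℝ → Pred (Point d) 0ℓ
  neighbourhood L r z = inf (λ ((w , _) : ∃[ w ] (w ∈ points L)) → dist z w) ≤ r

  ------------------------------------------------------------------------
  -- The hyperplane absolute game

  record AliceMove {d : ℕ} (β : ℝ) (B : Ball d) : Set where
    field
      plane    : Hyperplane d
      width    : ℝ
      positive : 0# < width
      legal    : width ≤ β * radius B

    removed : Pred (Point d) 0ℓ
    removed = neighbourhood plane width

  open AliceMove public using (removed)

  -- A strategy sees Bob's earlier balls, most recent first, and his current one.
  Strategy : ℕ → ℝ → Set
  Strategy d β = List (Ball d) → (B : Ball d) → AliceMove β B

  module _ {d : ℕ} {β : ℝ} (σ : Strategy d β) where

    response : (B : ℕ → Ball d) (n : ℕ) → AliceMove β (B n)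
    response B n = σ (applyDownFrom B n) (B n)

    -- Bob's balls in an infinite legal play against σ.
    record LegalPlay (U : Pred (Point d) 0ℓ) (B : ℕ → Ball d) : Set where
      field
        start  : closed (B 0) ⊆ U
        nested : ∀ n → closed (B (ℕ.suc n)) ⊆ closed (B n)
        avoids : ∀ n z → z ∈ closed (B (ℕ.suc n)) → z ∉ removed (response B n)
        size   : ∀ n → β * radius (B n) ≤ radius (B (ℕ.suc n))

    -- Plays in which Bob gets stuck, or in which the radii do not tend to 0, are
    -- won by Alice and hence impose no condition.
    Winning : (U S : Pred (Point d) 0ℓ) → Set
    Winning U S = ∀ B → LegalPlay U B → TendsToZero (radius ∘ B) →
                  ∃[ z ] ((∀ n → z ∈ closed (B n)) × z ∈ S)

  HAW : ∀ {d} → (U S : Pred (Point d) 0ℓ) → Set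
  HAW {d} U S = ∀ β → 0# < β → β < 1# / fromℕ 3 →
                Σ[ σ ∈ Strategy d β ] Winning σ U S

  Image : ∀ {X : Set} {d} → (X → Point d) → Pred X 0ℓ → Pred (Point d) 0ℓ
  Image φ S t = ∃[ p ] (p ∈ S × (∀ i → φ p i ≈ t i))

  -- HAW on a manifold, relative to an atlas with chart domains U and charts φ.
  HAWOn : ∀ {X A : Set} {d} → (U : A → Pred X 0ℓ) → (φ : A → X → Point d) →
          Pred X 0ℓ → Set
  HAWOn U φ S = ∀ α → HAW (Image (φ α) (U α)) (Image (φ α) (S ∩ U α))

  ------------------------------------------------------------------------
  -- Diophantine approximation in the plane

  ℝ² : Set
  ℝ² = ℝ × ℝ

  ⟨_⟩ : ℝ → ℝ
  ⟨ x ⟩ = inf λ (n : ℤ) → ∣ x - fromℤ n ∣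

  -- Q · min over integers 1 ≤ q ≤ Q of ⟨qx⟩⟨qy⟩; the range is nonempty only for
  -- Q ≥ 1.
  scaledMin : ℝ² → ℝ → ℝ
  scaledMin (x , y) Q =
    Q * inf λ ((q , _) : ∃[ q ] (1 ℕ.≤ q × fromℕ q ≤ Q)) →
          ⟨ fromℕ q * x ⟩ * ⟨ fromℕ q * y ⟩

  E : Pred ℝ² 0ℓ
  E p = [ 0# ] <± limsup _≤_ (λ Q → scaledMin p Q)

  E[_] : (ℕ → ℝ) → Pred ℝ² 0ℓ
  E[ Q ] p = [ 0# ] <± liminf ℕ._≤_ (λ m → scaledMin p (Q m))

  Line : ℝ → ℝ → Pred ℝ² 0ℓ
  Line a b (x , y) = y ≈ a * x + b

  -- The line is covered by the single global chart (x , y) ↦ x; as affine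
  -- hyperplanes of ℝ are points, HAW there is the absolute winning property.
  AbsolutelyWinningOnLine : ℝ → ℝ → Pred ℝ² 0ℓ → Set
  AbsolutelyWinningOnLine a b =
    HAWOn {A = ⊤} {d = 1} (λ _ → Line a b) (λ _ (x , _) _ → x)

  record IsAdmissible (Q : ℕ → ℝ) : Set where
    field
      positive   : ∀ m → 0# < Q m
      increasing : ∀ m → Q m < Q (ℕ.suc m)
      1<Q₀       : 1# < Q 0
      unbounded  : TendsToInfinity Q
      growth     : ∃[ τ ] (1# < τ × 0# < inf (λ m → Q (ℕ.suc m) / (Q m ^ℝ τ)))

  -- The term q = 0 does not affect the lower limit.
  DiophantineCondition : ℝ → ℝ → Set
  DiophantineCondition a b =
    ∃[ ε ] (0# < ε ×
      [ 0# ] <± liminf ℕ._≤_ (λ q →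
        (fromℕ q ^ℝ (fromℕ 2 - ε)) * (⟨ fromℕ q * a ⟩ ⊔ ⟨ fromℕ q * b ⟩)))

{-# OPTIONS --safe #-}
-- It suffices to win for E_Q, which is contained in E.  Fix m and put Q = Q_m = P².
-- A point t of the line is bad for Q if, up to exchanging the coordinates, there is a
-- rational point v = (p/q , r/q) with q ≤ Q and |q x − p| · max (|L| , 1/P) ≪ 1/Q,
-- where L = a p + b q − r measures how far v is from the line.  Let S = 1/β, and say
-- that v has class i if Q/q ≈ S³ⁱ.  Alice takes notice of v when the radius of Bob's
-- ball is about Sⁱ times the length of its bad interval.  If two points of the same
-- class are noticed at the same ball, they span a rational line w = v₁ × v₂ that is
-- nearly parallel to the given one there; such lines are noticed at an earlier stage,
-- and if two of them are noticed at once, they meet in a rational point v = w₁ × w₂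
-- whose neighbourhood has been left before.  Hence each class contributes at most one
-- point and one line per ball.  The Diophantine condition ensures that no such line
-- matters before the first ball, and the growth condition that only boundedly many m
-- matter at a given radius.
--
-- Thus at each turn Alice receives finitely many targets, those of class i having to
-- be left within l₀ + i turns.  Giving weight (2/3)ᵈ to a target that is due in d
-- turns, she removes a neighbourhood of the weighted median of the pending targets:
-- Bob then keeps at most half of their mass, while ageing multiplies it by 3/2 only.
-- So the mass stays below 1 and no target is ever due.
--
-- On a rational line, Dirichlet's theorem applied along multiples of a common
-- denominator of a and b gives ⟨q x⟩ ⟨q y⟩ ≪ 1/N² for some q ≪ N.
module Submission where

open import Level using (0ℓ)
open import Algebra.Bundles using (RawRing)
open import Axiom.ExcludedMiddle using (ExcludedMiddle)
open import Data.Bool.Base using (Bool; true; false)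
open import Data.Empty using (⊥; ⊥-elim)
open import Data.Fin.Base using (Fin; zero; suc; toℕ; fromℕ<)
open import Data.Fin.Properties using (pigeonhole; toℕ-fromℕ<; toℕ<n)
open import Data.Integer.Base as ℤ using (ℤ; +_; -[1+_]; +[1+_])
open import Data.List.Base using (List; []; _∷_; _++_; map; applyDownFrom)
open import Data.List.Membership.Propositional using () renaming (_∈_ to _∈ₗ_)
open import Data.List.Membership.Propositional.Properties using (∈-++⁺ˡ; ∈-++⁺ʳ; ∈-++⁻)
open import Data.List.Relation.Unary.Any using (here; there)
open import Data.Maybe.Base using (Maybe; just; nothing)
open import Data.Nat.Base as ℕ using (ℕ; zero; suc)
open import Data.Product.Base using (_×_; _,_; ∃; ∃-syntax; proj₁; proj₂; ∃₂)
open import Data.Rational.Base using (ℚ; mkℚ)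
open import Data.Sum.Base using (_⊎_; inj₁; inj₂; [_,_]′)
open import Data.Unit.Base using (⊤; tt)
open import Function.Base using (_∘_; case_of_)
open import Relation.Binary.PropositionalEquality.Core as ≡ using (_≡_)
open import Relation.Nullary using (¬_; yes; no)
open import Relation.Nullary.Decidable using (decidable-stable)
open import Relation.Nullary.Construct.Add.Extrema using (⊥±; ⊤±; [_])
open import Relation.Unary using (Pred; _∈_; _∩_; Empty; Satisfiable)
import Algebra.Construct.NaturalChoice.Max as Max
import Algebra.Properties.Ring as RingProperties
import Algebra.Properties.Semiring.Exp as SemiringExp
import Algebra.Properties.Semiring.Mult as SemiringMult
import Algebra.Properties.Semiring.Mult.TCOptimised as SemiringMult′
import Algebra.Solver.Ring as RingSolver
import Algebra.Solver.Ring.AlmostCommutativeRing as ACR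
import Data.Integer.Properties as ℤ
import Data.Nat.Properties as ℕ
open import Data.Nat.Coprimality using (Coprime; coprime-+; 1-coprimeTo)
open import Data.Nat.Induction using (<-rec)
import Relation.Binary.Construct.Add.Extrema.NonStrict as NonStrict±
import Relation.Binary.Construct.Add.Supremum.NonStrict as NonStrict⁺
import Relation.Binary.Construct.Add.Extrema.Strict as Strict±
import Relation.Binary.Reasoning.PartialOrder as PosetReasoning
import Relation.Binary.Reasoning.Setoid as SetoidReasoning
open import Relation.Binary.Definitions using (tri<; tri≈; tri>)
open import Relation.Binary.Structures using (IsTotalOrder)
open import Relation.Binary.Bundles using (TotalOrder)
open import Defs

-- The number of classes of an index grows like log Q and is unbounded, so a common delay would not
-- keep the fresh weight bounded. It becomes summable because class i is granted i additional turns,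
-- and this is affordable only because the ball is then larger than the bad interval by another
-- factor Sⁱ. Noticing targets so early costs powers of Sⁱ in every estimate, and the small
-- denominators of class i have to pay for them. Suppose they were about P²/Sⁿⁱ. The line through
-- two points noticed together has a second coefficient of order at most P S^((1-n)i). Its own bad
-- interval is already longer by Sⁱ, so to be left in time it must be noticed at the scale S²ⁱ.
-- Where two such lines meet, both the error of the point and the product deciding when it should
-- have been noticed are then of order S^((3-n)i). Thus n = 3 is the least exponent for which the
-- intersection is again a bad point that is long overdue, and the alternation between points and
-- lines closes up.

module Proof (lem : ExcludedMiddle 0ℓ) (R : Reals) where

  open Analysis lem R hiding (zero)

  -- Integers in the field, and a ring solver with integer coefficients.

  open RingProperties ring using (-‿distribˡ-*; -‿distribʳ-*; -0#≈0#; -‿involutive; -‿+-comm)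
  private module U = SemiringMult semiring
  private module T = SemiringMult′ semiring

  -- With these optimised multiples `♯ 1` reduces to `1#`, so that `con (+ 1)` denotes `1#` itself
  -- in solver equations; `fromℕ 1` is `1# + 0#`.
  ♯_ : ℕ → ℝ
  ♯ n = n T.× 1#

  infix 9 ♯_

  fromℕ≈♯ : ∀ n → fromℕ n ≈ ♯ n
  fromℕ≈♯ n = T.×ᵤ≈× n 1#

  fromℕ-+ : ∀ m n → fromℕ (m ℕ.+ n) ≈ fromℕ m + fromℕ n
  fromℕ-+ = U.×-homo-+ 1#

  fromℕ-* : ∀ m n → fromℕ (m ℕ.* n) ≈ fromℕ m * fromℕ n
  fromℕ-* = U.×1-homo-*

  private
    cancel-1 : ∀ x y → x - y ≈ (1# + x) - (1# + y)
    cancel-1 x y = sym (begin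
      (1# + x) + - (1# + y)       ≈⟨ +-congˡ (sym (-‿+-comm 1# y)) ⟩
      (1# + x) + (- 1# + - y)     ≈⟨ sym (+-assoc _ _ _) ⟩
      ((1# + x) + - 1#) + - y     ≈⟨ +-congʳ (+-congʳ (+-comm 1# x)) ⟩
      ((x + 1#) + - 1#) + - y     ≈⟨ +-congʳ (+-assoc x 1# (- 1#)) ⟩
      (x + (1# + - 1#)) + - y     ≈⟨ +-congʳ (+-congˡ (-‿inverseʳ 1#)) ⟩
      (x + 0#) + - y              ≈⟨ +-congʳ (+-identityʳ x) ⟩
      x + - y                     ∎)
      where open SetoidReasoning setoid

  fromℤ-⊖ : ∀ m n → fromℤ (m ℤ.⊖ n) ≈ fromℕ m - fromℕ n
  fromℤ-⊖ m zero = sym (trans (+-congˡ -0#≈0#) (+-identityʳ _))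
  fromℤ-⊖ zero (suc n) = sym (+-identityˡ _)
  fromℤ-⊖ (suc m) (suc n) = trans (reflexive (≡.cong fromℤ (ℤ.[1+m]⊖[1+n]≡m⊖n m n)))
    (trans (fromℤ-⊖ m n) (cancel-1 (fromℕ m) (fromℕ n)))

  fromℤ-neg : ∀ i → fromℤ (ℤ.- i) ≈ - fromℤ i
  fromℤ-neg (+ zero) = sym -0#≈0#
  fromℤ-neg (+ suc n) = refl
  fromℤ-neg -[1+ n ] = sym (-‿involutive _)

  fromℤ-+ : ∀ i j → fromℤ (i ℤ.+ j) ≈ fromℤ i + fromℤ j
  fromℤ-+ (+ m) (+ n) = fromℕ-+ m n
  fromℤ-+ (+ m) -[1+ n ] = fromℤ-⊖ m (suc n)
  fromℤ-+ -[1+ m ] (+ n) = trans (fromℤ-⊖ n (suc m)) (+-comm _ _)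
  fromℤ-+ -[1+ m ] -[1+ n ] = trans (-‿cong (trans (reflexive (≡.cong (λ k → fromℕ (suc k)) (≡.sym (ℕ.+-suc m n))))
    (fromℕ-+ (suc m) (suc n)))) (sym (-‿+-comm _ _))

  fromℤ-* : ∀ i j → fromℤ (i ℤ.* j) ≈ fromℤ i * fromℤ j
  fromℤ-* (+ m) (+ n) = trans (reflexive (≡.cong fromℤ (ℤ.+◃n≡+n (m ℕ.* n)))) (fromℕ-* m n)
  fromℤ-* (+ m) -[1+ n ] = trans (reflexive (≡.cong fromℤ (ℤ.-◃n≡-n (m ℕ.* suc n))))
    (trans (fromℤ-neg (+ (m ℕ.* suc n))) (trans (-‿cong (fromℕ-* m (suc n))) (-‿distribʳ-* _ _)))
  fromℤ-* -[1+ m ] (+ n) = trans (reflexive (≡.cong fromℤ (ℤ.-◃n≡-n (suc m ℕ.* n))))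
    (trans (fromℤ-neg (+ (suc m ℕ.* n))) (trans (-‿cong (fromℕ-* (suc m) n)) (-‿distribˡ-* _ _)))
  fromℤ-* -[1+ m ] -[1+ n ] = trans (fromℕ-* (suc m) (suc n))
    (sym (trans (sym (-‿distribˡ-* _ _)) (trans (-‿cong (sym (-‿distribʳ-* _ _))) (-‿involutive _))))

  fromℤ-- : ∀ i j → fromℤ (i ℤ.- j) ≈ fromℤ i - fromℤ j
  fromℤ-- i j = trans (fromℤ-+ i (ℤ.- j)) (+-congˡ (fromℤ-neg j))

  private
    ιℤ : ℤ → ℝ
    ιℤ (+ n) = ♯ n
    ιℤ -[1+ n ] = - (♯ suc n)

    ι≈ : ∀ i → ιℤ i ≈ fromℤ i
    ι≈ (+ n) = sym (fromℕ≈♯ n)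
    ι≈ -[1+ n ] = -‿cong (sym (fromℕ≈♯ (suc n)))

    ℤring : RawRing 0ℓ 0ℓ
    ℤring = record { Carrier = ℤ ; _≈_ = _≡_ ; _+_ = ℤ._+_ ; _*_ = ℤ._*_ ; -_ = ℤ.-_ ; 0# = + 0 ; 1# = + 1 }

    acr : ACR.AlmostCommutativeRing 0ℓ 0ℓ
    acr = ACR.fromCommutativeRing commutativeRing

    morphism : ℤring ACR.-Raw-AlmostCommutative⟶ acr
    morphism = record
      { ⟦_⟧ = ιℤ
      ; +-homo = λ i j → trans (ι≈ (i ℤ.+ j)) (trans (fromℤ-+ i j) (sym (+-cong (ι≈ i) (ι≈ j))))
      ; *-homo = λ i j → trans (ι≈ (i ℤ.* j)) (trans (fromℤ-* i j) (sym (*-cong (ι≈ i) (ι≈ j))))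
      ; -‿homo = λ i → trans (ι≈ (ℤ.- i)) (trans (fromℤ-neg i) (sym (-‿cong (ι≈ i))))
      ; 0-homo = refl
      ; 1-homo = refl
      }

  private
    sameCoefficient : ∀ i j → Maybe (ιℤ i ≈ ιℤ j)
    sameCoefficient i j with i ℤ.≟ j
    ... | yes i≡j = just (reflexive (≡.cong ιℤ i≡j))
    ... | no _ = nothing

  open RingSolver ℤring acr morphism
    sameCoefficient
    using (solve; con; _:+_; _:*_; _:-_; :-_; _:^_; _:=_) public

  -- Order, inverses, absolute values and powers.

  open IsTotalOrder isTotalOrder using ()
    renaming (refl to ≤-refl; reflexive to ≤-reflexive; trans to ≤-trans; antisym to ≤-antisym; total to ≤-total;
              ≤-respˡ-≈ to ≤-respˡ; ≤-respʳ-≈ to ≤-respʳ) public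

  open PosetReasoning (TotalOrder.poset totalOrder) hiding (start; strict)

  -- Inequalities are reduced to a ring identity exhibiting the difference as a nonnegative expression.
  by≤ : ∀ {x y s} → 0# ≤ s → y ≈ x + s → x ≤ y
  by≤ {x} {y} {s} p e = ≤-respʳ (sym e) (≤-respˡ (+-identityˡ x) (≤-respʳ (+-comm s x) (+-monoˡ-≤ x p)))

  0≤sub : ∀ {x y} → x ≤ y → 0# ≤ y - x
  0≤sub {x} {y} p = ≤-respˡ (-‿inverseʳ x) (+-monoˡ-≤ (- x) p)

  0≤+ : ∀ {x y} → 0# ≤ x → 0# ≤ y → 0# ≤ x + y
  0≤+ {x} {y} p q = ≤-trans q (≤-respˡ (+-identityˡ y) (+-monoˡ-≤ y p))

  open Max totalOrder using (x≤x⊔y; x≤y⊔x; ⊔-lub; ⊔-sel; ⊔-cong; ⊔-comm; x≤y⇒x⊔y≈y; x≤y⇒y⊔x≈y)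

  <⇒≤ : ∀ {x y} → x < y → x ≤ y
  <⇒≤ = proj₁

  <⇒≱ : ∀ {x y} → x < y → ¬ (y ≤ x)
  <⇒≱ (x≤y , x≉y) y≤x = x≉y (≤-antisym x≤y y≤x)

  ≰⇒> : ∀ {x y} → ¬ (x ≤ y) → y < x
  ≰⇒> {x} {y} x≰y with ≤-total x y
  ... | inj₁ x≤y = ⊥-elim (x≰y x≤y)
  ... | inj₂ y≤x = y≤x , λ y≈x → x≰y (≤-reflexive (sym y≈x))

  ≮⇒≥ : ∀ {x y} → ¬ (x < y) → y ≤ x
  ≮⇒≥ {x} {y} x≮y with lem {y ≤ x}
  ... | yes y≤x = y≤x
  ... | no  y≰x = ⊥-elim (x≮y (≰⇒> y≰x))

  ≤-or-> : ∀ x y → x ≤ y ⊎ y < x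
  ≤-or-> x y with lem {x ≤ y}
  ... | yes p = inj₁ p
  ... | no ¬p = inj₂ (≰⇒> ¬p)

  <-≤-trans : ∀ {x y z} → x < y → y ≤ z → x < z
  <-≤-trans x<y y≤z = ≰⇒> λ z≤x → <⇒≱ x<y (≤-trans y≤z z≤x)

  ≤-<-trans : ∀ {x y z} → x ≤ y → y < z → x < z
  ≤-<-trans x≤y y<z = ≰⇒> λ z≤x → <⇒≱ y<z (≤-trans z≤x x≤y)

  <-trans : ∀ {x y z} → x < y → y < z → x < z
  <-trans x<y y<z = <-≤-trans x<y (<⇒≤ y<z)

  <-irrefl : ∀ {x} → ¬ (x < x)
  <-irrefl p = <⇒≱ p ≤-refl

  neg-mono : ∀ {x y} → x ≤ y → - y ≤ - x
  neg-mono {x} {y} p = (by≤ (0≤sub p) (solve 2 (λ a b → :- a := (:- b) :+ (b :- a)) refl x y))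

  0≤□ : ∀ x → 0# ≤ x * x
  0≤□ x with ≤-total 0# x
  ... | inj₁ p = *-nonneg p p
  ... | inj₂ p = (by≤ (*-nonneg (0≤sub p) (0≤sub p)) (solve 1 (λ a → a :* a := (con (+ 0)) :+ ((con (+ 0)) :- a) :* ((con (+ 0)) :- a)) refl x))

  0≤1 : 0# ≤ 1#
  0≤1 = (by≤ (0≤□ (1#)) (solve 1 (λ a → con (+ 1) := (con (+ 0)) :+ (con (+ 1)) :* (con (+ 1))) refl 0#))

  0<1 : 0# < 1#
  0<1 = 0≤1 , 0≉1

  0≤♯ : ∀ n → 0# ≤ fromℕ n
  0≤♯ zero = ≤-refl
  0≤♯ (suc n) = 0≤+ 0≤1 (0≤♯ n)

  0≤# : ∀ n → 0# ≤ ♯ n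
  0≤# n = ≤-respʳ (fromℕ≈♯ n) (0≤♯ n)

  +-mono-≤ : ∀ {x y u v} → x ≤ y → u ≤ v → x + u ≤ y + v
  +-mono-≤ {x} {y} {u} {v} p q = (by≤ (0≤+ (0≤sub p) (0≤sub q)) (solve 4 (λ a b c d → a :+ b := c :+ d :+ (a :- c :+ (b :- d))) refl y v x u))

  *-mono : ∀ {x y u v} → 0# ≤ x → x ≤ y → 0# ≤ u → u ≤ v → x * u ≤ y * v
  *-mono {x} {y} {u} {v} 0≤x p 0≤u q =
    (by≤ (0≤+ (*-nonneg (0≤sub p) (≤-trans 0≤u q)) (*-nonneg 0≤x (0≤sub q))) (solve 4 (λ a b c d → a :* b := c :* d :+ ((a :- c) :* b :+ c :* (b :- d))) refl y v x u))

  *-monoˡ : ∀ {x y} z → 0# ≤ z → x ≤ y → z * x ≤ z * y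
  *-monoˡ {x} {y} z 0≤z p = (by≤ (*-nonneg 0≤z (0≤sub p)) (solve 3 (λ a b c → a :* b := a :* c :+ a :* (b :- c)) refl z y x))

  *-monoʳ : ∀ {x y} z → 0# ≤ z → x ≤ y → x * z ≤ y * z
  *-monoʳ {x} {y} z 0≤z p = (by≤ (*-nonneg 0≤z (0≤sub p)) (solve 3 (λ a b c → a :* b := c :* b :+ b :* (a :- c)) refl y z x))

  pos≉0 : ∀ {x} → 0# < x → ¬ (x ≈ 0#)
  pos≉0 p e = proj₂ p (sym e)

  *-zero-cancel : ∀ {x y} → x * y ≈ 0# → ¬ (y ≈ 0#) → x ≈ 0#
  *-zero-cancel {x} {y} e y≉0 = let (z , yz≈1) = inverse y y≉0 in begin-equality
    x ≈⟨ solve 1 (λ a → a := a :* (con (+ 1))) refl x ⟩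
    x * 1# ≈⟨ *-congˡ (sym yz≈1) ⟩
    x * (y * z) ≈⟨ solve 3 (λ a b c → a :* (b :* c) := a :* b :* c) refl x y z ⟩
    (x * y) * z ≈⟨ *-congʳ e ⟩
    0# * z ≈⟨ solve 1 (λ a → (con (+ 0)) :* a := con (+ 0)) refl z ⟩
    0# ∎

  *-pos : ∀ {x y} → 0# < x → 0# < y → 0# < x * y
  *-pos p q = *-nonneg (<⇒≤ p) (<⇒≤ q) , λ e → pos≉0 p (*-zero-cancel (sym e) (pos≉0 q))

  +-pos : ∀ {x y} → 0# < x → 0# ≤ y → 0# < x + y
  +-pos {x} {y} p q = <-≤-trans p ((by≤ q (solve 2 (λ a b → a :+ b := a :+ b) refl x y)))

  *-cancelʳ-≤ : ∀ {x y} z → 0# < z → x * z ≤ y * z → x ≤ y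
  *-cancelʳ-≤ {x} {y} z p q with ≤-total x y
  ... | inj₁ x≤y = x≤y
  ... | inj₂ y≤x = ≤-reflexive (trans ((solve 2 (λ a b → a := a :- b :+ b) refl x y)) (trans (+-congʳ x-y≈0) (+-identityˡ y)))
    where
    yz≤xz : y * z ≤ x * z
    yz≤xz = *-monoʳ z (<⇒≤ p) y≤x
    x-y≈0 : x - y ≈ 0#
    x-y≈0 = *-zero-cancel (trans ((solve 3 (λ a b c → (a :- b) :* c := a :* c :- b :* c) refl x y z)) (trans (+-congʳ (≤-antisym q yz≤xz)) (-‿inverseʳ (y * z)))) (pos≉0 p)

  *-cancelˡ-≤ : ∀ {x y} z → 0# < z → z * x ≤ z * y → x ≤ y
  *-cancelˡ-≤ z p q = *-cancelʳ-≤ z p (≤-respˡ (*-comm z _) (≤-respʳ (*-comm z _) q))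

  pos-cancel : ∀ {x} z → 0# ≤ z → 0# < x * z → 0# < x
  pos-cancel {x} z 0≤z p = ≰⇒> λ x≤0 → <⇒≱ p (≤-respʳ (zeroˡ z) (*-monoʳ z 0≤z x≤0))

  ⁻¹-inverse : ∀ x → ¬ (x ≈ 0#) → x * x ⁻¹ ≈ 1#
  ⁻¹-inverse x x≉0 with lem {x ≈ 0#}
  ... | yes e = ⊥-elim (x≉0 e)
  ... | no ne = proj₂ (inverse x ne)

  ⁻¹-zero : ∀ x → x ≈ 0# → x ⁻¹ ≈ 0#
  ⁻¹-zero x x≈0 with lem {x ≈ 0#}
  ... | yes e = refl
  ... | no ne = ⊥-elim (ne x≈0)

  x⁻¹x : ∀ {x} → 0# < x → x * x ⁻¹ ≈ 1#
  x⁻¹x p = ⁻¹-inverse _ (pos≉0 p)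

  ⁻¹-pos : ∀ {x} → 0# < x → 0# < x ⁻¹
  ⁻¹-pos {x} p = pos-cancel x (<⇒≤ p) (<-≤-trans 0<1 (≤-reflexive (trans (sym (x⁻¹x p)) (*-comm x _))))

  x≤∣x∣ : ∀ x → x ≤ ∣ x ∣
  x≤∣x∣ x = x≤x⊔y x (- x)

  -x≤∣x∣ : ∀ x → - x ≤ ∣ x ∣
  -x≤∣x∣ x = x≤y⊔x x (- x)

  ∣∣≤ : ∀ {x c} → x ≤ c → - x ≤ c → ∣ x ∣ ≤ c
  ∣∣≤ = ⊔-lub

  0≤∣∣ : ∀ x → 0# ≤ ∣ x ∣
  0≤∣∣ x with ≤-total 0# x
  ... | inj₁ p = ≤-trans p (x≤∣x∣ x)
  ... | inj₂ p = ≤-trans ((by≤ (0≤sub p) (solve 1 (λ a → :- a := (con (+ 0)) :+ ((con (+ 0)) :- a)) refl x))) (-x≤∣x∣ x)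

  ∣∣-nonneg : ∀ {x} → 0# ≤ x → ∣ x ∣ ≈ x
  ∣∣-nonneg {x} p = ≤-antisym (∣∣≤ ≤-refl ((by≤ (0≤+ p p) (solve 1 (λ a → a := (:- a) :+ (a :+ a)) refl x)))) (x≤∣x∣ x)

  ∣∣-cong : ∀ {x y} → x ≈ y → ∣ x ∣ ≈ ∣ y ∣
  ∣∣-cong e = ⊔-cong e (-‿cong e)

  ∣-∣ : ∀ x → ∣ - x ∣ ≈ ∣ x ∣
  ∣-∣ x = trans (⊔-cong refl (-‿involutive x)) (⊔-comm (- x) x)

  ∣∣-sign : ∀ x → (0# ≤ x × ∣ x ∣ ≈ x) ⊎ (x ≤ 0# × ∣ x ∣ ≈ - x)
  ∣∣-sign x with ≤-total 0# x
  ... | inj₁ p = inj₁ (p , ∣∣-nonneg p)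
  ... | inj₂ p = inj₂ (p , trans (sym (∣-∣ x)) (∣∣-nonneg ((by≤ (0≤sub p) (solve 1 (λ a → :- a := (con (+ 0)) :+ ((con (+ 0)) :- a)) refl x)))))

  ∣+∣≤ : ∀ x y → ∣ x + y ∣ ≤ ∣ x ∣ + ∣ y ∣
  ∣+∣≤ x y = ∣∣≤ (+-mono-≤ (x≤∣x∣ x) (x≤∣x∣ y))
    (≤-respˡ ((solve 2 (λ a b → (:- a) :+ (:- b) := :- (a :+ b)) refl x y)) (+-mono-≤ (-x≤∣x∣ x) (-x≤∣x∣ y)))

  ∣-∣≤ : ∀ x y → ∣ x - y ∣ ≤ ∣ x ∣ + ∣ y ∣
  ∣-∣≤ x y = ≤-trans (∣+∣≤ x (- y)) (≤-reflexive (+-congˡ (∣-∣ y)))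

  ∣*∣ : ∀ x y → ∣ x * y ∣ ≈ ∣ x ∣ * ∣ y ∣
  ∣*∣ x y with ∣∣-sign x | ∣∣-sign y
  ... | inj₁ (p , e) | inj₁ (q , f) = trans (∣∣-nonneg (*-nonneg p q)) (sym (*-cong e f))
  ... | inj₁ (p , e) | inj₂ (q , f) = trans (sym (∣-∣ _)) (trans (∣∣-nonneg ((by≤ (*-nonneg p (0≤sub q)) (solve 2 (λ a b → :- (a :* b) := (con (+ 0)) :+ a :* ((con (+ 0)) :- b)) refl x y))))
    (trans ((solve 2 (λ a b → :- (a :* b) := a :* (:- b)) refl x y)) (sym (*-cong e f))))
  ... | inj₂ (p , e) | inj₁ (q , f) = trans (sym (∣-∣ _)) (trans (∣∣-nonneg ((by≤ (*-nonneg (0≤sub p) q) (solve 2 (λ a b → :- (a :* b) := (con (+ 0)) :+ ((con (+ 0)) :- a) :* b) refl x y))))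
    (trans ((solve 2 (λ a b → :- (a :* b) := (:- a) :* b) refl x y)) (sym (*-cong e f))))
  ... | inj₂ (p , e) | inj₂ (q , f) = trans (∣∣-nonneg ((by≤ (*-nonneg (0≤sub p) (0≤sub q)) (solve 2 (λ a b → a :* b := (con (+ 0)) :+ ((con (+ 0)) :- a) :* ((con (+ 0)) :- b)) refl x y))))
    (trans ((solve 2 (λ a b → a :* b := (:- a) :* (:- b)) refl x y)) (sym (*-cong e f)))

  ∣∣≤0 : ∀ {x} → ∣ x ∣ ≤ 0# → x ≈ 0#
  ∣∣≤0 {x} p = ≤-antisym (≤-trans (x≤∣x∣ x) p) ((by≤ (0≤sub (≤-trans (-x≤∣x∣ x) p)) (solve 1 (λ a → a := (con (+ 0)) :+ ((con (+ 0)) :- (:- a))) refl x)))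

  fromℕ-mono : ∀ {m n} → m ℕ.≤ n → fromℕ m ≤ fromℕ n
  fromℕ-mono {n = n} ℕ.z≤n = 0≤♯ n
  fromℕ-mono (ℕ.s≤s {m} {n} p) = (by≤ (0≤sub (fromℕ-mono p)) (solve 2 (λ a b → (con (+ 1)) :+ a := (con (+ 1)) :+ b :+ (a :- b)) refl (fromℕ n) (fromℕ m)))

  fromℕ1 : fromℕ 1 ≈ 1#
  fromℕ1 = +-identityʳ 1#

  1≤fromℕ : ∀ {n} → 1 ℕ.≤ n → 1# ≤ fromℕ n
  1≤fromℕ p = ≤-respˡ fromℕ1 (fromℕ-mono p)

  fromℕ-pos : ∀ n → 0# < fromℕ (suc n)
  fromℕ-pos n = +-pos 0<1 (0≤♯ n)

  fromℕ-cancel : ∀ {m n} → fromℕ m ≤ fromℕ n → m ℕ.≤ n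
  fromℕ-cancel {m} {n} p with m ℕ.≤? n
  ... | yes q = q
  ... | no ¬q = ⊥-elim (<⇒≱ 0<1 ((by≤ (0≤+ (0≤sub (fromℕ-mono (ℕ.≰⇒> ¬q))) (0≤sub p)) (solve 2 (λ a b → con (+ 0) := (con (+ 1)) :+ (a :- ((con (+ 1)) :+ b) :+ (b :- a))) refl (fromℕ m) (fromℕ n)))))

  ♯-pos : ∀ n → 0# < ♯ suc n
  ♯-pos n = <-≤-trans (fromℕ-pos n) (≤-reflexive (fromℕ≈♯ (suc n)))

  ∣fromℤ∣ : ∀ i → ∣ fromℤ i ∣ ≈ fromℕ ℤ.∣ i ∣
  ∣fromℤ∣ (+ n) = ∣∣-nonneg (0≤♯ n)
  ∣fromℤ∣ -[1+ n ] = trans (∣-∣ _) (∣∣-nonneg (0≤♯ (suc n)))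

  1≤∣fromℤ∣ : ∀ i → ¬ (i ≡ + 0) → 1# ≤ ∣ fromℤ i ∣
  1≤∣fromℤ∣ i i≢0 = ≤-respʳ (sym (∣fromℤ∣ i)) (1≤fromℕ (ℕ.n≢0⇒n>0 λ e → i≢0 (ℤ.∣i∣≡0⇒i≡0 e)))

  ∣fromℤ∣<1 : ∀ i → ∣ fromℤ i ∣ < 1# → i ≡ + 0
  ∣fromℤ∣<1 i p with i ℤ.≟ + 0
  ... | yes e = e
  ... | no ne = ⊥-elim (<⇒≱ p (1≤∣fromℤ∣ i ne))

  ^-pos : ∀ {x} n → 0# < x → 0# < x ^ n
  ^-pos zero p = 0<1
  ^-pos (suc n) p = *-pos p (^-pos n p)

  ^-nonneg : ∀ {x} n → 0# ≤ x → 0# ≤ x ^ n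
  ^-nonneg zero p = 0≤1
  ^-nonneg (suc n) p = *-nonneg p (^-nonneg n p)

  ^-mono : ∀ {x y} n → 0# ≤ x → x ≤ y → x ^ n ≤ y ^ n
  ^-mono zero p q = ≤-refl
  ^-mono (suc n) p q = *-mono p q (^-nonneg n p) (^-mono n p q)

  1≤^ : ∀ {x} n → 1# ≤ x → 1# ≤ x ^ n
  1≤^ zero p = ≤-refl
  1≤^ {x} (suc n) p = ≤-trans (1≤^ n p) (≤-respˡ (*-identityˡ _) (*-monoʳ (x ^ n) (^-nonneg n (≤-trans 0≤1 p)) p))

  ^≤1 : ∀ {x} n → 0# ≤ x → x ≤ 1# → x ^ n ≤ 1#
  ^≤1 zero p q = ≤-refl
  ^≤1 (suc n) p q = ≤-respʳ (*-identityˡ 1#) (*-mono p q (^-nonneg n p) (^≤1 n p q))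

  ^-monoʳ : ∀ {x m n} → 1# ≤ x → m ℕ.≤ n → x ^ m ≤ x ^ n
  ^-monoʳ {n = n} p ℕ.z≤n = 1≤^ n p
  ^-monoʳ {x} p (ℕ.s≤s q) = *-monoˡ x (≤-trans 0≤1 p) (^-monoʳ p q)

  ^-antiʳ : ∀ {x m n} → 0# ≤ x → x ≤ 1# → m ℕ.≤ n → x ^ n ≤ x ^ m
  ^-antiʳ {n = n} p p′ ℕ.z≤n = ^≤1 n p p′
  ^-antiʳ {x} p p′ (ℕ.s≤s q) = *-monoˡ x p (^-antiʳ p p′ q)

  ^-smono : ∀ {x y} n → 0# ≤ x → x < y → x ^ suc n < y ^ suc n
  ^-smono {x} {y} n p q = ≰⇒> λ r → <⇒≱ q (*-cancelʳ-≤ (y ^ n) (^-pos n (≤-<-trans p q))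
    (≤-trans r (*-monoˡ x p (^-mono n p (<⇒≤ q)))))

  ^-cancel : ∀ {x y} n → 0# ≤ y → x ^ suc n ≤ y ^ suc n → x ≤ y
  ^-cancel {x} {y} n p q with ≤-or-> x y
  ... | inj₁ r = r
  ... | inj₂ r = ⊥-elim (<⇒≱ (^-smono n p r) q)

  open SemiringExp semiring using (^-homo-*; ^-assocʳ; ^-congˡ)

  ^-distrib-* : ∀ x y n → (x * y) ^ n ≈ x ^ n * y ^ n
  ^-distrib-* x y zero = sym (*-identityˡ 1#)
  ^-distrib-* x y (suc n) = trans (*-congˡ (^-distrib-* x y n)) ((solve 4 (λ a b c d → a :* b :* (c :* d) := a :* c :* (b :* d)) refl x y (x ^ n) (y ^ n)))

  1^ : ∀ n → 1# ^ n ≈ 1#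
  1^ zero = refl
  1^ (suc n) = trans (*-identityˡ _) (1^ n)

  -- Extended suprema and infima, lower and upper limits.

  ≤±-trans : ∀ {k l m} → k ≤± l → l ≤± m → k ≤± m
  ≤±-trans = NonStrict±.≤±-trans _≤_ ≤-trans

  neg±-anti : ∀ {k l} → k ≤± l → neg± l ≤± neg± k
  neg±-anti NonStrict±.⊥±≤⊥± = NonStrict±._≤⊤± _≤_ _
  neg±-anti NonStrict±.⊥±≤[ l ] = NonStrict±._≤⊤± _≤_ _
  neg±-anti NonStrict±.[ p ] = NonStrict±.[ neg-mono p ]
  neg±-anti NonStrict±.⊥±≤⊤± = NonStrict±._≤⊤± _≤_ _
  neg±-anti NonStrict±.[ k ]≤⊤± = NonStrict±.⊥±≤_ _≤_ _
  neg±-anti NonStrict±.⊤±≤⊤± = NonStrict±.⊥±≤_ _≤_ _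

  neg±-neg± : ∀ k → neg± (neg± k) ≤± k
  neg±-neg± ⊥± = NonStrict±.⊥±≤⊥±
  neg±-neg± [ k ] = NonStrict±.[ ≤-reflexive (-‿involutive k) ]
  neg±-neg± ⊤± = NonStrict±.⊤±≤⊤±

  ≤±neg±-neg± : ∀ k → k ≤± neg± (neg± k)
  ≤±neg±-neg± ⊥± = NonStrict±.⊥±≤⊥±
  ≤±neg±-neg± [ k ] = NonStrict±.[ ≤-reflexive (sym (-‿involutive k)) ]
  ≤±neg±-neg± ⊤± = NonStrict±.⊤±≤⊤±

  ≤±-refl : ∀ k → k ≤± k
  ≤±-refl ⊥± = NonStrict±.⊥±≤⊥±
  ≤±-refl [ k ] = NonStrict±.[ ≤-refl ]
  ≤±-refl ⊤± = NonStrict±.⊤±≤⊤±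

  module _ {I : Set} (g : I → ℝ±) where

    ⨆-ub : ∀ i → g i ≤± ⨆ g
    ⨆-ub i with g i in eq
    ... | ⊥± = NonStrict±.⊥±≤_ _≤_ _
    ... | [ x ] with lem {Satisfiable (Below g)} | lem {Satisfiable (UpperBound (Below g))}
    ...   | no ne | _ = ⊥-elim (ne (x , i , ≡.subst ([ x ] ≤±_) (≡.sym eq) (≤±-refl _)))
    ...   | yes _ | no _ = NonStrict±._≤⊤± _≤_ _
    ...   | yes ne | yes bd = NonStrict±.[ proj₁ (proj₂ (complete (Below g) ne bd)) x (i , ≡.subst ([ x ] ≤±_) (≡.sym eq) (≤±-refl _)) ]
    ⨆-ub i | ⊤± with lem {Satisfiable (Below g)} | lem {Satisfiable (UpperBound (Below g))}
    ...   | no ne | _ = ⊥-elim (ne (0# , i , ≡.subst ([ 0# ] ≤±_) (≡.sym eq) NonStrict±.[ 0# ]≤⊤±))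
    ...   | yes _ | no _ = NonStrict±.⊤±≤⊤±
    ...   | yes _ | yes (u , u-ub) = ⊥-elim (<⇒≱ 0<1 ((by≤ (0≤sub (u-ub (u + 1#) (i , ≡.subst ([ u + 1# ] ≤±_) (≡.sym eq) NonStrict±.[ u + 1# ]≤⊤±))) (solve 1 (λ a → con (+ 0) := (con (+ 1)) :+ (a :- (a :+ (con (+ 1))))) refl u))))

    ⨆-lub : ∀ u → (∀ i → g i ≤± [ u ]) → ⨆ g ≤± [ u ]
    ⨆-lub u h with lem {Satisfiable (Below g)} | lem {Satisfiable (UpperBound (Below g))}
    ... | no ne | _ = NonStrict±.⊥±≤_ _≤_ _
    ... | yes _ | no nb = ⊥-elim (nb (u , λ x (i , p) → NonStrict±.[≤]-injective _≤_ (≤±-trans p (h i))))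
    ... | yes ne | yes bd = NonStrict±.[ proj₂ (proj₂ (complete (Below g) ne bd)) u (λ x (i , p) → NonStrict±.[≤]-injective _≤_ (≤±-trans p (h i))) ]

  module _ {I : Set} (g : I → ℝ±) where

    ⨅-lb : ∀ i → ⨅ g ≤± g i
    ⨅-lb i = ≤±-trans (neg±-anti (⨆-ub (neg± ∘ g) i)) (neg±-neg± (g i))

    ⨅-glb : ∀ u → (∀ i → [ u ] ≤± g i) → [ u ] ≤± ⨅ g
    ⨅-glb u h = ≤±-trans (≤±neg±-neg± [ u ]) (neg±-anti (⨆-lub (neg± ∘ g) (- u) λ i → neg±-anti (h i)))

    -- If no member exceeded `x`, then `x` would bound the supremum. A real `y` is returned because
    -- the member itself may be infinite.
    <⨆ : ∀ {x} → [ x ] <± ⨆ g → ∃[ i ] ∃[ y ] (x < y × [ y ] ≤± g i)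
    <⨆ {x} p with lem {∃[ i ] ∃[ y ] (x < y × [ y ] ≤± g i)}
    ... | yes r = r
    ... | no ¬r = ⊥-elim (contra (⨆ g) p (⨆-lub g x below))
      where
      contra : ∀ k → [ x ] <± k → ¬ (k ≤± [ x ])
      contra _ Strict±.[ p ] NonStrict±.[ q ] = <⇒≱ p q
      contra _ Strict±.[ _ ]<⊤± ()
      below : ∀ i → g i ≤± [ x ]
      below i with g i in eq
      ... | ⊥± = NonStrict±.⊥±≤_ _≤_ _
      ... | [ y ] = NonStrict±.[ ≮⇒≥ (λ x<y → ¬r (i , y , x<y , ≡.subst ([ y ] ≤±_) (≡.sym eq) (≤±-refl _))) ]
      ... | ⊤± = ⊥-elim (¬r (i , x + 1# , ≰⇒> (λ p → <⇒≱ 0<1 ((by≤ (0≤sub p) (solve 1 (λ a → con (+ 0) := (con (+ 1)) :+ (a :- (a :+ (con (+ 1))))) refl x)))) , ≡.subst ([ x + 1# ] ≤±_) (≡.sym eq) NonStrict±.[ x + 1# ]≤⊤±))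

  <-≤±-trans : ∀ {x y k} → x < y → [ y ] ≤± k → [ x ] <± k
  <-≤±-trans p NonStrict±.[ q ] = Strict±.[ <-≤-trans p q ]
  <-≤±-trans p NonStrict±.[ _ ]≤⊤± = Strict±.[ _ ]<⊤±

  <±⇒≤± : ∀ {x k} → [ x ] <± k → ∃[ y ] (x < y × [ y ] ≤± k)
  <±⇒≤± {x} Strict±.[ p ] = _ , p , NonStrict±.[ ≤-refl ]
  <±⇒≤± {x} Strict±.[ _ ]<⊤± = x + 1# , ≰⇒> (λ p → <⇒≱ 0<1 ((by≤ (0≤sub p) (solve 1 (λ a → con (+ 0) := (con (+ 1)) :+ (a :- (a :+ (con (+ 1))))) refl x)))) , NonStrict±.[ _ ]≤⊤±

  module _ {I : Set} (_≼_ : I → I → Set) (f : I → ℝ) where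

    liminf⁺ : ∀ {c} N → 0# < c → (∀ i → N ≼ i → c ≤ f i) → [ 0# ] <± liminf _≼_ f
    liminf⁺ {c} N 0<c h = <-≤±-trans 0<c (≤±-trans (⨅-glb _ c λ (i , N≼i) → NonStrict±.[ h i N≼i ]) (⨆-ub _ N))

    liminf⁻ : [ 0# ] <± liminf _≼_ f → ∃[ N ] ∃[ c ] (0# < c × (∀ i → N ≼ i → c ≤ f i))
    liminf⁻ p = let (N , c , 0<c , q) = <⨆ _ p in
      N , c , 0<c , λ i N≼i → NonStrict±.[≤]-injective _≤_ (≤±-trans q (⨅-lb (λ ((j , _) : ∃[ j ] (N ≼ j)) → [ f j ]) (i , N≼i)))

    limsup⁺ : ∀ {c} → 0# < c → (∀ N → ∃[ i ] (N ≼ i × c ≤ f i)) → [ 0# ] <± limsup _≼_ f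
    limsup⁺ {c} 0<c h = <-≤±-trans 0<c (⨅-glb _ c λ N → let (i , N≼i , p) = h N in
      ≤±-trans NonStrict±.[ p ] (⨆-ub _ (i , N≼i)))

    -- Every tail has a supremum above a fixed positive number; its half is strictly smaller and
    -- therefore exceeded by some member of each tail.
    limsup⁻ : [ 0# ] <± limsup _≼_ f → ∃[ c ] (0# < c × (∀ N → ¬ (∀ i → N ≼ i → f i ≤ c)))
    limsup⁻ p = let (c , 0<c , q) = <±⇒≤± p in c * (♯ 2) ⁻¹ , *-pos 0<c (⁻¹-pos (♯-pos 1)) , λ N h →
      let ((i , N≼i) , y , d<y , r) = <⨆ _ (<-≤±-trans (half c 0<c) (≤±-trans q (⨅-lb _ N)))
      in <⇒≱ d<y (≤-trans (NonStrict±.[≤]-injective _≤_ r) (h i N≼i))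
      where
      half : ∀ c → 0# < c → c * (♯ 2) ⁻¹ < c
      half c 0<c = ≰⇒> λ r → <⇒≱ 0<c ((by≤ (0≤sub (≤-respʳ (trans ((solve 2 (λ a b → a :* b :* (con (+ 2)) := a :* ((con (+ 2)) :* b)) refl c ((♯ 2) ⁻¹))) (trans (*-congˡ (x⁻¹x (♯-pos 1))) (*-identityʳ c))) (*-monoʳ (♯ 2) (0≤# 2) r))) (solve 1 (λ a → con (+ 0) := a :+ (a :- a :* (con (+ 2)))) refl c)))

  module _ {I : Set} (f : I → ℝ) where

    sup-ub : ∀ u → (∀ i → f i ≤ u) → ∀ i → f i ≤ sup f
    sup-ub u h i with ⨆ ([_] ∘ f) | ⨆-ub ([_] ∘ f) i | ⨆-lub ([_] ∘ f) u (λ i → NonStrict±.[ h i ])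
    ... | [ s ] | NonStrict±.[ p ] | _ = p
    ... | ⊤± | _ | ()

    -- The hypothesis `0# ≤ v` covers an empty family, for which `sup` takes the value `0#`.
    sup-lub : ∀ {v} → 0# ≤ v → (∀ i → f i ≤ v) → sup f ≤ v
    sup-lub {v} 0≤v h with ⨆ ([_] ∘ f) | ⨆-lub ([_] ∘ f) v (λ i → NonStrict±.[ h i ])
    ... | ⊥± | _ = 0≤v
    ... | [ s ] | NonStrict±.[ p ] = p
    ... | ⊤± | ()

    -- A supremum of infinite value is encoded as 0.
    ¬sup≈0⇒ub : ¬ (sup f ≈ 0#) → ∀ i → f i ≤ sup f
    ¬sup≈0⇒ub ne i with ⨆ ([_] ∘ f) | ⨆-ub ([_] ∘ f) i
    ... | [ s ] | NonStrict±.[ p ] = p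
    ... | ⊤± | _ = ⊥-elim (ne refl)

    inf-lb : ∀ u → (∀ i → u ≤ f i) → ∀ i → inf f ≤ f i
    inf-lb u h i with ⨅ ([_] ∘ f) | ⨅-lb ([_] ∘ f) i | ⨅-glb ([_] ∘ f) u (λ i → NonStrict±.[ h i ])
    ... | [ s ] | NonStrict±.[ p ] | _ = p
    ... | ⊥± | _ | NonStrict⁺.[ () ]

    inf-glb : ∀ {u} → I → (∀ i → u ≤ f i) → u ≤ inf f
    inf-glb {u} i h with ⨅ ([_] ∘ f) | ⨅-lb ([_] ∘ f) i | ⨅-glb ([_] ∘ f) u (λ i → NonStrict±.[ h i ])
    ... | [ s ] | _ | NonStrict±.[ p ] = p
    ... | ⊥± | _ | NonStrict⁺.[ () ]
    ... | ⊤± | () | _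

    0<inf⇒lb : 0# < inf f → ∀ i → inf f ≤ f i
    0<inf⇒lb p i with ⨅ ([_] ∘ f) | ⨅-lb ([_] ∘ f) i
    ... | [ s ] | NonStrict±.[ q ] = q
    ... | ⊥± | _ = ⊥-elim (<-irrefl p)

  -- The Archimedean property, integer parts and nearest integers.

  abstract
    archimedean : ∀ x → ∃[ n ] (x < fromℕ n)
    archimedean x with lem {∃[ n ] (x < fromℕ n)}
    ... | yes r = r
    ... | no ¬r = ⊥-elim (<⇒≱ 0<1 ((by≤ (0≤sub (sup-lub fromℕ {sup fromℕ - 1#} (≤-trans (0≤♯ 0) (below 0)) below)) (solve 1 (λ a → con (+ 0) := (con (+ 1)) :+ (a :- (con (+ 1)) :- a)) refl (sup fromℕ)))))
      where
      ub : ∀ n → fromℕ n ≤ sup fromℕ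
      ub = sup-ub fromℕ x λ n → ≮⇒≥ λ p → ¬r (n , p)
      below : ∀ n → fromℕ n ≤ sup fromℕ - 1#
      below n = (by≤ (0≤sub (ub (suc n))) (solve 2 (λ a b → a :- (con (+ 1)) := b :+ (a :- ((con (+ 1)) :+ b))) refl (sup fromℕ) (fromℕ n)))

  bernoulli : ∀ {d} n → 0# ≤ d → 1# + fromℕ n * d ≤ (1# + d) ^ n
  bernoulli {d} zero 0≤d = (by≤ (≤-refl {0#}) (solve 1 (λ a → con (+ 1) := (con (+ 1)) :+ (con (+ 0)) :* a :+ (con (+ 0))) refl d))
  bernoulli {d} (suc n) 0≤d = (by≤ (0≤+ (*-nonneg (0≤sub (bernoulli n 0≤d)) (0≤+ 0≤1 0≤d)) (*-nonneg (0≤♯ n) (0≤□ d))) (solve 3 (λ a b c → ((con (+ 1)) :+ a) :* b := (con (+ 1)) :+ ((con (+ 1)) :+ c) :* a :+ ((b :- ((con (+ 1)) :+ c :* a)) :* ((con (+ 1)) :+ a) :+ c :* (a :* a))) refl d ((1# + d) ^ n) (fromℕ n)))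

  abstract
    ^-unbounded : ∀ {x} → 1# < x → ∀ M → ∃[ n ] (M < x ^ n)
    ^-unbounded {x} 1<x M = let (n , p) = archimedean (M * (x - 1#) ⁻¹) in n , <-≤-trans
      (≰⇒> λ q → <⇒≱ p (*-cancelʳ-≤ (x - 1#) 0<x-1 (begin
        fromℕ n * (x - 1#) ≤⟨ q ⟩
        M ≈⟨ solve 1 (λ a → a := a :* (con (+ 1))) refl M ⟩
        M * 1# ≈⟨ *-congˡ (sym (x⁻¹x 0<x-1)) ⟩
        M * ((x - 1#) * (x - 1#) ⁻¹) ≈⟨ solve 3 (λ a b c → a :* ((b :- (con (+ 1))) :* c) := a :* c :* (b :- (con (+ 1)))) refl M x ((x - 1#) ⁻¹) ⟩
        M * (x - 1#) ⁻¹ * (x - 1#) ∎)))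
      (begin
        fromℕ n * (x - 1#) ≤⟨ (by≤ 0≤1 (solve 2 (λ a b → (con (+ 1)) :+ a :* (b :- (con (+ 1))) := a :* (b :- (con (+ 1))) :+ (con (+ 1))) refl (fromℕ n) x)) ⟩
        1# + fromℕ n * (x - 1#) ≤⟨ bernoulli n (<⇒≤ 0<x-1) ⟩
        (1# + (x - 1#)) ^ n ≈⟨ ^-congˡ n (solve 1 (λ a → (con (+ 1)) :+ (a :- (con (+ 1))) := a) refl x) ⟩
        x ^ n ∎)
      where
      0<x-1 : 0# < x - 1#
      0<x-1 = ≰⇒> λ q → <⇒≱ 1<x ((by≤ (0≤sub q) (solve 1 (λ a → con (+ 1) := a :+ ((con (+ 0)) :- (a :- (con (+ 1))))) refl x)))

  floor⁺ : ∀ n x → 0# ≤ x → x < fromℕ n → ∃[ m ] (fromℕ m ≤ x × x < 1# + fromℕ m)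
  floor⁺ zero x 0≤x x<n = ⊥-elim (<⇒≱ x<n 0≤x)
  floor⁺ (suc n) x 0≤x x<n with ≤-or-> (fromℕ n) x
  ... | inj₁ p = n , p , x<n
  ... | inj₂ p = floor⁺ n x 0≤x p

  private
    floor-shift : ∀ x k m → fromℕ m ≤ x + fromℕ k → x + fromℕ k < 1# + fromℕ m → ∃[ i ] (fromℤ i ≤ x × x < fromℤ i + 1#)
    floor-shift x k m m≤ <m+1 = + m ℤ.- + k ,
      ≤-respˡ (sym e) (by≤ (0≤sub m≤) (solve 3 (λ a b c → a := b :- c :+ (a :+ c :- b)) refl x (fromℕ m) (fromℕ k))) ,
      ≰⇒> λ q → <⇒≱ <m+1 (by≤ (0≤sub (≤-respˡ (+-congʳ e) q)) (solve 3 (λ a b c → a :+ b := (con (+ 1)) :+ c :+ (a :- (c :- b :+ (con (+ 1))))) refl x (fromℕ k) (fromℕ m)))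
      where
      e : fromℤ (+ m ℤ.- + k) ≈ fromℕ m - fromℕ k
      e = fromℤ-- (+ m) (+ k)

    floor-from : ∀ x k → - x ≤ fromℕ k → ∃[ n ] (x + fromℕ k < fromℕ n) → ∃[ i ] (fromℤ i ≤ x × x < fromℤ i + 1#)
    floor-from x k -x≤k (n , p) =
      let m , m≤ , <m+1 = floor⁺ n (x + fromℕ k) (by≤ (0≤sub -x≤k) (solve 2 (λ a b → a :+ b := (con (+ 0)) :+ (b :- (:- a))) refl x (fromℕ k))) p in floor-shift x k m m≤ <m+1

  abstract
    floor : ∀ x → ∃[ i ] (fromℤ i ≤ x × x < fromℤ i + 1#)
    floor x = let k , p = archimedean (- x) in floor-from x k (<⇒≤ p) (archimedean (x + fromℕ k))

  fromℤ-<⇒+1≤ : ∀ i j → fromℤ i < fromℤ j → fromℤ i + 1# ≤ fromℤ j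
  fromℤ-<⇒+1≤ i j p with ℤ.<-cmp (j ℤ.- i) (+ 0)
  ... | tri< a _ _ = ⊥-elim (neg (j ℤ.- i) a (≤-respʳ (sym (fromℤ-- j i)) (0≤sub (<⇒≤ p))))
    where
    neg : ∀ z → z ℤ.< + 0 → ¬ (0# ≤ fromℤ z)
    neg -[1+ n ] _ q = <⇒≱ (fromℕ-pos n) (by≤ q (solve 1 (λ a → con (+ 0) := a :+ (:- a)) refl (fromℕ (suc n))))
    neg (+ n) (ℤ.+<+ ()) q
  ... | tri≈ _ b _ = ⊥-elim (<⇒≱ p (by≤ (0≤sub (≤-reflexive (trans (sym (fromℤ-- j i)) (reflexive (≡.cong fromℤ b))))) (solve 2 (λ a b → a := b :+ ((con (+ 0)) :- (b :- a))) refl (fromℤ i) (fromℤ j))))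
  ... | tri> _ _ c = (by≤ (0≤sub (≤-trans (pos (j ℤ.- i) c) (≤-reflexive (fromℤ-- j i)))) (solve 2 (λ a b → a := b :+ (con (+ 1)) :+ (a :- b :- (con (+ 1)))) refl (fromℤ j) (fromℤ i)))
    where
    pos : ∀ z → + 0 ℤ.< z → 1# ≤ fromℤ z
    pos (+ n) (ℤ.+<+ q) = 1≤fromℕ q
    pos -[1+ n ] ()

  private
    module Nearest (x : ℝ) (n₀ : ℤ) (n₀≤x : fromℤ n₀ ≤ x) (x<n₀+1 : x < fromℤ n₀ + 1#) where

      below : ∀ m → (x - fromℤ n₀ ≤ ∣ x - fromℤ m ∣) ⊎ (fromℤ n₀ + 1# - x ≤ ∣ x - fromℤ m ∣)
      below m with ≤-or-> (fromℤ m) (fromℤ n₀)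
      ... | inj₁ p = inj₁ (≤-trans (by≤ (0≤sub p) (solve 3 (λ a b c → a :- b := a :- c :+ (c :- b)) refl x (fromℤ m) (fromℤ n₀))) (x≤∣x∣ _))
      ... | inj₂ p = inj₂ (≤-trans (by≤ (0≤sub (fromℤ-<⇒+1≤ n₀ m p)) (solve 3 (λ a b c → :- (a :- b) := c :+ (con (+ 1)) :- a :+ (b :- (c :+ (con (+ 1))))) refl x (fromℤ m) (fromℤ n₀))) (-x≤∣x∣ _))

      0≤f = 0≤sub n₀≤x
      f≤1 = <⇒≤ x<n₀+1

      best : ∃[ n ] (∣ x - fromℤ n ∣ ≤ 1# × (∀ m → ∣ x - fromℤ n ∣ ≤ ∣ x - fromℤ m ∣))
      best with ≤-total (x - fromℤ n₀) (fromℤ n₀ + 1# - x)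
      ... | inj₁ p = n₀ , ≤-respˡ (sym e) (by≤ (0≤sub f≤1) (solve 2 (λ a b → con (+ 1) := a :- b :+ (b :+ (con (+ 1)) :- a)) refl x (fromℤ n₀))) ,
                     λ m → ≤-respˡ (sym e) (case below m of λ { (inj₁ q) → q ; (inj₂ q) → ≤-trans p q })
        where e = ∣∣-nonneg 0≤f
      ... | inj₂ p = n₀ ℤ.+ + 1 , ≤-respˡ (sym e) (by≤ 0≤f (solve 2 (λ a b → con (+ 1) := a :+ (con (+ 1)) :- b :+ (b :- a)) refl (fromℤ n₀) x)) ,
                     λ m → ≤-respˡ (sym e) (case below m of λ { (inj₁ q) → ≤-trans p q ; (inj₂ q) → q })
        where
        e = trans (∣∣-cong (trans (+-congˡ (-‿cong (trans (fromℤ-+ n₀ (+ 1)) (+-congˡ fromℕ1)))) (solve 2 (λ a b → a :- (b :+ (con (+ 1))) := :- (b :+ (con (+ 1)) :- a)) refl x (fromℤ n₀))))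
            (trans (∣-∣ _) (∣∣-nonneg (0≤sub f≤1)))

  ⟨⟩≤ : ∀ x n → ⟨ x ⟩ ≤ ∣ x - fromℤ n ∣
  ⟨⟩≤ x = inf-lb (λ n → ∣ x - fromℤ n ∣) 0# (λ n → 0≤∣∣ _)

  ⟨⟩-attained : ∀ x → ∃[ n ] (⟨ x ⟩ ≈ ∣ x - fromℤ n ∣ × ∣ x - fromℤ n ∣ ≤ 1#)
  ⟨⟩-attained x = let (n₀ , p , q) = floor x ; (n , ≤1 , best) = Nearest.best x n₀ p q in
    n , ≤-antisym (⟨⟩≤ x n) (inf-glb (λ m → ∣ x - fromℤ m ∣) (+ 0) best) , ≤1

  0≤⟨⟩ : ∀ x → 0# ≤ ⟨ x ⟩
  0≤⟨⟩ x = inf-glb (λ m → ∣ x - fromℤ m ∣) (+ 0) (λ m → 0≤∣∣ _)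

  -- Existence of roots.

  private
    small : ∀ {g C} → 0# < g → 0# ≤ C → ∃[ d ] (0# < d × d ≤ 1# × d * C ≤ g)
    small {g} {C} 0<g 0≤C = g * u , *-pos 0<g (⁻¹-pos 0<w) , d≤1 , dC≤g
      where
      w = C + 1# + g
      0<w : 0# < w
      0<w = <-≤-trans 0<g (by≤ (0≤+ 0≤C 0≤1) (solve 2 (λ a b → a :+ (con (+ 1)) :+ b := b :+ (a :+ (con (+ 1)))) refl C g))
      u = w ⁻¹
      0≤u = <⇒≤ (⁻¹-pos 0<w)
      d≤1 : g * u ≤ 1#
      d≤1 = ≤-respʳ (x⁻¹x 0<w) (*-monoʳ u 0≤u (by≤ (0≤+ 0≤C 0≤1) (solve 2 (λ a b → a :+ (con (+ 1)) :+ b := b :+ (a :+ (con (+ 1)))) refl C g)))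
      dC≤g : g * u * C ≤ g
      dC≤g = begin
        g * u * C ≤⟨ (by≤ (*-nonneg (*-nonneg (<⇒≤ 0<g) 0≤u) (0≤sub ((by≤ (0≤+ (<⇒≤ 0<g) 0≤1) (solve 2 (λ a b → a :+ (con (+ 1)) :+ b := a :+ (b :+ (con (+ 1)))) refl C g))))) (solve 4 (λ a b c d → a :* (b :* c) := a :* c :* d :+ a :* c :* (b :- d)) refl g w u C)) ⟩
        g * (w * u) ≈⟨ trans (*-congˡ (x⁻¹x 0<w)) (*-identityʳ g) ⟩
        g ∎

    -- A Lipschitz bound for the power near `y`, whose constant is built by induction on the
    -- exponent. Together with `step-down` it takes the place of continuity in `root-^`.
    step-up : ∀ {y} n → 0# ≤ y → ∃[ C ] (0# ≤ C × (∀ d → 0# ≤ d → d ≤ 1# → (y + d) ^ n ≤ y ^ n + d * C))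
    step-up zero 0≤y = 0# , ≤-refl , λ d _ _ → ≤-reflexive (solve 1 (λ a → con (+ 1) := (con (+ 1)) :+ a :* (con (+ 0))) refl d)
    step-up {y} (suc n) 0≤y = let (C , 0≤C , h) = step-up n 0≤y in
      y * C + y ^ n + C , 0≤+ (0≤+ (*-nonneg 0≤y 0≤C) (^-nonneg n 0≤y)) 0≤C , λ d 0≤d d≤1 →
      (by≤ (0≤+ (*-nonneg (0≤+ 0≤y 0≤d) (0≤sub (h d 0≤d d≤1))) (*-nonneg (*-nonneg 0≤d 0≤C) (0≤sub d≤1))) (solve 5 (λ a b c d e → a :* b :+ c :* (a :* d :+ b :+ d) := (a :+ c) :* e :+ ((a :+ c) :* (b :+ c :* d :- e) :+ c :* d :* ((con (+ 1)) :- c))) refl y (y ^ n) d C ((y + d) ^ n)))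

    step-down : ∀ {y} n → 0# ≤ y → ∃[ C ] (0# ≤ C × (∀ d → 0# ≤ d → d ≤ y → y ^ n - d * C ≤ (y - d) ^ n))
    step-down zero 0≤y = 0# , ≤-refl , λ d _ _ → ≤-reflexive (solve 1 (λ a → (con (+ 1)) :- a :* (con (+ 0)) := con (+ 1)) refl d)
    step-down {y} (suc n) 0≤y = let (C , 0≤C , h) = step-down n 0≤y in
      y * C + y ^ n , 0≤+ (*-nonneg 0≤y 0≤C) (^-nonneg n 0≤y) , λ d 0≤d d≤y →
      (by≤ (0≤+ (*-nonneg (0≤sub d≤y) (0≤sub (h d 0≤d d≤y))) (*-nonneg 0≤C (0≤□ d))) (solve 5 (λ a b c d e → (a :- b) :* c := a :* d :- b :* (a :* e :+ d) :+ ((a :- b) :* (c :- (d :- b :* e)) :+ e :* (b :* b))) refl y d ((y - d) ^ n) (y ^ n) C))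

  module _ (n : ℕ) {x : ℝ} (0≤x : 0# ≤ x) where
    private
      I = ∃[ y ] (0# ≤ y × y ^ suc n ≤ x)
      r = root (suc n) x

      bound : ∀ (i : I) → proj₁ i ≤ 1# + x
      bound (y , 0≤y , p) with ≤-or-> y (1# + x)
      ... | inj₁ q = q
      ... | inj₂ q = ⊥-elim (<⇒≱ q (≤-trans (by≤ (*-nonneg 0≤y (0≤sub (1≤^ n (≤-trans (by≤ 0≤x (solve 1 (λ a → (con (+ 1)) :+ a := (con (+ 1)) :+ a) refl x)) (<⇒≤ q))))) (solve 2 (λ a b → a :* b := a :+ a :* (b :- (con (+ 1)))) refl y (y ^ n)))
          (≤-trans p (by≤ 0≤1 (solve 1 (λ a → (con (+ 1)) :+ a := a :+ (con (+ 1))) refl x)))))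

    root-ub : ∀ y → 0# ≤ y → y ^ suc n ≤ x → y ≤ r
    root-ub y 0≤y p = sup-ub {I} proj₁ (1# + x) bound (y , 0≤y , p)

    root-nonneg : 0# ≤ r
    root-nonneg = root-ub 0# ≤-refl (≤-respˡ (sym (zeroˡ _)) 0≤x)

    root-lub : ∀ {v} → 0# ≤ v → (∀ y → 0# ≤ y → y ^ suc n ≤ x → y ≤ v) → r ≤ v
    root-lub 0≤v h = sup-lub {I} proj₁ 0≤v λ (y , p , q) → h y p q

    root-^ : r ^ suc n ≈ x
    root-^ = ≤-antisym (≮⇒≥ too-big) (≮⇒≥ too-small)
      where
      too-small : ¬ (r ^ suc n < x)
      too-small p =
        let 0<g = ≰⇒> λ q → <⇒≱ p ((by≤ (0≤sub q) (solve 2 (λ a b → a := b :+ ((con (+ 0)) :- (b :- a))) refl (r ^ suc n) x)))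
            (C , 0≤C , h) = step-up (suc n) root-nonneg
            (d , 0<d , d≤1 , dC≤g) = small {x - r ^ suc n} {C} 0<g 0≤C
        in <⇒≱ 0<d (by≤ (0≤sub (root-ub (r + d) (0≤+ root-nonneg (<⇒≤ 0<d)) (≤-trans (h d (<⇒≤ 0<d) d≤1)
              (by≤ (0≤sub dC≤g) (solve 4 (λ a b c d → a := b :+ c :* d :+ (a :- b :- c :* d)) refl x (r ^ suc n) d C))))) (solve 2 (λ a b → con (+ 0) := a :+ (b :- (b :+ a))) refl d r))
      too-big : ¬ (x < r ^ suc n)
      too-big p =
        let 0<g = ≰⇒> λ q → <⇒≱ p ((by≤ (0≤sub q) (solve 2 (λ a b → a := b :+ ((con (+ 0)) :- (b :- a))) refl x (r ^ suc n))))
            (C , 0≤C , h) = step-down (suc n) root-nonneg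
            -- The root is decreased by `r * d` rather than by `d`, so that `d ≤ 1#` keeps the
            -- difference nonnegative.
            (d , 0<d , d≤1 , dC≤g) = small {r ^ suc n - x} {r * C} 0<g (*-nonneg root-nonneg 0≤C)
            0<r = ≰⇒> λ r≤0 → <⇒≱ p (≤-trans (≤-reflexive (trans (*-congʳ (≤-antisym r≤0 root-nonneg)) (zeroˡ _))) 0≤x)
            e≤r = (by≤ (*-nonneg root-nonneg (0≤sub d≤1)) (solve 2 (λ a b → a := a :* b :+ a :* ((con (+ 1)) :- b)) refl r d))
            0≤e = *-nonneg root-nonneg (<⇒≤ 0<d)
            x≤ = ≤-trans (by≤ (0≤sub dC≤g) (solve 5 (λ a b c d e → a :- b :* c :* d := e :+ (a :- e :- c :* (b :* d))) refl (r ^ suc n) r d C x)) (h (r * d) 0≤e e≤r)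
        in <⇒≱ (*-pos 0<r 0<d) (by≤ (0≤sub (root-lub (0≤sub e≤r) (λ y 0≤y q → ^-cancel n (0≤sub e≤r) (≤-trans q x≤)))) (solve 2 (λ a b → con (+ 0) := a :* b :+ (a :- a :* b :- a)) refl r d))

  root₂-□ : ∀ t {x} → x ≈ t * t → root 2 x ≈ ∣ t ∣
  root₂-□ t {x} e = ≤-antisym (root-lub 1 0≤x (0≤∣∣ t) λ y 0≤y p → ^-cancel 1 (0≤∣∣ t) (≤-trans p (≤-reflexive e′)))
    (root-ub 1 0≤x ∣ t ∣ (0≤∣∣ t) (≤-reflexive (sym e′)))
    where
    0≤x = ≤-respʳ (sym e) (0≤□ t)
    e′ : x ≈ ∣ t ∣ ^ 2
    e′ = trans e (trans (sym (∣∣-nonneg (0≤□ t))) (trans (∣*∣ t t) (solve 1 (λ a → a :* a := a :^ 2) refl (∣ t ∣))))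

  -- Balls, removed neighbourhoods and nested plays on the real line.

  dist₁ : ∀ (z w : Point 1) → dist z w ≈ ∣ z zero - w zero ∣
  dist₁ z w = root₂-□ (z zero - w zero) (solve 2 (λ a b → (a :- b) :^ 2 :+ (con (+ 0)) := (a :- b) :* (a :- b)) refl (z zero) (w zero))

  infix 4 _within_

  _within_ : ℝ → Ball 1 → Set
  t within B = ∣ t - centre B zero ∣ ≤ radius B

  closed⇒within : ∀ B z → closed B z → z zero within B
  closed⇒within B z p = ≤-respˡ (dist₁ z (centre B)) p

  within⇒closed : ∀ B z → z zero within B → closed B z
  within⇒closed B z p = ≤-respˡ (sym (dist₁ z (centre B))) p

  module _ {β : ℝ} (0<β : 0# < β) where

    removing : (B : Ball 1) → ℝ → AliceMove β B
    removing B a = record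
      { plane = record { normal = λ _ → 1# ; nonzero = zero , λ e → 0≉1 (sym e) ; offset = a }
      ; width = β * radius B
      ; positive = *-pos 0<β (positive B)
      ; legal = ≤-refl
      }

    within⇒removed : ∀ B a (z : Point 1) → ∣ z zero - a ∣ ≤ β * radius B → removed (removing B a) z
    within⇒removed B a z p = ≤-trans (inf-lb (λ ((w , _) : ∃[ w ] (w ∈ points (AliceMove.plane (removing B a)))) → dist z w) 0#
        (λ (w , _) → ≤-respʳ (sym (dist₁ z w)) (0≤∣∣ _))
        ((λ _ → a) , (solve 1 (λ a → (con (+ 1)) :* a :+ (con (+ 0)) := a) refl a)))
      (≤-respˡ (sym (dist₁ z (λ _ → a))) p)

  ∣-∣≤⁻ : ∀ {t c r} → ∣ t - c ∣ ≤ r → (c - r ≤ t) × (t ≤ c + r)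
  ∣-∣≤⁻ {t} {c} {r} p = (by≤ (0≤sub (≤-trans (-x≤∣x∣ _) p)) (solve 3 (λ a b c → a := b :- c :+ (c :- (:- (a :- b)))) refl t c r)) ,
                        (by≤ (0≤sub (≤-trans (x≤∣x∣ _) p)) (solve 3 (λ a b c → a :+ b := c :+ (b :- (c :- a))) refl c r t))

  ∣-∣≤⁺ : ∀ {t c r} → c - r ≤ t → t ≤ c + r → ∣ t - c ∣ ≤ r
  ∣-∣≤⁺ {t} {c} {r} p q = ∣∣≤ (by≤ (0≤sub q) (solve 3 (λ a b c → a := b :- c :+ (c :+ a :- b)) refl r t c)) (by≤ (0≤sub p) (solve 3 (λ a b c → a := (:- (b :- c)) :+ (b :- (c :- a))) refl r t c))

  centre-within : ∀ B → centre B zero within B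
  centre-within B = ∣-∣≤⁺ (by≤ (<⇒≤ (positive B)) (solve 2 (λ a b → a := a :- b :+ b) refl (centre B zero) (radius B)))
                          (by≤ (<⇒≤ (positive B)) (solve 2 (λ a b → a :+ b := a :+ b) refl (centre B zero) (radius B)))

  record NestedBalls (β : ℝ) : Set where
    field
      ball   : ℕ → Ball 1
      nested : ∀ n {t} → t within ball (suc n) → t within ball n
      ratio  : ∀ n → β * radius (ball n) ≤ radius (ball (suc n))

    c : ℕ → ℝ
    c n = centre (ball n) zero

    ρ : ℕ → ℝ
    ρ n = radius (ball n)

    0<ρ : ∀ n → 0# < ρ n
    0<ρ n = positive (ball n)

    private
      endpoints : ∀ n → (c n - ρ n ≤ c (suc n) - ρ (suc n)) × (c (suc n) + ρ (suc n) ≤ c n + ρ n)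
      endpoints n =
        proj₁ (∣-∣≤⁻ (nested n (∣-∣≤⁺ ≤-refl (by≤ (0≤+ 0≤ρ′ 0≤ρ′) (solve 2 (λ a b → a :+ b := a :- b :+ (b :+ b)) refl (c (suc n)) (ρ (suc n))))))) ,
        proj₂ (∣-∣≤⁻ (nested n (∣-∣≤⁺ (by≤ (0≤+ 0≤ρ′ 0≤ρ′) (solve 2 (λ a b → a :+ b := a :- b :+ (b :+ b)) refl (c (suc n)) (ρ (suc n)))) ≤-refl)))
        where
        0≤ρ′ = <⇒≤ (0<ρ (suc n))

    antitone₁ : ∀ n → ρ (suc n) ≤ ρ n
    antitone₁ n = *-cancelˡ-≤ (♯ 2) (♯-pos 1) (by≤ (0≤+ (0≤sub (proj₁ (endpoints n))) (0≤sub (proj₂ (endpoints n)))) (solve 4 (λ a b c d → (con (+ 2)) :* a := (con (+ 2)) :* b :+ (c :- b :- (d :- a) :+ (d :+ a :- (c :+ b)))) refl (ρ n) (ρ (suc n)) (c (suc n)) (c n)))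

    nested* : ∀ m k {t} → t within ball (k ℕ.+ m) → t within ball m
    nested* m zero p = p
    nested* m (suc k) p = nested* m k (nested (k ℕ.+ m) p)

    nested-≤ : ∀ {m n t} → m ℕ.≤ n → t within ball n → t within ball m
    nested-≤ {m} {n} {t} m≤n p = nested* m (n ℕ.∸ m) (≡.subst (λ k → t within ball k) (≡.sym (ℕ.m∸n+n≡m m≤n)) p)

    antitone* : ∀ m k → ρ (k ℕ.+ m) ≤ ρ m
    antitone* m zero = ≤-refl
    antitone* m (suc k) = ≤-trans (antitone₁ (k ℕ.+ m)) (antitone* m k)

    ratio* : 0# ≤ β → ∀ m k → β ^ k * ρ m ≤ ρ (k ℕ.+ m)
    ratio* 0≤β m zero = ≤-reflexive (*-identityˡ _)
    ratio* 0≤β m (suc k) = ≤-trans (by≤ (*-nonneg 0≤β (0≤sub (ratio* 0≤β m k))) (solve 4 (λ a b c d → a :* b := a :* c :* d :+ a :* (b :- c :* d)) refl β (ρ (k ℕ.+ m)) (β ^ k) (ρ m)))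
      (ratio (k ℕ.+ m))

    antitone : ∀ {m n} → m ℕ.≤ n → ρ n ≤ ρ m
    antitone {m} {n} m≤n = ≡.subst (λ k → ρ k ≤ ρ m) (ℕ.m∸n+n≡m m≤n) (antitone* m (n ℕ.∸ m))

    private
      left-right : ∀ m n → c m - ρ m ≤ c n + ρ n
      left-right m n with ℕ.≤-total m n
      ... | inj₁ m≤n = ≤-trans (proj₁ (∣-∣≤⁻ (nested-≤ m≤n (centre-within (ball n))))) (by≤ (<⇒≤ (0<ρ n)) (solve 2 (λ a b → a :+ b := a :+ b) refl (c n) (ρ n)))
      ... | inj₂ n≤m = ≤-trans (by≤ (<⇒≤ (0<ρ m)) (solve 2 (λ a b → a := a :- b :+ b) refl (c m) (ρ m))) (proj₂ (∣-∣≤⁻ (nested-≤ n≤m (centre-within (ball m)))))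

      -- Left endpoints may be negative, so the bound `v` need not satisfy the sign condition of
      -- `sup-lub`; here the family is nonempty, which excludes the default value.
      sup-glb : ∀ v → (∀ n → c n - ρ n ≤ v) → sup (λ n → c n - ρ n) ≤ v
      sup-glb v h with ⨆ (λ n → [ c n - ρ n ]) | ⨆-lub (λ n → [ c n - ρ n ]) v (λ n → NonStrict±.[ h n ]) | ⨆-ub (λ n → [ c n - ρ n ]) 0
      ... | [ s ] | NonStrict±.[ p ] | _ = p
      ... | ⊥± | _ | NonStrict⁺.[ () ]
      ... | ⊤± | () | _

    limit : ∃[ t ] (∀ n → t within ball n)
    limit = sup (λ n → c n - ρ n) , λ n →
      ∣-∣≤⁺ (sup-ub (λ n → c n - ρ n) (c 0 + ρ 0) (λ m → left-right m 0) n) (sup-glb (c n + ρ n) λ m → left-right m n)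

  -- A target is a point with a radius and the number of turns within which the
  -- interval of that radius around it has to be left.
  record Target : Set where
    constructor target
    field
      at   : ℝ
      size : ℝ
      due  : ℕ

  open Target

  -- The weighted game: medians, ageing and the control of the pending mass.

  θ : ℝ
  θ = ♯ 2 * (♯ 3) ⁻¹

  3θ≈2 : ♯ 3 * θ ≈ ♯ 2
  3θ≈2 = trans (solve 1 (λ a → (con (+ 3)) :* ((con (+ 2)) :* a) := (con (+ 2)) :* ((con (+ 3)) :* a)) refl ((♯ 3) ⁻¹)) (trans (*-congˡ (x⁻¹x (♯-pos 2))) (*-identityʳ (♯ 2)))

  0<θ : 0# < θ
  0<θ = *-pos (♯-pos 1) (⁻¹-pos (♯-pos 2))

  weight : Target → ℝ
  weight x = θ ^ due x

  0≤weight : ∀ x → 0# ≤ weight x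
  0≤weight x = ^-nonneg (due x) (<⇒≤ 0<θ)

  mass : List Target → ℝ
  mass [] = 0#
  mass (x ∷ xs) = weight x + mass xs

  massWhere : (Target → Set) → List Target → ℝ
  massWhere P [] = 0#
  massWhere P (x ∷ xs) with lem {P x}
  ... | yes _ = weight x + massWhere P xs
  ... | no  _ = massWhere P xs

  mass-++ : ∀ xs ys → mass (xs ++ ys) ≈ mass xs + mass ys
  mass-++ [] ys = sym (+-identityˡ _)
  mass-++ (x ∷ xs) ys = trans (+-congˡ (mass-++ xs ys)) (sym (+-assoc _ _ _))

  weight≤mass : ∀ {x xs} → x ∈ₗ xs → weight x ≤ mass xs
  weight≤mass {x} {_ ∷ xs} (here ≡.refl) = (by≤ (0≤mass xs) (solve 2 (λ a b → a :+ b := a :+ b) refl (weight x) (mass xs)))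
    where
    0≤mass : ∀ xs → 0# ≤ mass xs
    0≤mass [] = ≤-refl
    0≤mass (x ∷ xs) = 0≤+ (0≤weight x) (0≤mass xs)
  weight≤mass {x} {y ∷ xs} (there i) = (by≤ (0≤+ (0≤sub (weight≤mass i)) (0≤weight y)) (solve 3 (λ a b c → a :+ b := c :+ (b :- c :+ a)) refl (weight y) (mass xs) (weight x)))

  massWhere-⊆ : ∀ {P Q : Target → Set} xs → (∀ {x} → x ∈ₗ xs → P x → Q x) → massWhere P xs ≤ massWhere Q xs
  massWhere-⊆ [] h = ≤-refl
  massWhere-⊆ {P} {Q} (x ∷ xs) h with lem {P x} | lem {Q x} | massWhere-⊆ {P} {Q} xs (h ∘ there)
  ... | yes p | yes q | r = +-mono-≤ ≤-refl r
  ... | yes p | no ¬q | r = ⊥-elim (¬q (h (here ≡.refl) p))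
  ... | no ¬p | yes q | r = (by≤ (0≤+ (0≤sub r) (0≤weight x)) (solve 3 (λ a b c → a :+ b := c :+ (b :- c :+ a)) refl (weight x) (massWhere Q xs) (massWhere P xs)))
  ... | no ¬p | no ¬q | r = r

  massWhere-disjoint : ∀ {P Q : Target → Set} xs → (∀ {x} → x ∈ₗ xs → P x → Q x → ⊥) → massWhere P xs + massWhere Q xs ≤ mass xs
  massWhere-disjoint [] h = ≤-reflexive (+-identityˡ 0#)
  massWhere-disjoint {P} {Q} (x ∷ xs) h with lem {P x} | lem {Q x} | massWhere-disjoint {P} {Q} xs (λ i → h (there i))
  ... | yes p | yes q | r = ⊥-elim (h (here ≡.refl) p q)
  ... | yes p | no ¬q | r = (by≤ (0≤sub r) (solve 4 (λ a b c d → a :+ b := a :+ c :+ d :+ (b :- (c :+ d))) refl (weight x) (mass xs) (massWhere P xs) (massWhere Q xs)))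
  ... | no ¬p | yes q | r = (by≤ (0≤sub r) (solve 4 (λ a b c d → a :+ b := c :+ (a :+ d) :+ (b :- (c :+ d))) refl (weight x) (mass xs) (massWhere P xs) (massWhere Q xs)))
  ... | no ¬p | no ¬q | r = (by≤ (0≤+ (0≤sub r) (0≤weight x)) (solve 4 (λ a b c d → a :+ b := c :+ d :+ (b :- (c :+ d) :+ a)) refl (weight x) (mass xs) (massWhere P xs) (massWhere Q xs)))

  massWhere-none : ∀ {P : Target → Set} xs → (∀ {x} → x ∈ₗ xs → ¬ P x) → massWhere P xs ≈ 0#
  massWhere-none [] h = refl
  massWhere-none {P} (x ∷ xs) h with lem {P x}
  ... | yes p = ⊥-elim (h (here ≡.refl) p)
  ... | no _ = massWhere-none xs (h ∘ there)

  -- An arbitrary total preorder is allowed so that the same induction finds leftmost and, with the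
  -- order reversed, rightmost targets.
  least : ∀ {_≼_ : Target → Target → Set} → (∀ x → x ≼ x) → (∀ {x y z} → x ≼ y → y ≼ z → x ≼ z) → (∀ x y → x ≼ y ⊎ y ≼ x) →
          ∀ {P : Target → Set} xs → (∃[ x ] (x ∈ₗ xs × P x)) → ∃[ z ] (z ∈ₗ xs × P z × (∀ {x} → x ∈ₗ xs → P x → z ≼ x))
  least _ _ _ [] (_ , () , _)
  least {_≼_} rfl tr tot {P} (y ∷ ys) (x , x∈ , Px) with lem {∃[ x ] (x ∈ₗ ys × P x)}
  ... | no none with x∈
  ...   | there i = ⊥-elim (none (x , i , Px))
  ...   | here ≡.refl = y , here ≡.refl , Px , λ { (here ≡.refl) _ → rfl y ; (there i) Pz → ⊥-elim (none (_ , i , Pz)) }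
  least {_≼_} rfl tr tot {P} (y ∷ ys) (x , x∈ , Px) | yes some with least {_≼_} rfl tr tot {P} ys some | lem {P y}
  ... | z , z∈ , Pz , min | no ¬Py = z , there z∈ , Pz , λ { (here ≡.refl) Py → ⊥-elim (¬Py Py) ; (there i) Pw → min i Pw }
  ... | z , z∈ , Pz , min | yes Py with tot y z
  ...   | inj₁ y≼z = y , here ≡.refl , Py , λ { (here ≡.refl) _ → rfl y ; (there i) Pw → tr y≼z (min i Pw) }
  ...   | inj₂ z≼y = z , there z∈ , Pz , λ { (here ≡.refl) _ → z≼y ; (there i) Pw → min i Pw }

  IsMedian : List Target → ℝ → Set
  IsMedian xs m = ♯ 2 * massWhere (λ x → at x < m) xs ≤ mass xs × ♯ 2 * massWhere (λ x → m < at x) xs ≤ mass xs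

  module _ {xs : List Target} (0≤m : 0# ≤ mass xs) where
    private
      above below : ℝ → ℝ
      above m = massWhere (λ x → m < at x) xs
      below m = massWhere (λ x → at x < m) xs

      P : Target → Set
      P x = ♯ 2 * above (at x) ≤ mass xs

      swap : ∀ {A B M} → M < ♯ 2 * A → A + B ≤ M → ♯ 2 * B ≤ M
      swap {A} {B} {M} p q = (by≤ (0≤+ (0≤+ (0≤sub q) (0≤sub q)) (0≤sub (<⇒≤ p))) (solve 3 (λ a b c → a := (con (+ 2)) :* b :+ (a :- (c :+ b) :+ (a :- (c :+ b)) :+ ((con (+ 2)) :* c :- a))) refl M B A))

    rightmost-P : ∀ {z} → (∀ {x} → x ∈ₗ xs → at x ≤ at z) → P z
    rightmost-P {z} max = ≤-trans (≤-reflexive (trans (*-congˡ (massWhere-none {λ x → at z < at x} xs λ i p → <⇒≱ p (max i))) (zeroʳ _))) 0≤m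

    -- Let `y` be the rightmost target left of `z`. The targets left of `z` and those right of `y`
    -- are disjoint, so if the former had more than half of the mass, `y` would satisfy `P` and
    -- contradict the choice of `z`.
    leftmost-median : ∀ {z} → P z → (∀ {x} → x ∈ₗ xs → P x → at z ≤ at x) → IsMedian xs (at z)
    leftmost-median {z} Pz min = ≮⇒≥ left , Pz
      where
      left : ¬ (mass xs < ♯ 2 * below (at z))
      left p with lem {∃[ y ] (y ∈ₗ xs × at y < at z)}
      ... | no none = <⇒≱ p (≤-trans (≤-reflexive (trans (*-congˡ (massWhere-none {λ x → at x < at z} xs λ i q → none (_ , i , q))) (zeroʳ _))) 0≤m)
      ... | yes some with least {λ x y → at y ≤ at x} (λ _ → ≤-refl) (λ p q → ≤-trans q p) (λ x y → ≤-total (at y) (at x)) {λ y → at y < at z} xs some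
      ...   | y , y∈ , y<z , max = <⇒≱ y<z (min y∈ (swap p
                (massWhere-disjoint {λ x → at x < at z} {λ x → at y < at x} xs (λ i q r → <⇒≱ r (max i q)))))

    private
      atLeast : ∀ Q → ∃[ x ] (x ∈ₗ xs × Q x) → ∃[ z ] (z ∈ₗ xs × Q z × (∀ {x} → x ∈ₗ xs → Q x → at z ≤ at x))
      atLeast Q = least {λ x y → at x ≤ at y} (λ _ → ≤-refl) ≤-trans (λ x y → ≤-total (at x) (at y)) {Q} xs

      atMost : ∀ Q → ∃[ x ] (x ∈ₗ xs × Q x) → ∃[ z ] (z ∈ₗ xs × Q z × (∀ {x} → x ∈ₗ xs → Q x → at x ≤ at z))
      atMost Q = least {λ x y → at y ≤ at x} (λ _ → ≤-refl) (λ p q → ≤-trans q p) (λ x y → ≤-total (at y) (at x)) {Q} xs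

      from-leftmost : ∃[ z ] (z ∈ₗ xs × P z × (∀ {x} → x ∈ₗ xs → P x → at z ≤ at x)) → ∃[ m ] IsMedian xs m
      from-leftmost (z , _ , Pz , min) = at z , leftmost-median {z} Pz min

      from-rightmost : ∃[ z ] (z ∈ₗ xs × ⊤ × (∀ {x} → x ∈ₗ xs → ⊤ → at x ≤ at z)) → ∃[ m ] IsMedian xs m
      from-rightmost (z , z∈ , _ , max) = from-leftmost (atLeast P (z , z∈ , rightmost-P {z} λ i → max i tt))

    -- The leftmost target with at most half of the mass to its right.
    nonempty-median : ∀ {x} → x ∈ₗ xs → ∃[ m ] IsMedian xs m
    nonempty-median {x} i = from-rightmost (atMost (λ _ → ⊤) (x , i , tt))

  abstract
    median : ∀ xs → ∃[ m ] IsMedian xs m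
    median [] = 0# , ≤-reflexive (zeroʳ (♯ 2)) , ≤-reflexive (zeroʳ (♯ 2))
    median (x ∷ xs) = nonempty-median (≤-trans (0≤weight x) (weight≤mass {x} {x ∷ xs} (here ≡.refl))) (here ≡.refl)

  targets : (ℕ → ℝ) → List (ℝ × ℕ) → List Target
  targets r = map λ (z , l) → target z (r l) l

  module Potential {β : ℝ} (0<β : 0# < β) (new : Ball 1 → List (ℝ × ℕ))
    (light : ∀ B → ♯ 8 * mass (targets (λ _ → 0#) (new B)) ≤ 1#) where

    fresh : Ball 1 → List Target
    fresh B = targets (λ l → β ^ l * radius B) (new B)

    Alive : Ball 1 → Target → Set
    Alive B x = ∃[ t ] (t within B × ∣ t - at x ∣ ≤ size x)

    age : Target → Target
    age (target z r l) = target z r (ℕ.pred l)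

    survivors : Ball 1 → List Target → List Target
    survivors B [] = []
    survivors B (x ∷ xs) with lem {Alive B x}
    ... | yes _ = age x ∷ survivors B xs
    ... | no  _ = survivors B xs

    -- A strategy sees only Bob's balls, so the pending targets are replayed from the history.
    -- Dropping a target is final: the balls are nested, so Bob cannot return to its interval.
    pending : List (Ball 1) → Ball 1 → List Target
    pending [] B = fresh B
    pending (B′ ∷ H) B = survivors B (pending H B′) ++ fresh B

    strategy : Strategy 1 β
    strategy H B = removing 0<β B (proj₁ (median (pending H B)))

    private
      mass-cong : ∀ r r′ (xs : List (ℝ × ℕ)) →
        mass (targets r xs) ≈ mass (targets r′ xs)
      mass-cong r r′ [] = refl
      mass-cong r r′ ((z , l) ∷ xs) = +-congˡ (mass-cong r r′ xs)

      fresh-light : ∀ B → ♯ 8 * mass (fresh B) ≤ 1#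
      fresh-light B = ≤-respˡ (*-congˡ (mass-cong (λ _ → 0#) (λ l → β ^ l * radius B) (new B))) (light B)

      alive-∈ : ∀ {B x} xs → x ∈ₗ xs → Alive B x → age x ∈ₗ survivors B xs
      alive-∈ {B} (x ∷ xs) (here ≡.refl) a with lem {Alive B x}
      ... | yes _ = here ≡.refl
      ... | no ¬a = ⊥-elim (¬a a)
      alive-∈ {B} (y ∷ xs) (there i) a with lem {Alive B y}
      ... | yes _ = there (alive-∈ xs i a)
      ... | no _ = alive-∈ xs i a

      survivor⁻ : ∀ {B y} xs → y ∈ₗ survivors B xs → ∃[ x ] (x ∈ₗ xs × y ≡ age x)
      survivor⁻ {B} (x ∷ xs) i with lem {Alive B x}
      survivor⁻ (x ∷ xs) (here ≡.refl) | yes _ = x , here ≡.refl , ≡.refl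
      survivor⁻ (x ∷ xs) (there i) | yes _ = let (y , j , e) = survivor⁻ xs i in y , there j , e
      survivor⁻ (x ∷ xs) i | no _ = let (y , j , e) = survivor⁻ xs i in y , there j , e

      mass-survivors : ∀ {B} xs → (∀ {x} → x ∈ₗ xs → ¬ (due x ≡ 0)) → ♯ 2 * mass (survivors B xs) ≤ ♯ 3 * massWhere (Alive B) xs
      mass-survivors [] h = ≤-reflexive (solve 1 (λ a → (con (+ 2)) :* (con (+ 0)) := (con (+ 3)) :* (con (+ 0))) refl 0#)
      mass-survivors {B} (x ∷ xs) h with lem {Alive B x}
      ... | no _ = mass-survivors xs (h ∘ there)
      ... | yes _ with x | h (here ≡.refl)
      ...   | target z r zero | ne = ⊥-elim (ne ≡.refl)
      ...   | target z r (suc l) | _ = ≤-trans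
        (by≤ (0≤sub (mass-survivors {B} xs (h ∘ there))) (solve 3 (λ a b c → (con (+ 2)) :* a :+ (con (+ 3)) :* b := (con (+ 2)) :* (a :+ c) :+ ((con (+ 3)) :* b :- (con (+ 2)) :* c)) refl (θ ^ l) (massWhere (Alive B) xs) (mass (survivors B xs))))
        (≤-reflexive (trans (+-congʳ (*-congʳ (sym 3θ≈2))) (solve 3 (λ a b c → (con (+ 3)) :* a :* b :+ (con (+ 3)) :* c := (con (+ 3)) :* (a :* b :+ c)) refl θ (θ ^ l) (massWhere (Alive B) xs))))

      record Controlled (B : Ball 1) (xs : List Target) : Set where
        field
          half  : ♯ 2 * mass xs ≤ 1#
          short : ∀ {x} → x ∈ₗ xs → size x ≤ β ^ due x * radius B

        -- A target that is due has weight 1, which alone exceeds the permitted mass 1/2.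
        notDue : ∀ {x} → x ∈ₗ xs → ¬ (due x ≡ 0)
        notDue {target z r .0} i ≡.refl = <⇒≱ 0<1 (by≤ (0≤+ (0≤+ (0≤sub half) (0≤sub (weight≤mass {target z r 0} i))) (0≤sub (weight≤mass {target z r 0} i))) (solve 1 (λ a → con (+ 0) := (con (+ 1)) :+ ((con (+ 1)) :- (con (+ 2)) :* a :+ (a :- (con (+ 1))) :+ (a :- (con (+ 1))))) refl (mass xs)))

      open Controlled

      fresh-short : ∀ {B : Ball 1} {x} (ls : List (ℝ × ℕ)) → x ∈ₗ targets (λ l → β ^ l * radius B) ls → size x ≤ β ^ due x * radius B
      fresh-short {B} (_ ∷ ls) (here ≡.refl) = ≤-refl
      fresh-short {B} (_ ∷ ls) (there i) = fresh-short {B} ls i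

      controlled-fresh : ∀ B → Controlled B (fresh B)
      controlled-fresh B .half = *-cancelˡ-≤ (♯ 4) (♯-pos 3) (by≤ (0≤+ (0≤sub (fresh-light B)) (0≤# 3)) (solve 1 (λ a → (con (+ 4)) :* (con (+ 1)) := (con (+ 4)) :* ((con (+ 2)) :* a) :+ ((con (+ 1)) :- (con (+ 8)) :* a :+ (con (+ 3)))) refl (mass (fresh B))))
      controlled-fresh B .short i = fresh-short {B} (new B) i

    module _ (N : NestedBalls β) (avoids : ∀ n t → t within NestedBalls.ball N (suc n) →
        ¬ (∣ t - proj₁ (median (pending (applyDownFrom (NestedBalls.ball N) n) (NestedBalls.ball N n))) ∣ ≤ β * NestedBalls.ρ N n)) where

      open NestedBalls N

      private
        pend : ℕ → List Target
        pend n = pending (applyDownFrom ball n) (ball n)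

        m : ℕ → ℝ
        m n = proj₁ (median (pend n))

        0≤β = <⇒≤ 0<β

        0≤βρ : ∀ n → 0# ≤ β * ρ n
        0≤βρ n = *-nonneg 0≤β (<⇒≤ (0<ρ n))

        m-near : ∀ n → ∣ m n - m n ∣ ≤ β * ρ n
        m-near n = ≤-respˡ (sym (trans (∣∣-cong (-‿inverseʳ (m n))) (∣∣-nonneg ≤-refl))) (0≤βρ n)

        -- Bob's next ball is an interval avoiding the median, hence lies on one side of it.
        right-side : ∀ n → m n ≤ c (suc n) → ∀ {t} → t within ball (suc n) → m n + β * ρ n < t
        right-side n m≤c {t} w = ≰⇒> λ t≤m+ → avoids n t w (∣-∣≤⁺ (≮⇒≥ λ t<m- → avoids n (m n) (mid t<m-) (m-near n)) t≤m+)
          where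
          mid : t < m n - β * ρ n → m n within ball (suc n)
          mid p = ∣-∣≤⁺ (≤-trans (proj₁ (∣-∣≤⁻ w)) (by≤ (0≤+ (0≤sub (<⇒≤ p)) (0≤βρ n)) (solve 4 (λ a b c d → a := b :+ (a :- c :* d :- b :+ c :* d)) refl (m n) t β (ρ n))))
                        (by≤ (0≤+ (0≤sub m≤c) (<⇒≤ (0<ρ (suc n)))) (solve 3 (λ a b c → a :+ b := c :+ (a :- c :+ b)) refl (c (suc n)) (ρ (suc n)) (m n)))

        left-side : ∀ n → c (suc n) ≤ m n → ∀ {t} → t within ball (suc n) → t < m n - β * ρ n
        left-side n c≤m {t} w = ≰⇒> λ t≥m- → avoids n t w (∣-∣≤⁺ t≥m- (≮⇒≥ λ t>m+ → avoids n (m n) (mid t>m+) (m-near n)))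
          where
          mid : m n + β * ρ n < t → m n within ball (suc n)
          mid p = ∣-∣≤⁺ (by≤ (0≤+ (0≤sub c≤m) (<⇒≤ (0<ρ (suc n)))) (solve 3 (λ a b c → a := b :- c :+ (a :- b :+ c)) refl (m n) (c (suc n)) (ρ (suc n))))
                        (≤-trans (by≤ (0≤+ (0≤sub (<⇒≤ p)) (0≤βρ n)) (solve 4 (λ a b c d → a := b :+ (a :- (b :+ c :* d) :+ c :* d)) refl t (m n) β (ρ n))) (proj₂ (∣-∣≤⁻ w)))

        β≤1 : β ≤ 1#
        β≤1 = *-cancelʳ-≤ (ρ 0) (0<ρ 0) (≤-trans (NestedBalls.ratio N 0) (≤-trans (antitone₁ 0) (≤-reflexive (sym (*-identityˡ _)))))

        short-β : ∀ n → Controlled (ball n) (pend n) → ∀ x → x ∈ₗ pend n → size x ≤ β * ρ n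
        short-β n C (target z r zero) i = ⊥-elim (notDue C i ≡.refl)
        short-β n C (target z r (suc l)) i = ≤-trans (short C i) (by≤ (*-nonneg (*-nonneg 0≤β (0≤sub (^≤1 l 0≤β β≤1))) (<⇒≤ (0<ρ n))) (solve 3 (λ a b c → a :* b := a :* c :* b :+ a :* ((con (+ 1)) :- c) :* b) refl β (ρ n) (β ^ l)))

        -- As no pending target is due, each has size at most `β * ρ n`. A target that is not
        -- strictly on Bob's side of the median therefore cannot reach across the removed interval
        -- into his next ball.
        halved : ∀ n → Controlled (ball n) (pend n) → ♯ 2 * massWhere (Alive (ball (suc n))) (pend n) ≤ mass (pend n)
        halved n C with ≤-total (m n) (c (suc n))
        ... | inj₁ m≤c = ≤-trans (*-monoˡ (♯ 2) (0≤# 2) (massWhere-⊆ {Alive (ball (suc n))} {λ x → m n < at x} (pend n) to-right)) (proj₂ (proj₂ (median (pend n))))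
          where
          to-right : ∀ {x} → x ∈ₗ pend n → Alive (ball (suc n)) x → m n < at x
          to-right {x} i (t , w , p) = ≰⇒> λ x≤m → <⇒≱ (right-side n m≤c w)
            (≤-trans (proj₂ (∣-∣≤⁻ p)) (+-mono-≤ x≤m (short-β n C x i)))
        ... | inj₂ c≤m = ≤-trans (*-monoˡ (♯ 2) (0≤# 2) (massWhere-⊆ {Alive (ball (suc n))} {λ x → at x < m n} (pend n) to-left)) (proj₁ (proj₂ (median (pend n))))
          where
          to-left : ∀ {x} → x ∈ₗ pend n → Alive (ball (suc n)) x → at x < m n
          to-left {x} i (t , w , p) = ≰⇒> λ m≤x → <⇒≱ (left-side n c≤m w)
            (≤-trans (+-mono-≤ m≤x (neg-mono (short-β n C x i))) (proj₁ (∣-∣≤⁻ p)))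

        -- Halving and ageing together leave 3/4 of a mass of at most 1/2, that is 3/8. The
        -- remaining room is 1/8 for fresh targets, whence the factor `♯ 8` in `light`.
        arith : ∀ {s a f M} → ♯ 2 * s ≤ ♯ 3 * a → ♯ 2 * a ≤ M → ♯ 2 * M ≤ 1# → ♯ 8 * f ≤ 1# → ♯ 2 * (s + f) ≤ 1#
        arith {s} {a} {f} {M} p q r u = *-cancelˡ-≤ (♯ 4) (♯-pos 3) (by≤ (0≤+ (0≤+ (0≤+ (*-nonneg (0≤# 4) (0≤sub p)) (*-nonneg (0≤# 6) (0≤sub q))) (*-nonneg (0≤# 3) (0≤sub r))) (0≤sub u)) (solve 4 (λ a b c d → (con (+ 4)) :* (con (+ 1)) := (con (+ 4)) :* ((con (+ 2)) :* (a :+ b)) :+ ((con (+ 4)) :* ((con (+ 3)) :* c :- (con (+ 2)) :* a) :+ (con (+ 6)) :* (d :- (con (+ 2)) :* c) :+ (con (+ 3)) :* ((con (+ 1)) :- (con (+ 2)) :* d) :+ ((con (+ 1)) :- (con (+ 8)) :* b))) refl s f a M))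

        survivor-short : ∀ n → Controlled (ball n) (pend n) → ∀ x → x ∈ₗ pend n → size x ≤ β ^ ℕ.pred (due x) * ρ (suc n)
        survivor-short n C (target z r zero) i = ⊥-elim (notDue C i ≡.refl)
        survivor-short n C (target z r (suc l)) i = ≤-trans (short C i) (by≤ (*-nonneg (^-nonneg l 0≤β) (0≤sub (NestedBalls.ratio N n))) (solve 4 (λ a b c d → a :* b := c :* a :* d :+ a :* (b :- c :* d)) refl (β ^ l) (ρ (suc n)) β (ρ n)))

        controlled : ∀ n → Controlled (ball n) (pend n)
        controlled zero = controlled-fresh (ball 0)
        controlled (suc n) = record { half = ≤-respˡ (*-congˡ (sym (mass-++ (survivors (ball (suc n)) (pend n)) (fresh (ball (suc n))))))
            (arith (mass-survivors (pend n) (notDue C)) (halved n C) (half C) (fresh-light (ball (suc n))))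
          ; short = λ i → [ old , fresh-short {ball (suc n)} (new (ball (suc n))) ]′ (∈-++⁻ (survivors (ball (suc n)) (pend n)) i) }
          where
          C = controlled n
          old : ∀ {y} → y ∈ₗ survivors (ball (suc n)) (pend n) → size y ≤ β ^ due y * ρ (suc n)
          old i with survivor⁻ (pend n) i
          ... | x , j , ≡.refl = survivor-short n C x j

        -- The point `t` itself witnesses at every turn that the target is still alive.
        track : ∀ j {n z r k t} → t within ball (j ℕ.+ n) → ∣ t - z ∣ ≤ r → target z r (j ℕ.+ k) ∈ₗ pend n → target z r k ∈ₗ pend (j ℕ.+ n)
        track zero w p i = i
        track (suc j) {n} {z} {r} {k} {t} w p i = ∈-++⁺ˡ (alive-∈ (pend (j ℕ.+ n))
          (track j {n} {z} {r} {suc k} (nested (j ℕ.+ n) w) p (≡.subst (λ h → target z r h ∈ₗ pend n) (≡.sym (ℕ.+-suc j k)) i)) (t , w , p))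

        fresh-∈ : ∀ n (ls : List (ℝ × ℕ)) {z l} → (z , l) ∈ₗ ls → target z (β ^ l * ρ n) l ∈ₗ targets (λ l → β ^ l * ρ n) ls
        fresh-∈ n (_ ∷ ls) (here ≡.refl) = here ≡.refl
        fresh-∈ n (_ ∷ ls) (there i) = there (fresh-∈ n ls i)

        fresh-pend : ∀ n {x} → x ∈ₗ fresh (ball n) → x ∈ₗ pend n
        fresh-pend zero i = i
        fresh-pend (suc n) i = ∈-++⁺ʳ (survivors (ball (suc n)) (pend n)) i

      -- A target not left by then would be pending with nothing left in `due`.
      cleared : ∀ n {z l t} → (z , l) ∈ₗ new (ball n) → t within ball (l ℕ.+ n) → ¬ (∣ t - z ∣ ≤ β ^ l * ρ n)
      cleared n {z} {l} i w p = notDue (controlled (l ℕ.+ n))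
        (track l {n} {z} {_} {0} w p (≡.subst (λ h → target z (β ^ l * ρ n) h ∈ₗ pend n) (≡.sym (ℕ.+-identityʳ l)) (fresh-pend n (fresh-∈ n (new (ball n)) i)))) ≡.refl

  -- The constants, and the sizes of spanned lines and of intersection points.

  1≤x*y : ∀ {x y} → 1# ≤ x → 1# ≤ y → 1# ≤ x * y
  1≤x*y p q = ≤-trans (≤-reflexive (sym (*-identityˡ 1#))) (*-mono 0≤1 p 0≤1 q)

  x≤x*y : ∀ {x y} → 0# ≤ x → 1# ≤ y → x ≤ x * y
  x≤x*y {x} {y} p q = (by≤ (*-nonneg p (0≤sub q)) (solve 2 (λ a b → a :* b := a :+ a :* (b :- (con (+ 1)))) refl x y))

  x≤y*x : ∀ {x y} → 0# ≤ x → 1# ≤ y → x ≤ y * x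
  x≤y*x {x} {y} p q = (by≤ (*-nonneg p (0≤sub q)) (solve 2 (λ a b → a :* b := b :+ b :* (a :- (con (+ 1)))) refl y x))

  -- `c₀` and `k` say how bad a point or a line is, `k₁` and `k₄` when it is noticed. By `c₀D≤` and
  -- `k≤` the bad intervals fit into the targets. By `D²S⁴k₁≤` two points noticed together span a
  -- bad line, and by `DSk≤1`, `Sk₄≤1` and `kk₄≤` two such lines meet in a bad point. `Dkk₄<` puts
  -- the deadline of this point into the past; for the line, `k≤` and `D²S⁴k₁≤` do so.
  record Constants (β : ℝ) : Set where
    field
      0<β : 0# < β
      S   : ℝ
      Sβ  : S * β ≈ 1#
      1<S : 1# < S
      l₀  : ℕ
      1≤l₀ : 1 ℕ.≤ l₀
      D k k₁ k₄ c₀ : ℝ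
      1≤D  : 1# ≤ D
      0<k  : 0# < k
      0<k₁ : 0# < k₁
      0<k₄ : 0# < k₄
      0<c₀ : 0# < c₀
      c₀D≤   : c₀ * D ≤ β ^ suc l₀ * k₁
      k≤     : k ≤ β ^ suc l₀ * k₄
      Dkk₄<  : ♯ 2 * D * k * k₄ < β ^ suc l₀ * k₁
      D²S⁴k₁≤ : ♯ 8 * D ^ 2 * S ^ 4 * k₁ ≤ k
      DSk≤1  : ♯ 2 * D * S * k ≤ 1#
      Sk₄≤1  : ♯ 4 * S * k₄ ≤ 1#
      kk₄≤   : ♯ 4 * k * k₄ ≤ c₀

    1≤S = <⇒≤ 1<S
    0≤β = <⇒≤ 0<β
    0≤S = ≤-trans 0≤1 1≤S
    0≤D = ≤-trans 0≤1 1≤D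
    0≤k = <⇒≤ 0<k
    0≤k₁ = <⇒≤ 0<k₁
    0≤k₄ = <⇒≤ 0<k₄
    0≤c₀ = <⇒≤ 0<c₀

    β≤1 : β ≤ 1#
    β≤1 = ≤-trans (x≤y*x 0≤β 1≤S) (≤-reflexive Sβ)

    s : ℕ → ℝ
    s i = S ^ i

    1≤s : ∀ i → 1# ≤ s i
    1≤s i = 1≤^ i 1≤S

    0<s : ∀ i → 0# < s i
    0<s i = <-≤-trans 0<1 (1≤s i)

    sβ : ∀ i → s i * β ^ i ≈ 1#
    sβ zero = *-identityˡ 1#
    sβ (suc i) = trans (solve 4 (λ a b c d → a :* b :* (c :* d) := a :* c :* (b :* d)) refl S (s i) β (β ^ i)) (trans (*-cong Sβ (sβ i)) (*-identityˡ 1#))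

    β^≤1 : ∀ n → β ^ n ≤ 1#
    β^≤1 n = ^≤1 n 0≤β β≤1

    c₀≤k₁ : c₀ ≤ k₁
    c₀≤k₁ = ≤-trans (x≤x*y 0≤c₀ 1≤D) (≤-trans c₀D≤ (by≤ (*-nonneg (0≤sub (β^≤1 (suc l₀))) 0≤k₁) (solve 2 (λ a b → a := b :* a :+ ((con (+ 1)) :- b) :* a) refl k₁ (β ^ suc l₀))))

    k≤k₄ : k ≤ k₄
    k≤k₄ = ≤-trans k≤ (by≤ (*-nonneg (0≤sub (β^≤1 (suc l₀))) 0≤k₄) (solve 2 (λ a b → a := b :* a :+ ((con (+ 1)) :- b) :* a) refl k₄ (β ^ suc l₀)))

    -- The size of the dual vector joining two rational points that are detected together.
    module TwoPoints {i : ℕ} {P ρ q₁ q₂ x₁ x₂ λ₁ λ₂ : ℝ} (0<P : 0# < P) (0≤ρ : 0# ≤ ρ)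
      (0<q₁ : 0# < q₁) (0<q₂ : 0# < q₂) (0≤x₁ : 0# ≤ x₁) (0≤x₂ : 0# ≤ x₂) (1≤λ₁ : 1# ≤ λ₁) (1≤λ₂ : 1# ≤ λ₂)
      (q₁≤ : s i ^ 3 * q₁ ≤ P * P) (q₂≤ : s i ^ 3 * q₂ ≤ P * P)
      (≤q₁ : P * P ≤ S ^ 3 * s i ^ 3 * q₁) (≤q₂ : P * P ≤ S ^ 3 * s i ^ 3 * q₂)
      (x₁≤ : x₁ * λ₁ ≤ ♯ 2 * D * k₁ * s i) (x₂≤ : x₂ * λ₂ ≤ ♯ 2 * D * k₁ * s i)
      (low₁ : β * (k₁ * s i) ≤ ρ * (λ₁ * q₁ * P)) (up₁ : ρ * (λ₁ * q₁ * P) ≤ k₁ * s i)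
      (low₂ : β * (k₁ * s i) ≤ ρ * (λ₂ * q₂ * P)) (up₂ : ρ * (λ₂ * q₂ * P) ≤ k₁ * s i) where

      private
        σ = s i
        G = ♯ 2 * D * k₁ * s i
        K = S ^ 4
        0≤σ = <⇒≤ (0<s i)
        0≤G : 0# ≤ G
        0≤G = *-nonneg (*-nonneg (*-nonneg (0≤# 2) 0≤D) 0≤k₁) 0≤σ
        1≤K : 1# ≤ K
        1≤K = 1≤^ 4 1≤S
        0≤K = ≤-trans 0≤1 1≤K

        0≤P = <⇒≤ 0<P

        q-comparable : ∀ {q q′} → σ ^ 3 * q ≤ P * P → P * P ≤ S ^ 3 * σ ^ 3 * q′ → q ≤ S ^ 3 * q′
        q-comparable {q} {q′} p r = *-cancelˡ-≤ (σ ^ 3) (^-pos 3 (0<s i))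
          (≤-respʳ (solve 3 (λ a b c → a :^ 3 :* b :^ 3 :* c := b :^ 3 :* (a :^ 3 :* c)) refl S σ q′) (≤-trans p r))

        0<k₁σ : 0# < k₁ * σ
        0<k₁σ = *-pos 0<k₁ (0<s i)

        -- Denominators of one class agree up to `S ^ 3` and the products that are noticed at one
        -- ball up to `S`, so the heights agree up to `S ^ 4`. This controls the mixed products of
        -- an error with the height of the other point.
        λ-comparable : ∀ {q q′ μ μ′} → 0# < q → 0# ≤ μ′ → ρ * (μ * q * P) ≤ k₁ * σ → β * (k₁ * σ) ≤ ρ * (μ′ * q′ * P) → q′ ≤ S ^ 3 * q → μ ≤ K * μ′
        λ-comparable {q} {q′} {μ} {μ′} 0<q 0≤μ′ up low q′≤ = *-cancelʳ-≤ (ρ * P * q) 0<ρPq (begin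
          μ * (ρ * P * q) ≈⟨ (solve 4 (λ a b c d → a :* (b :* c :* d) := b :* (a :* d :* c)) refl μ ρ P q) ⟩
          ρ * (μ * q * P) ≤⟨ up ⟩
          k₁ * σ ≈⟨ trans (sym (*-identityˡ _)) (trans (*-congʳ (sym Sβ)) (*-assoc S β _)) ⟩
          S * (β * (k₁ * σ)) ≤⟨ *-monoˡ S 0≤S low ⟩
          S * (ρ * (μ′ * q′ * P)) ≈⟨ (solve 5 (λ a b c d e → a :* (b :* (c :* d :* e)) := a :* b :* c :* e :* d) refl S ρ μ′ q′ P) ⟩
          S * ρ * μ′ * P * q′ ≤⟨ *-monoˡ (S * ρ * μ′ * P) (*-nonneg (*-nonneg (*-nonneg 0≤S 0≤ρ) 0≤μ′) 0≤P) q′≤ ⟩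
          S * ρ * μ′ * P * (S ^ 3 * q) ≈⟨ (solve 5 (λ a b c d e → a :* b :* c :* d :* (a :^ 3 :* e) := a :^ 4 :* c :* (b :* d :* e)) refl S ρ μ′ P q) ⟩
          S ^ 4 * μ′ * (ρ * P * q) ∎)
          where
          0<ρ : 0# < ρ
          0<ρ = pos-cancel (μ′ * q′ * P) (≮⇒≥ λ neg → <⇒≱ (*-pos 0<β 0<k₁σ) (≤-trans low ((by≤ (*-nonneg 0≤ρ (0≤sub (<⇒≤ neg))) (solve 4 (λ a b c d → con (+ 0) := a :* (b :* c :* d) :+ a :* ((con (+ 0)) :- b :* c :* d)) refl ρ μ′ q′ P))))) (<-≤-trans (*-pos 0<β 0<k₁σ) low)
          0<ρPq : 0# < ρ * P * q
          0<ρPq = *-pos (*-pos 0<ρ 0<P) 0<q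

        0≤λ₁ = ≤-trans 0≤1 1≤λ₁
        0≤λ₂ = ≤-trans 0≤1 1≤λ₂
        q₁≤S³q₂ = q-comparable q₁≤ ≤q₂
        q₂≤S³q₁ = q-comparable q₂≤ ≤q₁
        λ₁≤ = λ-comparable 0<q₁ 0≤λ₂ up₁ low₂ q₂≤S³q₁
        λ₂≤ = λ-comparable 0<q₂ 0≤λ₁ up₂ low₁ q₁≤S³q₂

        KG : ∀ {x μ μ′} → 0# ≤ x → x * μ ≤ G → μ′ ≤ K * μ → x * μ′ ≤ K * G
        KG {x} {μ} {μ′} 0≤x p q = (by≤ (0≤+ (*-nonneg 0≤x (0≤sub q)) (*-nonneg 0≤K (0≤sub p))) (solve 5 (λ a b c d e → a :* b := c :* d :+ (c :* (a :* e :- d) :+ a :* (b :- c :* e))) refl K G x μ′ μ))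

        G≤KG : G ≤ K * G
        G≤KG = x≤y*x 0≤G 1≤K

        x₁λ₂≤ = KG 0≤x₁ x₁≤ λ₂≤
        x₂λ₁≤ = KG 0≤x₂ x₂≤ λ₁≤

        term : ∀ {u v x μ} → 0# ≤ u → u ≤ P * P → 0# ≤ v → v ≤ P * P → 0# ≤ x → 0# ≤ μ → x * μ ≤ K * G → u * v * (x * μ) ≤ P * P * (P * P) * (K * G)
        term 0≤u u≤ 0≤v v≤ 0≤x 0≤μ p = *-mono (*-nonneg 0≤u 0≤v) (*-mono 0≤u u≤ 0≤v v≤) (*-nonneg 0≤x 0≤μ) p

        0≤u₁ = *-nonneg (^-nonneg 3 0≤σ) (<⇒≤ 0<q₁)
        0≤u₂ = *-nonneg (^-nonneg 3 0≤σ) (<⇒≤ 0<q₂)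

        expand : ∀ {u₁ u₂ T} → u₁ * u₁ * (x₂ * λ₂) ≤ T → u₁ * u₂ * (x₂ * λ₁) ≤ T → u₂ * u₁ * (x₁ * λ₂) ≤ T → u₂ * u₂ * (x₁ * λ₁) ≤ T →
                 (u₂ * x₁ + u₁ * x₂) * (u₂ * λ₁ + u₁ * λ₂) ≤ ♯ 4 * T
        expand {u₁} {u₂} {T} a b c d = (by≤ (0≤+ (0≤+ (0≤+ (0≤sub a) (0≤sub b)) (0≤sub c)) (0≤sub d)) (solve 7 (λ a b c d e f g → (con (+ 4)) :* a := (b :* c :+ d :* e) :* (b :* f :+ d :* g) :+ (a :- d :* d :* (e :* g) :+ (a :- d :* b :* (e :* f)) :+ (a :- b :* d :* (c :* g)) :+ (a :- b :* b :* (c :* f)))) refl T u₂ x₁ u₁ x₂ λ₁ λ₂))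

        expanded : (σ ^ 3 * q₂ * x₁ + σ ^ 3 * q₁ * x₂) * (σ ^ 3 * q₂ * λ₁ + σ ^ 3 * q₁ * λ₂) ≤ ♯ 4 * (P * P * (P * P) * (K * G))
        expanded = expand (term 0≤u₁ q₁≤ 0≤u₁ q₁≤ 0≤x₂ 0≤λ₂ (≤-trans x₂≤ G≤KG)) (term 0≤u₁ q₁≤ 0≤u₂ q₂≤ 0≤x₂ 0≤λ₁ x₂λ₁≤)
                          (term 0≤u₂ q₂≤ 0≤u₁ q₁≤ 0≤x₁ 0≤λ₂ x₁λ₂≤) (term 0≤u₂ q₂≤ 0≤u₂ q₂≤ 0≤x₁ 0≤λ₁ (≤-trans x₁≤ G≤KG))

        D≤D² : D ≤ D ^ 2
        D≤D² = ≤-respʳ (solve 1 (λ a → a :* a := a :^ 2) refl D) (x≤x*y 0≤D 1≤D)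

        8DKk₁≤k : ♯ 8 * D * K * k₁ ≤ k
        8DKk₁≤k = ≤-trans (by≤ (*-nonneg (*-nonneg (*-nonneg (0≤# 8) (0≤sub D≤D²)) 0≤K) 0≤k₁) (solve 3 (λ a b c → (con (+ 8)) :* a :^ 2 :* b :* c := (con (+ 8)) :* a :* b :* c :+ (con (+ 8)) :* (a :^ 2 :- a) :* b :* c) refl D K k₁)) D²S⁴k₁≤

      -- Each of the two denominators contributes a factor `s i ^ 3`, and one power of `s i` is lost
      -- because `x * λ` is of that size at the centre: hence the exponent five.
      product : ∀ {b a} → 0# ≤ b → 0# ≤ a → b * P ≤ q₂ * x₁ + q₁ * x₂ → a * P ≤ q₂ * λ₁ + q₁ * λ₂ → b * a * s i ^ 5 ≤ k * (P * P)
      product {b} {a} 0≤b 0≤a b≤ a≤ = *-cancelʳ-≤ (σ * (P * P)) (*-pos (0<s i) (*-pos 0<P 0<P)) (begin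
        b * a * σ ^ 5 * (σ * (P * P)) ≈⟨ (solve 4 (λ a b c d → a :* b :* c :^ 5 :* (c :* (d :* d)) := c :^ 6 :* (a :* d :* (b :* d))) refl b a σ P) ⟩
        σ ^ 6 * (b * P * (a * P)) ≤⟨ *-monoˡ (σ ^ 6) (^-nonneg 6 0≤σ) (*-mono (*-nonneg 0≤b 0≤P) b≤ (*-nonneg 0≤a 0≤P) a≤) ⟩
        σ ^ 6 * ((q₂ * x₁ + q₁ * x₂) * (q₂ * λ₁ + q₁ * λ₂)) ≈⟨ (solve 7 (λ a b c d e f g → a :^ 6 :* ((b :* c :+ d :* e) :* (b :* f :+ d :* g)) := (a :^ 3 :* b :* c :+ a :^ 3 :* d :* e) :* (a :^ 3 :* b :* f :+ a :^ 3 :* d :* g)) refl σ q₂ x₁ q₁ x₂ λ₁ λ₂) ⟩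
        (σ ^ 3 * q₂ * x₁ + σ ^ 3 * q₁ * x₂) * (σ ^ 3 * q₂ * λ₁ + σ ^ 3 * q₁ * λ₂) ≤⟨ expanded ⟩
        ♯ 4 * (P * P * (P * P) * (K * G)) ≈⟨ (solve 5 (λ a b c d e → (con (+ 4)) :* (a :* a :* (a :* a) :* (b :* ((con (+ 2)) :* c :* d :* e))) := (con (+ 8)) :* c :* b :* d :* (a :* a :* (e :* (a :* a)))) refl P K D k₁ σ) ⟩
        ♯ 8 * D * K * k₁ * (P * P * (σ * (P * P))) ≤⟨ *-monoʳ (P * P * (σ * (P * P))) (*-nonneg (0≤□ P) (*-nonneg 0≤σ (0≤□ P))) 8DKk₁≤k ⟩
        k * (P * P * (σ * (P * P))) ≈⟨ sym (*-assoc k _ _) ⟩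
        k * (P * P) * (σ * (P * P)) ∎)

      coefficient : ∀ {b} → b * P ≤ q₂ * x₁ + q₁ * x₂ → b * s i ^ 2 ≤ k * P
      coefficient {b} b≤ = *-cancelʳ-≤ (σ * P) (*-pos (0<s i) 0<P) (begin
        b * σ ^ 2 * (σ * P) ≈⟨ (solve 3 (λ a b c → a :* b :^ 2 :* (b :* c) := b :^ 3 :* (a :* c)) refl b σ P) ⟩
        σ ^ 3 * (b * P) ≤⟨ *-monoˡ (σ ^ 3) (^-nonneg 3 0≤σ) b≤ ⟩
        σ ^ 3 * (q₂ * x₁ + q₁ * x₂) ≈⟨ (solve 5 (λ a b c d e → a :^ 3 :* (b :* c :+ d :* e) := a :^ 3 :* b :* c :+ a :^ 3 :* d :* e) refl σ q₂ x₁ q₁ x₂) ⟩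
        σ ^ 3 * q₂ * x₁ + σ ^ 3 * q₁ * x₂ ≤⟨ +-mono-≤ (*-mono 0≤u₂ q₂≤ 0≤x₁ (≤-trans (x≤x*y 0≤x₁ 1≤λ₁) x₁≤)) (*-mono 0≤u₁ q₁≤ 0≤x₂ (≤-trans (x≤x*y 0≤x₂ 1≤λ₂) x₂≤)) ⟩
        P * P * G + P * P * G ≈⟨ (solve 4 (λ a b c d → a :* a :* ((con (+ 2)) :* b :* c :* d) :+ a :* a :* ((con (+ 2)) :* b :* c :* d) := (con (+ 4)) :* b :* c :* (a :* (d :* a))) refl P D k₁ σ) ⟩
        ♯ 4 * D * k₁ * (P * (σ * P)) ≤⟨ *-monoʳ (P * (σ * P)) (*-nonneg 0≤P (*-nonneg 0≤σ 0≤P)) (≤-trans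
            (by≤ (0≤+ (*-nonneg (*-nonneg (*-nonneg (0≤# 8) 0≤D) (0≤sub 1≤K)) 0≤k₁) (*-nonneg (*-nonneg (0≤# 4) 0≤D) 0≤k₁)) (solve 3 (λ a b c → (con (+ 8)) :* a :* b :* c := (con (+ 4)) :* a :* c :+ ((con (+ 8)) :* a :* (b :- (con (+ 1))) :* c :+ (con (+ 4)) :* a :* c)) refl D K k₁)) 8DKk₁≤k) ⟩
        k * (P * (σ * P)) ≈⟨ sym (*-assoc k _ _) ⟩
        k * P * (σ * P) ∎)

      value : ∀ {w E} → 0# ≤ w → 1# ≤ D * E → E * (w * (P * P)) ≤ x₂ * λ₁ + x₁ * λ₂ → w * (P * P) ≤ k * s i
      value {w} {E} 0≤w 1≤DE p = begin
        w * (P * P) ≤⟨ x≤y*x (*-nonneg 0≤w (0≤□ P)) 1≤DE ⟩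
        D * E * (w * (P * P)) ≈⟨ *-assoc D E _ ⟩
        D * (E * (w * (P * P))) ≤⟨ *-monoˡ D 0≤D (≤-trans p (+-mono-≤ x₂λ₁≤ x₁λ₂≤)) ⟩
        D * (K * G + K * G) ≤⟨ (by≤ (*-nonneg (*-nonneg (*-nonneg (*-nonneg (0≤# 4) (0≤□ D)) 0≤K) 0≤k₁) 0≤σ) (solve 4 (λ a b c d → (con (+ 8)) :* a :^ 2 :* b :* c :* d := a :* (b :* ((con (+ 2)) :* a :* c :* d) :+ b :* ((con (+ 2)) :* a :* c :* d)) :+ (con (+ 4)) :* (a :* a) :* b :* c :* d) refl D K k₁ σ)) ⟩
        ♯ 8 * D ^ 2 * K * k₁ * σ ≤⟨ *-monoʳ σ 0≤σ D²S⁴k₁≤ ⟩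
        k * σ ∎

      -- Lines are noticed when this product is about `k₄ * s i ^ 2`. Being much smaller here, it
      -- shows that the spanned line belongs to a much larger ball.
      slope : ∀ {a} → a * P ≤ q₂ * λ₁ + q₁ * λ₂ → ρ * (a * (P * P)) ≤ ♯ 2 * S ^ 3 * k₁ * s i
      slope {a} a≤ = begin
        ρ * (a * (P * P)) ≈⟨ (solve 3 (λ a b c → a :* (b :* (c :* c)) := a :* c :* (b :* c)) refl ρ a P) ⟩
        ρ * P * (a * P) ≤⟨ *-monoˡ (ρ * P) 0≤ρP (≤-trans a≤ (+-mono-≤ (*-monoʳ λ₁ 0≤λ₁ q₂≤S³q₁) (*-monoʳ λ₂ 0≤λ₂ q₁≤S³q₂))) ⟩
        ρ * P * (S ^ 3 * q₁ * λ₁ + S ^ 3 * q₂ * λ₂) ≈⟨ (solve 7 (λ a b c d e f g → a :* b :* (c :^ 3 :* d :* e :+ c :^ 3 :* f :* g) := c :^ 3 :* (a :* (e :* d :* b) :+ a :* (g :* f :* b))) refl ρ P S q₁ λ₁ q₂ λ₂) ⟩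
        S ^ 3 * (ρ * (λ₁ * q₁ * P) + ρ * (λ₂ * q₂ * P)) ≤⟨ *-monoˡ (S ^ 3) (^-nonneg 3 0≤S) (+-mono-≤ up₁ up₂) ⟩
        S ^ 3 * (k₁ * σ + k₁ * σ) ≈⟨ (solve 3 (λ a b c → a :^ 3 :* (b :* c :+ b :* c) := (con (+ 2)) :* a :^ 3 :* b :* c) refl S k₁ σ) ⟩
        ♯ 2 * S ^ 3 * k₁ * σ ∎
        where
        0≤ρP = *-nonneg 0≤ρ 0≤P

  module DualConstants {β : ℝ} (𝒞 : Constants β) where
    open Constants 𝒞

    0≤4kk₄ : 0# ≤ ♯ 4 * k * k₄
    0≤4kk₄ = *-nonneg (*-nonneg (0≤# 4) 0≤k) 0≤k₄

    DSk : ∀ {x} → 0# ≤ x → ♯ 2 * D * S * k * x ≤ x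
    DSk {x} 0≤x = ≤-respʳ (*-identityˡ x) (*-monoʳ x 0≤x DSk≤1)

    2k≤1 : ♯ 2 * k ≤ 1#
    2k≤1 = ≤-trans (≤-trans (x≤x*y (*-nonneg (0≤# 2) 0≤k) (1≤x*y 1≤D 1≤S)) (≤-reflexive (solve 3 (λ a b c → (con (+ 2)) :* a :* (b :* c) := (con (+ 2)) :* b :* c :* a) refl k D S))) DSk≤1

    4k₄≤1 : ♯ 4 * k₄ ≤ 1#
    4k₄≤1 = ≤-trans (≤-trans (x≤x*y (*-nonneg (0≤# 4) 0≤k₄) 1≤S) (≤-reflexive (solve 2 (λ a b → (con (+ 4)) :* a :* b := (con (+ 4)) :* b :* a) refl k₄ S))) Sk₄≤1

    8kk₄≤1 : ♯ 8 * k * k₄ ≤ 1#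
    8kk₄≤1 = (by≤ (0≤+ (0≤sub 2k≤1) (*-nonneg (*-nonneg (0≤# 2) 0≤k) (0≤sub 4k₄≤1))) (solve 2 (λ a b → con (+ 1) := (con (+ 8)) :* a :* b :+ ((con (+ 1)) :- (con (+ 2)) :* a :+ (con (+ 2)) :* a :* ((con (+ 1)) :- (con (+ 4)) :* b))) refl k k₄))

    16Skk₄²≤ : ♯ 16 * S * k * k₄ ^ 2 ≤ ♯ 4 * k * k₄
    16Skk₄²≤ = (by≤ (*-nonneg 0≤4kk₄ (0≤sub Sk₄≤1)) (solve 3 (λ a b c → (con (+ 4)) :* a :* b := (con (+ 16)) :* c :* a :* b :^ 2 :+ (con (+ 4)) :* a :* b :* ((con (+ 1)) :- (con (+ 4)) :* c :* b)) refl k k₄ S))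

    -- The size of the rational point in which two detected dual vectors meet.
    module TwoLines {i : ℕ} {P ρ a₁ a₂ b₁ b₂ ω₁ ω₂ : ℝ} (1≤P : 1# ≤ P) (0≤ρ : 0# ≤ ρ)
      (0≤a₁ : 0# ≤ a₁) (0≤a₂ : 0# ≤ a₂) (1≤b₁ : 1# ≤ b₁) (1≤b₂ : 1# ≤ b₂) (0≤ω₁ : 0# ≤ ω₁) (0≤ω₂ : 0# ≤ ω₂)
      (ab₁ : b₁ * a₁ * s i ^ 5 ≤ k * (P * P)) (ab₂ : b₂ * a₂ * s i ^ 5 ≤ k * (P * P))
      (b₁≤ : b₁ * s i ^ 2 ≤ k * P) (b₂≤ : b₂ * s i ^ 2 ≤ k * P)
      (low₁ : β * (k₄ * s i ^ 2) ≤ ρ * (a₁ * (P * P))) (up₁ : ρ * (a₁ * (P * P)) ≤ k₄ * s i ^ 2)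
      (low₂ : β * (k₄ * s i ^ 2) ≤ ρ * (a₂ * (P * P))) (up₂ : ρ * (a₂ * (P * P)) ≤ k₄ * s i ^ 2)
      (ω₁≤ : ω₁ * (P * P) ≤ ♯ 2 * k₄ * s i ^ 2) (ω₂≤ : ω₂ * (P * P) ≤ ♯ 2 * k₄ * s i ^ 2) where

      private
        σ = s i
        0≤σ = <⇒≤ (0<s i)
        0<P = <-≤-trans 0<1 1≤P
        0≤P = <⇒≤ 0<P
        0≤PP = 0≤□ P
        0<PP : 0# < P * P
        0<PP = *-pos 0<P 0<P
        0≤b₁ = ≤-trans 0≤1 1≤b₁
        0≤b₂ = ≤-trans 0≤1 1≤b₂
        1≤σ⁵ : 1# ≤ σ ^ 5
        1≤σ⁵ = 1≤^ 5 (1≤s i)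
        0≤σ² = ^-nonneg 2 0≤σ
        0≤σ⁵ = ^-nonneg 5 0≤σ

        0<k₄σ² : 0# < k₄ * σ ^ 2
        0<k₄σ² = *-pos 0<k₄ (^-pos 2 (0<s i))

        0<ρ : 0# < ρ
        0<ρ = pos-cancel (a₁ * (P * P)) (*-nonneg 0≤a₁ 0≤PP) (<-≤-trans (*-pos 0<β 0<k₄σ²) low₁)

        a-comparable : ∀ {a a′} → ρ * (a * (P * P)) ≤ k₄ * σ ^ 2 → β * (k₄ * σ ^ 2) ≤ ρ * (a′ * (P * P)) → a ≤ S * a′
        a-comparable {a} {a′} up low = *-cancelʳ-≤ (ρ * (P * P)) (*-pos 0<ρ 0<PP) (begin
          a * (ρ * (P * P)) ≈⟨ (solve 3 (λ a b c → a :* (b :* (c :* c)) := b :* (a :* (c :* c))) refl a ρ P) ⟩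
          ρ * (a * (P * P)) ≤⟨ up ⟩
          k₄ * σ ^ 2 ≈⟨ trans (sym (*-identityˡ _)) (trans (*-congʳ (sym Sβ)) (*-assoc S β _)) ⟩
          S * (β * (k₄ * σ ^ 2)) ≤⟨ *-monoˡ S 0≤S low ⟩
          S * (ρ * (a′ * (P * P))) ≈⟨ (solve 4 (λ a b c d → a :* (b :* (c :* (d :* d))) := a :* c :* (b :* (d :* d))) refl S ρ a′ P) ⟩
          S * a′ * (ρ * (P * P)) ∎)

        a₁≤ = a-comparable up₁ low₂
        a₂≤ = a-comparable up₂ low₁

        cross : ∀ {a b a′} → 0# ≤ b → a′ ≤ S * a → b * a * σ ^ 5 ≤ k * (P * P) → b * a′ * σ ^ 5 ≤ S * k * (P * P)
        cross {a} {b} {a′} 0≤b p q = (by≤ (0≤+ (*-nonneg (*-nonneg 0≤b (0≤sub p)) 0≤σ⁵) (*-nonneg 0≤S (0≤sub q))) (solve 7 (λ a b c d e f g → a :* b :* (c :* c) := d :* e :* f :^ 5 :+ (d :* (a :* g :- e) :* f :^ 5 :+ a :* (b :* (c :* c) :- d :* g :* f :^ 5))) refl S k P b a′ σ a))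

        b₁a₂ : b₁ * a₂ * σ ^ 5 ≤ S * k * (P * P)
        b₁a₂ = cross 0≤b₁ a₂≤ ab₁

        b₂a₁ : b₂ * a₁ * σ ^ 5 ≤ S * k * (P * P)
        b₂a₁ = cross 0≤b₂ a₁≤ ab₂

        0≤kPP : 0# ≤ k * (P * P)
        0≤kPP = *-nonneg 0≤k 0≤PP

        all-products : (b₁ + b₂) * (a₁ + a₂) * σ ^ 5 ≤ ♯ 4 * S * k * (P * P)
        all-products = (by≤ (0≤+ (0≤+ (0≤+ (0≤+ (0≤sub b₁a₂) (0≤sub b₂a₁)) (0≤sub ab₁)) (0≤sub ab₂)) (*-nonneg (*-nonneg (0≤# 2) (0≤sub 1≤S)) 0≤kPP)) (solve 8 (λ a b c d e f g h → (con (+ 4)) :* a :* b :* (c :* c) := (d :+ e) :* (f :+ g) :* h :^ 5 :+ (a :* b :* (c :* c) :- d :* g :* h :^ 5 :+ (a :* b :* (c :* c) :- e :* f :* h :^ 5) :+ (b :* (c :* c) :- d :* f :* h :^ 5) :+ (b :* (c :* c) :- e :* g :* h :^ 5) :+ (con (+ 2)) :* (a :- (con (+ 1))) :* (b :* (c :* c)))) refl S k P b₁ b₂ a₁ a₂ σ))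

      module _ {q} (0≤q : 0# ≤ q) (q≤ : q ≤ D * (a₁ * b₂ + a₂ * b₁)) where

        denominator′ : q * σ ^ 5 ≤ ♯ 2 * D * S * k * (P * P)
        denominator′ = (by≤ (0≤+ (0≤+ (*-nonneg (0≤sub q≤) 0≤σ⁵) (*-nonneg 0≤D (0≤sub b₁a₂))) (*-nonneg 0≤D (0≤sub b₂a₁))) (solve 10 (λ a b c d e f g h i j → (con (+ 2)) :* a :* b :* c :* (d :* d) := e :* f :^ 5 :+ ((a :* (g :* h :+ i :* j) :- e) :* f :^ 5 :+ a :* (b :* c :* (d :* d) :- j :* i :* f :^ 5) :+ a :* (b :* c :* (d :* d) :- h :* g :* f :^ 5))) refl D S k P q σ a₁ b₂ a₂ b₁))

        denominator : q ≤ P * P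
        denominator = ≤-trans (x≤x*y 0≤q 1≤σ⁵) (≤-trans denominator′ (DSk 0≤PP))

        private
          timing₁ : ∀ {a b} → 0# ≤ a → ρ * (a * (P * P)) ≤ k₄ * σ ^ 2 → b * σ ^ 2 ≤ k * P → ρ * (a * b * P) ≤ k * k₄
          timing₁ {a} {b} 0≤a up b≤ = *-cancelʳ-≤ (P * σ ^ 2) (*-pos 0<P (^-pos 2 (0<s i))) (by≤ (0≤+ (*-nonneg (*-nonneg 0≤ρ (*-nonneg 0≤a 0≤PP)) (0≤sub b≤)) (*-nonneg (*-nonneg 0≤k 0≤P) (0≤sub up))) (solve 7 (λ a b c d e f g → a :* b :* (c :* d :^ 2) := e :* (f :* g :* c) :* (c :* d :^ 2) :+ (e :* (f :* (c :* c)) :* (a :* c :- g :* d :^ 2) :+ a :* c :* (b :* d :^ 2 :- e :* (f :* (c :* c))))) refl k k₄ P σ ρ a b))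

        timing : ρ * (q * P) ≤ ♯ 2 * D * k * k₄
        timing = (by≤ (0≤+ (0≤+ (*-nonneg (*-nonneg 0≤ρ 0≤P) (0≤sub q≤)) (*-nonneg 0≤D (0≤sub (timing₁ 0≤a₁ up₁ b₂≤)))) (*-nonneg 0≤D (0≤sub (timing₁ 0≤a₂ up₂ b₁≤)))) (solve 10 (λ a b c d e f g h i j → (con (+ 2)) :* a :* b :* c := d :* (e :* f) :+ (d :* f :* (a :* (g :* h :+ i :* j) :- e) :+ a :* (b :* c :- d :* (g :* h :* f)) :+ a :* (b :* c :- d :* (i :* j :* f)))) refl D k k₄ ρ q P a₁ b₂ a₂ b₁))

      -- The values `ω₁` and `ω₂` grow by `s i ^ 2` when passing to the centre, and the coefficients
      -- `b₁` and `b₂` are small by exactly this power.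
      numerator : ∀ {x} → x ≤ ω₁ * b₂ + ω₂ * b₁ → P * x ≤ ♯ 4 * k * k₄
      numerator {x} x≤ = *-cancelʳ-≤ (P * σ ^ 2) (*-pos 0<P (^-pos 2 (0<s i))) (begin
        P * x * (P * σ ^ 2) ≤⟨ (by≤ (*-nonneg (*-nonneg 0≤PP 0≤σ²) (0≤sub x≤)) (solve 7 (λ a b c d e f g → a :* (b :* b) :* (c :* d :^ 2) :+ e :* (b :* b) :* (f :* d :^ 2) := b :* g :* (b :* d :^ 2) :+ b :* b :* d :^ 2 :* (a :* c :+ e :* f :- g)) refl ω₁ P b₂ σ ω₂ b₁ x)) ⟩
        ω₁ * (P * P) * (b₂ * σ ^ 2) + ω₂ * (P * P) * (b₁ * σ ^ 2) ≤⟨ +-mono-≤ (*-mono (*-nonneg 0≤ω₁ 0≤PP) ω₁≤ (*-nonneg 0≤b₂ 0≤σ²) b₂≤) (*-mono (*-nonneg 0≤ω₂ 0≤PP) ω₂≤ (*-nonneg 0≤b₁ 0≤σ²) b₁≤) ⟩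
        ♯ 2 * k₄ * σ ^ 2 * (k * P) + ♯ 2 * k₄ * σ ^ 2 * (k * P) ≈⟨ (solve 4 (λ a b c d → (con (+ 2)) :* a :* b :^ 2 :* (c :* d) :+ (con (+ 2)) :* a :* b :^ 2 :* (c :* d) := (con (+ 4)) :* c :* a :* (d :* b :^ 2)) refl k₄ σ k P) ⟩
        ♯ 4 * k * k₄ * (P * σ ^ 2) ∎)

      module _ {L} (0≤L : 0# ≤ L) (L≤ : L ≤ ω₁ * a₂ + ω₂ * a₁) where

        private
          L₁ : L * (P * P) ≤ ♯ 2 * k₄ * σ ^ 2 * (a₁ + a₂)
          L₁ = (by≤ (0≤+ (0≤+ (*-nonneg 0≤PP (0≤sub L≤)) (*-nonneg 0≤a₂ (0≤sub ω₁≤))) (*-nonneg 0≤a₁ (0≤sub ω₂≤))) (solve 8 (λ a b c d e f g h → (con (+ 2)) :* a :* b :^ 2 :* (c :+ d) := e :* (f :* f) :+ (f :* f :* (g :* d :+ h :* c :- e) :+ d :* ((con (+ 2)) :* a :* b :^ 2 :- g :* (f :* f)) :+ c :* ((con (+ 2)) :* a :* b :^ 2 :- h :* (f :* f)))) refl k₄ σ a₁ a₂ L P ω₁ ω₂))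

          0≤2k₄σ² : 0# ≤ ♯ 2 * k₄ * σ ^ 2
          0≤2k₄σ² = *-nonneg (*-nonneg (0≤# 2) 0≤k₄) 0≤σ²

          L₂ : ρ * (L * (P * P) * (P * P)) ≤ ♯ 4 * k₄ ^ 2 * σ ^ 4
          L₂ = (by≤ (0≤+ (0≤+ (*-nonneg (*-nonneg 0≤ρ 0≤PP) (0≤sub L₁)) (*-nonneg 0≤2k₄σ² (0≤sub up₁))) (*-nonneg 0≤2k₄σ² (0≤sub up₂))) (solve 7 (λ a b c d e f g → (con (+ 4)) :* a :^ 2 :* b :^ 4 := c :* (d :* (e :* e) :* (e :* e)) :+ (c :* (e :* e) :* ((con (+ 2)) :* a :* b :^ 2 :* (f :+ g) :- d :* (e :* e)) :+ (con (+ 2)) :* a :* b :^ 2 :* (a :* b :^ 2 :- c :* (f :* (e :* e))) :+ (con (+ 2)) :* a :* b :^ 2 :* (a :* b :^ 2 :- c :* (g :* (e :* e))))) refl k₄ σ ρ L P a₁ a₂))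

        -- The two values cost four powers of `s i` and `all-products` gains five; the surplus power
        -- is given away by `1≤s i`.
        product : ∀ {x} → 0# ≤ x → x ≤ ω₁ * b₂ + ω₂ * b₁ → P * x * (P * L) ≤ ♯ 4 * k * k₄
        product {x} 0≤x x≤ = ≤-trans (*-cancelʳ-≤ (σ ^ 5 * (P * P)) (*-pos (^-pos 5 (0<s i)) 0<PP) (begin
          P * x * (P * L) * (σ ^ 5 * (P * P)) ≈⟨ (solve 4 (λ a b c d → a :* b :* (a :* c) :* (d :^ 5 :* (a :* a)) := b :* (a :* a) :* (c :* (a :* a)) :* d :^ 5) refl P x L σ) ⟩
          x * (P * P) * (L * (P * P)) * σ ^ 5 ≤⟨ *-monoʳ (σ ^ 5) 0≤σ⁵ (*-mono (*-nonneg 0≤x 0≤PP) x₁ (*-nonneg 0≤L 0≤PP) L₁) ⟩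
          ♯ 2 * k₄ * σ ^ 2 * (b₁ + b₂) * (♯ 2 * k₄ * σ ^ 2 * (a₁ + a₂)) * σ ^ 5 ≈⟨ (solve 6 (λ a b c d e f → (con (+ 2)) :* a :* b :^ 2 :* (c :+ d) :* ((con (+ 2)) :* a :* b :^ 2 :* (e :+ f)) :* b :^ 5 := (con (+ 4)) :* a :^ 2 :* b :^ 4 :* ((c :+ d) :* (e :+ f) :* b :^ 5)) refl k₄ σ b₁ b₂ a₁ a₂) ⟩
          ♯ 4 * k₄ ^ 2 * σ ^ 4 * ((b₁ + b₂) * (a₁ + a₂) * σ ^ 5) ≤⟨ *-monoˡ (♯ 4 * k₄ ^ 2 * σ ^ 4) (*-nonneg (*-nonneg (0≤# 4) (^-nonneg 2 0≤k₄)) (^-nonneg 4 0≤σ)) all-products ⟩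
          ♯ 4 * k₄ ^ 2 * σ ^ 4 * (♯ 4 * S * k * (P * P)) ≤⟨ x≤x*y (*-nonneg (*-nonneg (*-nonneg (0≤# 4) (^-nonneg 2 0≤k₄)) (^-nonneg 4 0≤σ)) (*-nonneg (*-nonneg (*-nonneg (0≤# 4) 0≤S) 0≤k) 0≤PP)) (1≤s i) ⟩
          ♯ 4 * k₄ ^ 2 * σ ^ 4 * (♯ 4 * S * k * (P * P)) * σ ≈⟨ (solve 5 (λ a b c d e → (con (+ 4)) :* a :^ 2 :* b :^ 4 :* ((con (+ 4)) :* c :* d :* (e :* e)) :* b := (con (+ 16)) :* c :* d :* a :^ 2 :* (b :^ 5 :* (e :* e))) refl k₄ σ S k P) ⟩
          ♯ 16 * S * k * k₄ ^ 2 * (σ ^ 5 * (P * P)) ∎)) 16Skk₄²≤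
          where
          x₁ : x * (P * P) ≤ ♯ 2 * k₄ * σ ^ 2 * (b₁ + b₂)
          x₁ = (by≤ (0≤+ (0≤+ (*-nonneg 0≤PP (0≤sub x≤)) (*-nonneg 0≤b₂ (0≤sub ω₁≤))) (*-nonneg 0≤b₁ (0≤sub ω₂≤))) (solve 8 (λ a b c d e f g h → (con (+ 2)) :* a :* b :^ 2 :* (c :+ d) := e :* (f :* f) :+ (f :* f :* (g :* d :+ h :* c :- e) :+ d :* ((con (+ 2)) :* a :* b :^ 2 :- g :* (f :* f)) :+ c :* ((con (+ 2)) :* a :* b :^ 2 :- h :* (f :* f)))) refl k₄ σ b₁ b₂ x P ω₁ ω₂))

        L-timing : ∀ {q} → 0# ≤ q → q ≤ D * (a₁ * b₂ + a₂ * b₁) → ρ * (P * L * q * P) ≤ ♯ 2 * D * k * k₄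
        L-timing {q} 0≤q q≤ = ≤-trans (*-cancelʳ-≤ (σ ^ 5 * (P * P)) (*-pos (^-pos 5 (0<s i)) 0<PP) (begin
          ρ * (P * L * q * P) * (σ ^ 5 * (P * P)) ≈⟨ (solve 5 (λ a b c d e → a :* (b :* c :* d :* b) :* (e :^ 5 :* (b :* b)) := a :* (c :* (b :* b) :* (b :* b)) :* (d :* e :^ 5)) refl ρ P L q σ) ⟩
          ρ * (L * (P * P) * (P * P)) * (q * σ ^ 5) ≤⟨ *-mono (*-nonneg 0≤ρ (*-nonneg (*-nonneg 0≤L 0≤PP) 0≤PP)) L₂ (*-nonneg 0≤q 0≤σ⁵) (denominator′ 0≤q q≤) ⟩
          ♯ 4 * k₄ ^ 2 * σ ^ 4 * (♯ 2 * D * S * k * (P * P)) ≤⟨ x≤x*y (*-nonneg (*-nonneg (*-nonneg (0≤# 4) (^-nonneg 2 0≤k₄)) (^-nonneg 4 0≤σ)) (*-nonneg (*-nonneg (*-nonneg (*-nonneg (0≤# 2) 0≤D) 0≤S) 0≤k) 0≤PP)) (1≤s i) ⟩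
          ♯ 4 * k₄ ^ 2 * σ ^ 4 * (♯ 2 * D * S * k * (P * P)) * σ ≈⟨ (solve 6 (λ a b c d e f → (con (+ 4)) :* a :^ 2 :* b :^ 4 :* ((con (+ 2)) :* c :* d :* e :* (f :* f)) :* b := (con (+ 2)) :* c :* e :* a :* ((con (+ 4)) :* d :* a) :* (b :^ 5 :* (f :* f))) refl k₄ σ D S k P) ⟩
          ♯ 2 * D * k * k₄ * (♯ 4 * S * k₄) * (σ ^ 5 * (P * P)) ∎))
          (by≤ (*-nonneg (*-nonneg (*-nonneg (*-nonneg (0≤# 2) 0≤D) 0≤k) 0≤k₄) (0≤sub Sk₄≤1)) (solve 4 (λ a b c d → (con (+ 2)) :* a :* b :* c := (con (+ 2)) :* a :* b :* c :* ((con (+ 4)) :* d :* c) :+ (con (+ 2)) :* a :* b :* c :* ((con (+ 1)) :- (con (+ 4)) :* d :* c)) refl D k k₄ S))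

        -- `L₂` bounds `L` only together with `ρ`. The lower bound `low₁` eliminates `ρ` at the
        -- price of a factor `a₁`, which `ab₁` controls.
        L≤1 : L ≤ 1#
        L≤1 = ≤-trans (*-cancelʳ-≤ (β * (k₄ * σ ^ 4)) (*-pos 0<β (*-pos 0<k₄ (^-pos 4 (0<s i)))) (begin
          L * (β * (k₄ * σ ^ 4)) ≤⟨ x≤x*y (*-nonneg 0≤L (*-nonneg 0≤β (*-nonneg 0≤k₄ (^-nonneg 4 0≤σ)))) (1≤^ 3 (1≤s i)) ⟩
          L * (β * (k₄ * σ ^ 4)) * σ ^ 3 ≈⟨ (solve 4 (λ a b c d → a :* (b :* (c :* d :^ 4)) :* d :^ 3 := a :* d :^ 5 :* (b :* (c :* d :^ 2))) refl L β k₄ σ) ⟩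
          L * σ ^ 5 * (β * (k₄ * σ ^ 2)) ≤⟨ *-monoˡ (L * σ ^ 5) (*-nonneg 0≤L 0≤σ⁵) low₁ ⟩
          L * σ ^ 5 * (ρ * (a₁ * (P * P))) ≈⟨ (solve 5 (λ a b c d e → a :* b :^ 5 :* (c :* (d :* (e :* e))) := a :* c :* (e :* e) :* (d :* b :^ 5)) refl L σ ρ a₁ P) ⟩
          L * ρ * (P * P) * (a₁ * σ ^ 5) ≤⟨ *-monoˡ (L * ρ * (P * P)) (*-nonneg (*-nonneg 0≤L 0≤ρ) 0≤PP) (≤-trans (≤-trans (x≤y*x (*-nonneg 0≤a₁ 0≤σ⁵) 1≤b₁) (≤-reflexive (sym (*-assoc b₁ a₁ _)))) ab₁) ⟩
          L * ρ * (P * P) * (k * (P * P)) ≈⟨ (solve 4 (λ a b c d → a :* b :* (c :* c) :* (d :* (c :* c)) := d :* (b :* (a :* (c :* c) :* (c :* c)))) refl L ρ P k) ⟩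
          k * (ρ * (L * (P * P) * (P * P))) ≤⟨ *-monoˡ k 0≤k L₂ ⟩
          k * (♯ 4 * k₄ ^ 2 * σ ^ 4) ≈⟨ trans (sym (*-identityˡ _)) (*-congʳ (sym Sβ)) ⟩
          S * β * (k * (♯ 4 * k₄ ^ 2 * σ ^ 4)) ≈⟨ (solve 5 (λ a b c d e → a :* b :* (c :* ((con (+ 4)) :* d :^ 2 :* e :^ 4)) := (con (+ 4)) :* a :* c :* d :* (b :* (d :* e :^ 4))) refl S β k k₄ σ) ⟩
          ♯ 4 * S * k * k₄ * (β * (k₄ * σ ^ 4)) ∎))
          (by≤ (0≤+ (0≤+ (*-nonneg 0≤k (0≤sub Sk₄≤1)) (0≤sub 2k≤1)) 0≤k) (solve 3 (λ a b c → con (+ 1) := (con (+ 4)) :* a :* b :* c :+ (b :* ((con (+ 1)) :- (con (+ 4)) :* a :* c) :+ ((con (+ 1)) :- (con (+ 2)) :* b) :+ b)) refl S k k₄))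

      slope≉0 : 0# < a₂
      slope≉0 = pos-cancel (ρ * (P * P)) (*-nonneg 0≤ρ 0≤PP) (<-≤-trans (*-pos 0<β 0<k₄σ²) (≤-respʳ (solve 3 (λ a b c → a :* (b :* (c :* c)) := b :* (a :* (c :* c))) refl ρ a₂ P) low₂))

  -- Homogeneous coordinates (p , r , q) of a rational point (p/q , r/q), or
  -- coefficients (A , B , C) of a rational line A x + B y + C = 0.
  record ℤ³ : Set where
    constructor vec
    field
      fst snd thd : ℤ

  open ℤ³

  -- Cross products, bad points and bad lines.

  det₂ : ℤ → ℤ → ℤ → ℤ → ℤ
  det₂ a b c d = a ℤ.* d ℤ.- b ℤ.* c

  infixl 7 _⊗_

  _⊗_ : ℤ³ → ℤ³ → ℤ³
  vec a₁ a₂ a₃ ⊗ vec b₁ b₂ b₃ = vec (det₂ a₂ a₃ b₂ b₃) (det₂ a₃ a₁ b₃ b₁) (det₂ a₁ a₂ b₁ b₂)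

  fromℤ-det₂ : ∀ a b c d → fromℤ (det₂ a b c d) ≈ fromℤ a * fromℤ d - fromℤ b * fromℤ c
  fromℤ-det₂ a b c d = trans (fromℤ-- (a ℤ.* d) (b ℤ.* c)) (+-cong (fromℤ-* a d) (-‿cong (fromℤ-* b c)))

  ∣+∣≤₂ : ∀ {x y z a b} → x ≈ y + z → ∣ y ∣ ≤ a → ∣ z ∣ ≤ b → ∣ x ∣ ≤ a + b
  ∣+∣≤₂ {y = y} {z} e p q = ≤-respˡ (sym (∣∣-cong e)) (≤-trans (∣+∣≤ y z) (+-mono-≤ p q))

  ∣-∣≤₂ : ∀ {x y z a b} → x ≈ y - z → ∣ y ∣ ≤ a → ∣ z ∣ ≤ b → ∣ x ∣ ≤ a + b
  ∣-∣≤₂ {y = y} {z} e p q = ≤-respˡ (sym (∣∣-cong e)) (≤-trans (∣-∣≤ y z) (+-mono-≤ p q))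

  ∣*∣≤ : ∀ {x y a b} → ∣ x ∣ ≤ a → ∣ y ∣ ≤ b → ∣ x * y ∣ ≤ a * b
  ∣*∣≤ {x} {y} p q = ≤-respˡ (sym (∣*∣ x y)) (*-mono (0≤∣∣ x) p (0≤∣∣ y) q)

  ≤⊔-scale : ∀ {x y z c} → 0# ≤ z → z * x ≤ c → z * y ≤ c → z * (x ⊔ y) ≤ c
  ≤⊔-scale {x} {y} {z} 0≤z p q with ⊔-sel x y
  ... | inj₁ e = ≤-respˡ (*-congˡ (sym e)) p
  ... | inj₂ e = ≤-respˡ (*-congˡ (sym e)) q

  module Side {β : ℝ} (𝒞 : Constants β) (e f g h P : ℝ) (1≤P : 1# ≤ P)
    (e≤D : ∣ e ∣ ≤ Constants.D 𝒞) (g≤D : ∣ g ∣ ≤ Constants.D 𝒞) (1≤De : 1# ≤ Constants.D 𝒞 * ∣ e ∣) where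

    open Constants 𝒞
    open DualConstants 𝒞

    private
      0<P = <-≤-trans 0<1 1≤P
      0≤P = <⇒≤ 0<P
      0≤PP = 0≤□ P

    den : ℤ³ → ℝ
    den v = fromℤ (thd v)

    X : ℤ³ → ℝ → ℝ
    X v t = den v * (e * t + f) - fromℤ (fst v)

    -- This is `g` times the error in the first coordinate minus `e` times the error in the second.
    -- The parameter cancels in it, so it measures the distance of the rational point from the line.
    L : ℤ³ → ℝ
    L v = g * (den v * f - fromℤ (fst v)) - e * (den v * h - fromℤ (snd v))

    -- The factor max (|L| , 1/P) of the badness condition, multiplied by `P`.
    height : ℤ³ → ℝ
    height v = (P * ∣ L v ∣) ⊔ 1#

    -- The slope of `val w` along the given line; it is small when the two lines are nearly
    -- parallel.
    α : ℤ³ → ℝ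
    α w = fromℤ (fst w) * e + fromℤ (snd w) * g

    val : ℤ³ → ℝ → ℝ
    val w t = fromℤ (fst w) * (e * t + f) + fromℤ (snd w) * (g * t + h) + fromℤ (thd w)

    -- Up to constants, v is bad on an interval of radius 1/(height · den · P), and it is
    -- found in class i at balls of radius Sⁱ/(height · den · P), where P²/den ≈ S³ⁱ.
    record VBad (v : ℤ³) (t : ℝ) : Set where
      field
        1≤den : 1# ≤ den v
        den≤  : den v ≤ P * P
        L≤    : ∣ L v ∣ ≤ ♯ 2 * D
        near  : P * ∣ X v t ∣ * height v ≤ c₀

    record VFound (i : ℕ) (B : Ball 1) (v : ℤ³) : Set where
      field
        class≤ : s i ^ 3 * den v ≤ P * P
        ≤class : P * P ≤ S ^ 3 * s i ^ 3 * den v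
        low    : β * (k₁ * s i) ≤ radius B * (height v * den v * P)
        up     : radius B * (height v * den v * P) ≤ k₁ * s i
        witness : ∃[ t ] (t within B × VBad v t)

    -- A line is bad if it could be spanned by two points of class i found at one ball.
    record WBad (i : ℕ) (w : ℤ³) (t : ℝ) : Set where
      field
        1≤snd   : 1# ≤ ∣ fromℤ (snd w) ∣
        product : ∣ fromℤ (snd w) ∣ * ∣ α w ∣ * s i ^ 5 ≤ k * (P * P)
        snd≤    : ∣ fromℤ (snd w) ∣ * s i ^ 2 ≤ k * P
        near    : ∣ val w t ∣ * (P * P) ≤ k * s i

    record WFound (i : ℕ) (B : Ball 1) (w : ℤ³) : Set where
      field
        low     : β * (k₄ * s i ^ 2) ≤ radius B * (∣ α w ∣ * (P * P))
        up      : radius B * (∣ α w ∣ * (P * P)) ≤ k₄ * s i ^ 2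
        witness : ∃[ t ] (t within B × WBad i w t)

    1≤height : ∀ v → 1# ≤ height v
    1≤height v = x≤y⊔x (P * ∣ L v ∣) 1#

    PL≤height : ∀ v → P * ∣ L v ∣ ≤ height v
    PL≤height v = x≤x⊔y (P * ∣ L v ∣) 1#

    0≤height : ∀ v → 0# ≤ height v
    0≤height v = ≤-trans 0≤1 (1≤height v)

    -- Between the bad parameter and the centre the error changes by at most the denominator times
    -- `D * radius B`, which `up` bounds after multiplication by `P` and the height.
    V-near-centre : ∀ {i B v} → VFound i B v → P * ∣ X v (centre B zero) ∣ * height v ≤ ♯ 2 * D * k₁ * s i
    V-near-centre {i} {B} {v} F = estimate (VFound.witness F)
      where
      c = centre B zero
      σ = s i
      estimate : ∃[ t ] (t within B × VBad v t) → P * ∣ X v c ∣ * height v ≤ ♯ 2 * D * k₁ * σ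
      estimate (t , t∈B , bad) = begin
        P * ∣ X v c ∣ * height v ≤⟨ *-monoʳ (height v) (0≤height v) (*-monoˡ P 0≤P moved) ⟩
        P * (∣ X v t ∣ + q * D * radius B) * height v ≈⟨ (solve 6 (λ a b c d e f → a :* (b :+ c :* d :* e) :* f := a :* b :* f :+ d :* (e :* (f :* c :* a))) refl P (∣ X v t ∣) q D (radius B) (height v)) ⟩
        P * ∣ X v t ∣ * height v + D * (radius B * (height v * q * P)) ≤⟨ +-mono-≤ (VBad.near bad) (*-monoˡ D 0≤D (VFound.up F)) ⟩
        c₀ + D * (k₁ * σ) ≤⟨ (by≤ (0≤sub c₀≤) (solve 4 (λ a b c d → (con (+ 2)) :* a :* b :* c := d :+ a :* (b :* c) :+ (a :* (b :* c) :- d)) refl D k₁ σ c₀)) ⟩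
        ♯ 2 * D * k₁ * σ ∎
        where
        q = den v
        0≤q = ≤-trans 0≤1 (VBad.1≤den bad)
        c₀≤ : c₀ ≤ D * (k₁ * σ)
        c₀≤ = ≤-trans c₀≤k₁ (≤-trans (x≤x*y 0≤k₁ (1≤s i)) (x≤y*x (*-nonneg 0≤k₁ (<⇒≤ (0<s i))) 1≤D))
        moved : ∣ X v c ∣ ≤ ∣ X v t ∣ + q * D * radius B
        moved = ∣-∣≤₂ {z = q * e * (t - c)} (solve 6 (λ a b c d e f → a :* (b :* c :+ d) :- e := a :* (b :* f :+ d) :- e :- a :* b :* (f :- c)) refl q e c f (fromℤ (fst v)) t) ≤-refl
          (∣*∣≤ {q * e} {t - c} (∣*∣≤ {q} {e} (≤-reflexive (∣∣-nonneg 0≤q)) e≤D) t∈B)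

    W-near-centre : ∀ {i B w} → WFound i B w → ∣ val w (centre B zero) ∣ * (P * P) ≤ ♯ 2 * k₄ * s i ^ 2
    W-near-centre {i} {B} {w} F = estimate (WFound.witness F)
      where
      c = centre B zero
      σ = s i
      estimate : ∃[ t ] (t within B × WBad i w t) → ∣ val w c ∣ * (P * P) ≤ ♯ 2 * k₄ * σ ^ 2
      estimate (t , t∈B , bad) = begin
        ∣ val w c ∣ * (P * P) ≤⟨ *-monoʳ (P * P) 0≤PP moved ⟩
        (∣ val w t ∣ + ∣ α w ∣ * radius B) * (P * P) ≈⟨ (solve 4 (λ a b c d → (a :+ b :* c) :* (d :* d) := a :* (d :* d) :+ c :* (b :* (d :* d))) refl (∣ val w t ∣) (∣ α w ∣) (radius B) P) ⟩
        ∣ val w t ∣ * (P * P) + radius B * (∣ α w ∣ * (P * P)) ≤⟨ +-mono-≤ (WBad.near bad) (WFound.up F) ⟩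
        k * σ + k₄ * σ ^ 2 ≤⟨ (by≤ (0≤+ (*-nonneg (0≤sub k≤k₄) (<⇒≤ (0<s i))) (*-nonneg (*-nonneg 0≤k₄ (<⇒≤ (0<s i))) (0≤sub (1≤s i)))) (solve 3 (λ a b c → (con (+ 2)) :* a :* b :^ 2 := c :* b :+ a :* b :^ 2 :+ ((a :- c) :* b :+ a :* b :* (b :- (con (+ 1))))) refl k₄ σ k)) ⟩
        ♯ 2 * k₄ * σ ^ 2 ∎
        where
        a₁ = fromℤ (fst w)
        a₂ = fromℤ (snd w)
        moved : ∣ val w c ∣ ≤ ∣ val w t ∣ + ∣ α w ∣ * radius B
        moved = ∣-∣≤₂ {z = α w * (t - c)} (solve 9 (λ a b c d e f g h i → a :* (b :* c :+ d) :+ e :* (f :* c :+ g) :+ h := a :* (b :* i :+ d) :+ e :* (f :* i :+ g) :+ h :- (a :* b :+ e :* f) :* (i :- c)) refl a₁ e c f a₂ g h (fromℤ (thd w)) t) ≤-refl (∣*∣≤ {α w} {t - c} ≤-refl t∈B)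

    private
      -- These identities write the integer determinants as differences of products with a factor
      -- `X`, `L`, `α` or `val`, and so make them accessible to estimates.
      det-X : ∀ p₁ q₁ p₂ q₂ x → q₁ * p₂ - p₁ * q₂ ≈ q₂ * (q₁ * x - p₁) - q₁ * (q₂ * x - p₂)
      det-X p₁ q₁ p₂ q₂ x = (solve 5 (λ a b c d e → a :* b :- c :* d := d :* (a :* e :- c) :- a :* (d :* e :- b)) refl q₁ p₂ p₁ q₂ x)

      det-L : ∀ p₁ r₁ q₁ p₂ r₂ q₂ → (r₁ * q₂ - q₁ * r₂) * e + (q₁ * p₂ - p₁ * q₂) * g ≈
        q₂ * (g * (q₁ * f - p₁) - e * (q₁ * h - r₁)) - q₁ * (g * (q₂ * f - p₂) - e * (q₂ * h - r₂))
      det-L p₁ r₁ q₁ p₂ r₂ q₂ = (solve 10 (λ a b c d e f g h i j → (a :* b :- c :* d) :* e :+ (c :* f :- g :* b) :* h := b :* (h :* (c :* i :- g) :- e :* (c :* j :- a)) :- c :* (h :* (b :* i :- f) :- e :* (b :* j :- d))) refl r₁ q₂ q₁ r₂ e p₂ p₁ g f h)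

      det-val : ∀ p₁ r₁ q₁ p₂ r₂ q₂ t → e * ((r₁ * q₂ - q₁ * r₂) * (e * t + f) + (q₁ * p₂ - p₁ * q₂) * (g * t + h) + (p₁ * r₂ - r₁ * p₂)) ≈
        (q₂ * (e * t + f) - p₂) * (g * (q₁ * f - p₁) - e * (q₁ * h - r₁)) - (q₁ * (e * t + f) - p₁) * (g * (q₂ * f - p₂) - e * (q₂ * h - r₂))
      det-val p₁ r₁ q₁ p₂ r₂ q₂ t = (solve 11 (λ a b c d e f g h i j k → a :* ((b :* c :- d :* e) :* (a :* f :+ g) :+ (d :* h :- i :* c) :* (j :* f :+ k) :+ (i :* e :- b :* h)) := (c :* (a :* f :+ g) :- h) :* (j :* (d :* g :- i) :- a :* (d :* k :- b)) :- (d :* (a :* f :+ g) :- i) :* (j :* (c :* g :- h) :- a :* (c :* k :- e))) refl e r₁ q₂ q₁ r₂ t f p₂ p₁ g h)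

      det-den : ∀ a₁ b₁ a₂ b₂ → e * (a₁ * b₂ - b₁ * a₂) ≈ (a₁ * e + b₁ * g) * b₂ - (a₂ * e + b₂ * g) * b₁
      det-den a₁ b₁ a₂ b₂ = (solve 6 (λ a b c d e f → a :* (b :* c :- d :* e) := (b :* a :+ d :* f) :* c :- (e :* a :+ c :* f) :* d) refl e a₁ b₂ b₁ a₂ g)

      det-num : ∀ a₁ b₁ c₁ a₂ b₂ c₂ x y → (a₁ * b₂ - b₁ * a₂) * x - (b₁ * c₂ - c₁ * b₂) ≈
        (a₁ * x + b₁ * y + c₁) * b₂ - (a₂ * x + b₂ * y + c₂) * b₁
      det-num a₁ b₁ c₁ a₂ b₂ c₂ x y = (solve 8 (λ a b c d e f g h → (a :* b :- c :* d) :* e :- (c :* f :- g :* b) := (a :* e :+ c :* h :+ g) :* b :- (d :* e :+ b :* h :+ f) :* c) refl a₁ b₂ b₁ a₂ x c₂ c₁ y)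

      det-lin : ∀ a₁ b₁ c₁ a₂ b₂ c₂ t → g * ((a₁ * b₂ - b₁ * a₂) * f - (b₁ * c₂ - c₁ * b₂)) - e * ((a₁ * b₂ - b₁ * a₂) * h - (c₁ * a₂ - a₁ * c₂)) ≈
        (a₁ * (e * t + f) + b₁ * (g * t + h) + c₁) * (a₂ * e + b₂ * g) - (a₂ * (e * t + f) + b₂ * (g * t + h) + c₂) * (a₁ * e + b₁ * g)
      det-lin a₁ b₁ c₁ a₂ b₂ c₂ t = (solve 11 (λ a b c d e f g h i j k → a :* ((b :* c :- d :* e) :* f :- (d :* g :- h :* c)) :- i :* ((b :* c :- d :* e) :* j :- (h :* e :- b :* g)) := (b :* (i :* k :+ f) :+ d :* (a :* k :+ j) :+ h) :* (e :* i :+ c :* a) :- (e :* (i :* k :+ f) :+ c :* (a :* k :+ j) :+ g) :* (b :* i :+ d :* a)) refl g a₁ b₂ b₁ a₂ f c₂ c₁ e h t)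

    snd-⊗ : ∀ v₁ v₂ t → fromℤ (snd (v₁ ⊗ v₂)) ≈ den v₂ * X v₁ t - den v₁ * X v₂ t
    snd-⊗ v₁ v₂ t = trans (fromℤ-det₂ (thd v₁) (fst v₁) (thd v₂) (fst v₂)) (det-X (fromℤ (fst v₁)) (den v₁) (fromℤ (fst v₂)) (den v₂) (e * t + f))

    α-⊗ : ∀ v₁ v₂ → α (v₁ ⊗ v₂) ≈ den v₂ * L v₁ - den v₁ * L v₂
    α-⊗ v₁ v₂ = trans (+-cong (*-congʳ (fromℤ-det₂ (snd v₁) (thd v₁) (snd v₂) (thd v₂))) (*-congʳ (fromℤ-det₂ (thd v₁) (fst v₁) (thd v₂) (fst v₂))))
      (det-L (fromℤ (fst v₁)) (fromℤ (snd v₁)) (den v₁) (fromℤ (fst v₂)) (fromℤ (snd v₂)) (den v₂))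

    val-⊗ : ∀ v₁ v₂ t → e * val (v₁ ⊗ v₂) t ≈ X v₂ t * L v₁ - X v₁ t * L v₂
    val-⊗ v₁ v₂ t = trans (*-congˡ (+-cong (+-cong (*-congʳ (fromℤ-det₂ (snd v₁) (thd v₁) (snd v₂) (thd v₂)))
        (*-congʳ (fromℤ-det₂ (thd v₁) (fst v₁) (thd v₂) (fst v₂)))) (fromℤ-det₂ (fst v₁) (snd v₁) (fst v₂) (snd v₂))))
      (det-val (fromℤ (fst v₁)) (fromℤ (snd v₁)) (den v₁) (fromℤ (fst v₂)) (fromℤ (snd v₂)) (den v₂) t)

    den-⊗ : ∀ w₁ w₂ → e * den (w₁ ⊗ w₂) ≈ α w₁ * fromℤ (snd w₂) - α w₂ * fromℤ (snd w₁)
    den-⊗ w₁ w₂ = trans (*-congˡ (fromℤ-det₂ (fst w₁) (snd w₁) (fst w₂) (snd w₂)))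
      (det-den (fromℤ (fst w₁)) (fromℤ (snd w₁)) (fromℤ (fst w₂)) (fromℤ (snd w₂)))

    X-⊗ : ∀ w₁ w₂ t → X (w₁ ⊗ w₂) t ≈ val w₁ t * fromℤ (snd w₂) - val w₂ t * fromℤ (snd w₁)
    X-⊗ w₁ w₂ t = trans (+-cong (*-congʳ (fromℤ-det₂ (fst w₁) (snd w₁) (fst w₂) (snd w₂))) (-‿cong (fromℤ-det₂ (snd w₁) (thd w₁) (snd w₂) (thd w₂))))
      (det-num (fromℤ (fst w₁)) (fromℤ (snd w₁)) (fromℤ (thd w₁)) (fromℤ (fst w₂)) (fromℤ (snd w₂)) (fromℤ (thd w₂)) (e * t + f) (g * t + h))

    L-⊗ : ∀ w₁ w₂ t → L (w₁ ⊗ w₂) ≈ val w₁ t * α w₂ - val w₂ t * α w₁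
    L-⊗ w₁ w₂ t = trans (+-cong (*-congˡ (+-cong (*-congʳ q) (-‿cong (fromℤ-det₂ (snd w₁) (thd w₁) (snd w₂) (thd w₂)))))
        (-‿cong (*-congˡ (+-cong (*-congʳ q) (-‿cong (fromℤ-det₂ (thd w₁) (fst w₁) (thd w₂) (fst w₂)))))))
      (det-lin (fromℤ (fst w₁)) (fromℤ (snd w₁)) (fromℤ (thd w₁)) (fromℤ (fst w₂)) (fromℤ (snd w₂)) (fromℤ (thd w₂)) t)
      where q = fromℤ-det₂ (fst w₁) (snd w₁) (fst w₂) (snd w₂)

    X-shift : ∀ v t z → X v t ≈ X v z + den v * e * (t - z)
    X-shift v t z = shift (den v) (fromℤ (fst v))
      where
      shift : ∀ q p → q * (e * t + f) - p ≈ q * (e * z + f) - p + q * e * (t - z)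
      shift q p = (solve 6 (λ a b c d e f → a :* (b :* c :+ d) :- e := a :* (b :* f :+ d) :- e :+ a :* b :* (c :- f)) refl q e t f p z)

    val-shift : ∀ w t z → val w t ≈ val w z + α w * (t - z)
    val-shift w t z = shift (fromℤ (fst w)) (fromℤ (snd w)) (fromℤ (thd w))
      where
      shift : ∀ a b c → a * (e * t + f) + b * (g * t + h) + c ≈ a * (e * z + f) + b * (g * z + h) + c + (a * e + b * g) * (t - z)
      shift a b c = (solve 9 (λ a b c d e f g h i → a :* (b :* c :+ d) :+ e :* (f :* c :+ g) :+ h := a :* (b :* i :+ d) :+ e :* (f :* i :+ g) :+ h :+ (a :* b :+ e :* f) :* (c :- i)) refl a e t f b g h c z)

  module SideUniqueness {β : ℝ} (𝒞 : Constants β) (e f g h P : ℝ) (1≤P : 1# ≤ P)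
    (e≤D : ∣ e ∣ ≤ Constants.D 𝒞) (g≤D : ∣ g ∣ ≤ Constants.D 𝒞) (1≤De : 1# ≤ Constants.D 𝒞 * ∣ e ∣) where

    open Constants 𝒞
    open DualConstants 𝒞
    open Side 𝒞 e f g h P 1≤P e≤D g≤D 1≤De public

    private
      0<P = <-≤-trans 0<1 1≤P
      0≤P = <⇒≤ 0<P

      e≉0 : ¬ (e ≈ 0#)
      e≉0 e≈0 = <⇒≱ 0<1 (≤-trans 1≤De (≤-reflexive (trans (*-congˡ (trans (∣∣-cong e≈0) (∣∣-nonneg ≤-refl))) (zeroʳ D))))

      0<den : ∀ {i B v} → VFound i B v → 0# < den v
      0<den F = let (_ , _ , bad) = VFound.witness F in <-≤-trans 0<1 (VBad.1≤den bad)

      same-root : ∀ {m z z′} → ¬ (m ≈ 0#) → m * (z - z′) ≈ 0# → z ≈ z′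
      same-root {m} {z} {z′} m≉0 p = trans (solve 2 (λ a b → a := a :- b :+ b) refl z z′) (trans (+-congʳ (*-zero-cancel (trans (*-comm _ m) p) m≉0)) (+-identityˡ z′))

      0≈+⇒ : ∀ {x y z} → x ≈ 0# → y ≈ 0# → x ≈ y + z → z ≈ 0#
      0≈+⇒ {x} {y} {z} x≈0 y≈0 p = trans (solve 2 (λ a b → a := b :+ a :- b) refl z y) (trans (+-cong (trans (sym p) x≈0) (-‿cong y≈0)) (-‿inverseʳ 0#))

    X-root-unique : ∀ {v z z′} → 0# < den v → X v z ≈ 0# → X v z′ ≈ 0# → z ≈ z′
    X-root-unique {v} {z} {z′} 0<q p p′ = same-root (λ q → e≉0 (*-zero-cancel (trans (*-comm e _) q) (pos≉0 0<q))) (0≈+⇒ p p′ (X-shift v z z′))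

    val-root-unique : ∀ {w z z′} → 0# < ∣ α w ∣ → val w z ≈ 0# → val w z′ ≈ 0# → z ≈ z′
    val-root-unique {w} {z} {z′} 0<a p p′ = same-root (λ q → pos≉0 0<a (trans (∣∣-cong q) (∣∣-nonneg ≤-refl))) (0≈+⇒ p p′ (val-shift w z z′))

    private
      module TwoV {i B v₁ v₂} (F₁ : VFound i B v₁) (F₂ : VFound i B v₂) where
        c = centre B zero
        w = v₁ ⊗ v₂
        q₁ = den v₁
        q₂ = den v₂
        0<q₁ = 0<den F₁
        0<q₂ = 0<den F₂

        open TwoPoints {i} {P} {radius B} {q₁} {q₂} {P * ∣ X v₁ c ∣} {P * ∣ X v₂ c ∣} {height v₁} {height v₂} 0<P (<⇒≤ (positive B)) 0<q₁ 0<q₂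
          (*-nonneg 0≤P (0≤∣∣ _)) (*-nonneg 0≤P (0≤∣∣ _)) (1≤height v₁) (1≤height v₂)
          (VFound.class≤ F₁) (VFound.class≤ F₂) (VFound.≤class F₁) (VFound.≤class F₂)
          (V-near-centre F₁) (V-near-centre F₂) (VFound.low F₁) (VFound.up F₁) (VFound.low F₂) (VFound.up F₂)

        scale : ∀ {q x} → 0# < q → ∣ q * x ∣ ≤ q * ∣ x ∣
        scale {q} {x} 0<q = ∣*∣≤ {q} {x} (≤-reflexive (∣∣-nonneg (<⇒≤ 0<q))) ≤-refl

        b≤ : ∣ fromℤ (snd w) ∣ * P ≤ q₂ * (P * ∣ X v₁ c ∣) + q₁ * (P * ∣ X v₂ c ∣)
        b≤ = ≤-trans (*-monoʳ P 0≤P (∣-∣≤₂ (snd-⊗ v₁ v₂ c) (scale 0<q₂) (scale 0<q₁)))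
          (≤-reflexive (solve 5 (λ a b c d e → (a :* b :+ c :* d) :* e := a :* (e :* b) :+ c :* (e :* d)) refl q₂ (∣ X v₁ c ∣) q₁ (∣ X v₂ c ∣) P))

        a≤ : ∣ α w ∣ * P ≤ q₂ * height v₁ + q₁ * height v₂
        a≤ = ≤-trans (*-monoʳ P 0≤P (∣-∣≤₂ (α-⊗ v₁ v₂) (scale 0<q₂) (scale 0<q₁)))
          (≤-trans (≤-reflexive (solve 5 (λ a b c d e → (a :* b :+ c :* d) :* e := a :* (e :* b) :+ c :* (e :* d)) refl q₂ (∣ L v₁ ∣) q₁ (∣ L v₂ ∣) P))
            (+-mono-≤ (*-monoˡ q₂ (<⇒≤ 0<q₂) (PL≤height v₁)) (*-monoˡ q₁ (<⇒≤ 0<q₁) (PL≤height v₂))))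

        w≤ : ∣ e ∣ * (∣ val w c ∣ * (P * P)) ≤ P * ∣ X v₂ c ∣ * height v₁ + P * ∣ X v₁ c ∣ * height v₂
        w≤ = ≤-trans (≤-reflexive (trans (sym (*-assoc _ _ _)) (*-congʳ (sym (∣*∣ e (val w c))))))
          (≤-trans (*-monoʳ (P * P) (0≤□ P) (∣-∣≤₂ (val-⊗ v₁ v₂ c) (∣*∣≤ {X v₂ c} {L v₁} ≤-refl ≤-refl) (∣*∣≤ {X v₁ c} {L v₂} ≤-refl ≤-refl)))
          (≤-trans (≤-reflexive (solve 5 (λ a b c d e → (a :* b :+ c :* d) :* (e :* e) := e :* a :* (e :* b) :+ e :* c :* (e :* d)) refl (∣ X v₂ c ∣) (∣ L v₁ ∣) (∣ X v₁ c ∣) (∣ L v₂ ∣) P))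
            (+-mono-≤ (*-monoˡ _ (*-nonneg 0≤P (0≤∣∣ _)) (PL≤height v₁)) (*-monoˡ _ (*-nonneg 0≤P (0≤∣∣ _)) (PL≤height v₂)))))

        bad : 1# ≤ ∣ fromℤ (snd w) ∣ → WBad i w c
        bad 1≤b = record
          { 1≤snd = 1≤b
          ; product = product (0≤∣∣ _) (0≤∣∣ _) b≤ a≤
          ; snd≤ = coefficient b≤
          ; near = value {∣ val w c ∣} {∣ e ∣} (0≤∣∣ _) 1≤De w≤
          }

        slow : radius B * (∣ α w ∣ * (P * P)) ≤ ♯ 2 * S ^ 3 * k₁ * s i
        slow = slope a≤

        -- A vanishing second coefficient makes the functions `X v₁` and `X v₂` proportional.
        parallel : ∀ {z z′} → snd w ≡ + 0 → X v₁ z ≈ 0# → X v₂ z′ ≈ 0# → z ≈ z′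
        parallel {z} {z′} e₀ p p′ = X-root-unique {v₂} 0<q₂ (*-zero-cancel (trans (*-comm _ q₁) vanish) (pos≉0 0<q₁)) p′
          where
          vanish : q₁ * X v₂ z ≈ 0#
          vanish = trans (solve 4 (λ a b c d → a :* b := c :* d :- (c :* d :- a :* b)) refl q₁ (X v₂ z) q₂ (X v₁ z))
            (trans (+-cong (trans (*-congˡ p) (zeroʳ q₂)) (-‿cong (trans (sym (snd-⊗ v₁ v₂ z)) (reflexive (≡.cong fromℤ e₀))))) (-‿inverseʳ 0#))

    -- The second coefficient of the spanned line decides: as an integer it is either zero or at
    -- least one in absolute value, and the latter is what `WBad` asks for.
    V-unique : ∀ {i B v₁ v₂ z₁ z₂} → VFound i B v₁ → VFound i B v₂ → X v₁ z₁ ≈ 0# → X v₂ z₂ ≈ 0# →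
      z₁ ≈ z₂ ⊎ (WBad i (v₁ ⊗ v₂) (centre B zero) × radius B * (∣ α (v₁ ⊗ v₂) ∣ * (P * P)) ≤ ♯ 2 * S ^ 3 * k₁ * s i)
    V-unique {i} {B} {v₁} {v₂} F₁ F₂ p₁ p₂ with snd (v₁ ⊗ v₂) ℤ.≟ + 0
    ... | yes e₀ = inj₁ (TwoV.parallel F₁ F₂ e₀ p₁ p₂)
    ... | no ne = inj₂ (TwoV.bad F₁ F₂ (1≤∣fromℤ∣ (snd (v₁ ⊗ v₂)) ne) , TwoV.slow F₁ F₂)

    private
      1≤snd : ∀ {i B w} → WFound i B w → 1# ≤ ∣ fromℤ (snd w) ∣
      1≤snd F = let (_ , _ , bad) = WFound.witness F in WBad.1≤snd bad

      W-product : ∀ {i B w} → WFound i B w → ∣ fromℤ (snd w) ∣ * ∣ α w ∣ * s i ^ 5 ≤ k * (P * P)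
      W-product F = let (_ , _ , bad) = WFound.witness F in WBad.product bad

      W-snd≤ : ∀ {i B w} → WFound i B w → ∣ fromℤ (snd w) ∣ * s i ^ 2 ≤ k * P
      W-snd≤ F = let (_ , _ , bad) = WFound.witness F in WBad.snd≤ bad

      module TwoW {i B w₁ w₂} (F₁ : WFound i B w₁) (F₂ : WFound i B w₂) where
        c = centre B zero
        v = w₁ ⊗ w₂
        b₁ = ∣ fromℤ (snd w₁) ∣
        b₂ = ∣ fromℤ (snd w₂) ∣
        a₁ = ∣ α w₁ ∣
        a₂ = ∣ α w₂ ∣
        ω₁ = ∣ val w₁ c ∣
        ω₂ = ∣ val w₂ c ∣

        open TwoLines {i} {P} {radius B} {a₁} {a₂} {b₁} {b₂} {ω₁} {ω₂} 1≤P (<⇒≤ (positive B)) (0≤∣∣ _) (0≤∣∣ _)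
          (1≤snd F₁) (1≤snd F₂) (0≤∣∣ _) (0≤∣∣ _) (W-product F₁) (W-product F₂) (W-snd≤ F₁) (W-snd≤ F₂)
          (WFound.low F₁) (WFound.up F₁) (WFound.low F₂) (WFound.up F₂) (W-near-centre F₁) (W-near-centre F₂)

        x≤ : ∣ X v c ∣ ≤ ω₁ * b₂ + ω₂ * b₁
        x≤ = ∣-∣≤₂ (X-⊗ w₁ w₂ c) (∣*∣≤ {val w₁ c} {fromℤ (snd w₂)} ≤-refl ≤-refl) (∣*∣≤ {val w₂ c} {fromℤ (snd w₁)} ≤-refl ≤-refl)

        L≤ : ∣ L v ∣ ≤ ω₁ * a₂ + ω₂ * a₁
        L≤ = ∣-∣≤₂ (L-⊗ w₁ w₂ c) (∣*∣≤ {val w₁ c} {α w₂} ≤-refl ≤-refl) (∣*∣≤ {val w₂ c} {α w₁} ≤-refl ≤-refl)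

        module _ (1≤q : 1# ≤ den v) where

          0≤q : 0# ≤ den v
          0≤q = ≤-trans 0≤1 1≤q

          q≤ : den v ≤ D * (a₁ * b₂ + a₂ * b₁)
          q≤ = ≤-trans (x≤y*x 0≤q 1≤De) (≤-trans (≤-reflexive (trans (*-assoc D _ _) (*-congˡ (trans (*-congˡ (sym (∣∣-nonneg 0≤q))) (sym (∣*∣ e (den v)))))))
            (*-monoˡ D 0≤D (∣-∣≤₂ (den-⊗ w₁ w₂) (∣*∣≤ {α w₁} {fromℤ (snd w₂)} ≤-refl ≤-refl) (∣*∣≤ {α w₂} {fromℤ (snd w₁)} ≤-refl ≤-refl))))

          bad : VBad v c
          bad = record
            { 1≤den = 1≤q
            ; den≤ = denominator 0≤q q≤
            ; L≤ = ≤-trans (L≤1 (0≤∣∣ _) L≤) (≤-trans 1≤D (by≤ 0≤D (solve 1 (λ a → (con (+ 2)) :* a := a :+ a) refl D)))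
            ; near = ≤-trans (≤⊔-scale (*-nonneg 0≤P (0≤∣∣ _)) (product (0≤∣∣ _) L≤ (0≤∣∣ _) x≤) (≤-respˡ (sym (*-identityʳ _)) (numerator x≤))) kk₄≤
            }

          slow : radius B * (height v * den v * P) ≤ ♯ 2 * D * k * k₄
          slow = ≤-respˡ (solve 4 (λ a b c d → a :* b :* c :* d := a :* (d :* b :* c)) refl (radius B) (den v) P (height v))
            (≤⊔-scale (*-nonneg (*-nonneg (<⇒≤ (positive B)) 0≤q) 0≤P)
              (≤-respˡ (solve 4 (λ a b c d → a :* (b :* c :* d :* b) := a :* d :* b :* (b :* c)) refl (radius B) P (∣ L v ∣) (den v)) (L-timing (0≤∣∣ _) L≤ 0≤q q≤))
              (≤-respˡ (solve 3 (λ a b c → a :* (b :* c) := a :* b :* c :* (con (+ 1))) refl (radius B) (den v) P) (timing 0≤q q≤)))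

        -- With denominator zero, `X v` is constant and equals an integer up to sign. By `numerator`
        -- it is at most 1/2 in absolute value, hence zero, and the two functions `val` are
        -- proportional.
        parallel : ∀ {z z′} → thd v ≡ + 0 → val w₁ z ≈ 0# → val w₂ z′ ≈ 0# → z ≈ z′
        parallel {z} {z′} q≡0 p p′ = val-root-unique {w₂} slope≉0 (*-zero-cancel vanish b₁≉0) p′
          where
          den≈0 : den v ≈ 0#
          den≈0 = reflexive (≡.cong fromℤ q≡0)
          X≈ : ∀ t → X v t ≈ - fromℤ (fst v)
          X≈ t = trans (+-congʳ (trans (*-congʳ den≈0) (zeroˡ _))) (+-identityˡ _)
          fst≡0 : fst v ≡ + 0
          fst≡0 = ∣fromℤ∣<1 (fst v) (≰⇒> λ 1≤p → <⇒≱ 0<1 (1≤p⇒ 1≤p))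
            where
            1≤p⇒ : 1# ≤ ∣ fromℤ (fst v) ∣ → 1# ≤ 0#
            1≤p⇒ 1≤p = (by≤ (0≤+ (0≤+ (0≤+ (0≤+ (0≤sub (1≤x*y 1≤P 1≤p)) (0≤sub (1≤x*y 1≤P 1≤p))) (0≤sub (≤-respˡ (*-congˡ (trans (∣∣-cong (X≈ c)) (∣-∣ _))) (numerator x≤)))) (0≤sub (≤-respˡ (*-congˡ (trans (∣∣-cong (X≈ c)) (∣-∣ _))) (numerator x≤)))) (0≤sub 8kk₄≤1)) (solve 4 (λ a b c d → con (+ 0) := (con (+ 1)) :+ (a :* b :- (con (+ 1)) :+ (a :* b :- (con (+ 1))) :+ ((con (+ 4)) :* c :* d :- a :* b) :+ ((con (+ 4)) :* c :* d :- a :* b) :+ ((con (+ 1)) :- (con (+ 8)) :* c :* d))) refl P (∣ fromℤ (fst v) ∣) k k₄))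
          B₁ = fromℤ (snd w₁)
          B₂ = fromℤ (snd w₂)
          b₁≉0 : ¬ (B₁ ≈ 0#)
          b₁≉0 q = <⇒≱ 0<1 (≤-trans (1≤snd F₁) (≤-reflexive (trans (∣∣-cong q) (∣∣-nonneg ≤-refl))))
          vanish : val w₂ z * B₁ ≈ 0#
          vanish = trans (solve 4 (λ a b c d → a :* b := c :* d :- (c :* d :- a :* b)) refl (val w₂ z) B₁ (val w₁ z) B₂)
            (trans (+-cong (trans (*-congʳ p) (zeroˡ B₂)) (-‿cong (trans (sym (X-⊗ w₁ w₂ z)) (trans (X≈ z) (trans (-‿cong (reflexive (≡.cong fromℤ fst≡0))) -0#≈0#)))))
              (-‿inverseʳ 0#))

      den-swap : ∀ w₁ w₂ → den (w₂ ⊗ w₁) ≈ - den (w₁ ⊗ w₂)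
      den-swap w₁ w₂ = trans (fromℤ-det₂ (fst w₂) (snd w₂) (fst w₁) (snd w₁)) (trans (swap (fromℤ (fst w₁)) (fromℤ (snd w₁)) (fromℤ (fst w₂)) (fromℤ (snd w₂)))
        (-‿cong (sym (fromℤ-det₂ (fst w₁) (snd w₁) (fst w₂) (snd w₂)))))
        where
        swap : ∀ a₁ b₁ a₂ b₂ → a₂ * b₁ - b₂ * a₁ ≈ - (a₁ * b₂ - b₁ * a₂)
        swap a₁ b₁ a₂ b₂ = (solve 4 (λ a b c d → a :* b :- c :* d := :- (d :* c :- b :* a)) refl a₂ b₁ b₂ a₁)

    -- A bad point needs a positive denominator, so the two lines are exchanged when the cross
    -- product has a negative one.
    W-unique : ∀ {i B w₁ w₂ z₁ z₂} → WFound i B w₁ → WFound i B w₂ → val w₁ z₁ ≈ 0# → val w₂ z₂ ≈ 0# →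
      z₁ ≈ z₂ ⊎ ∃[ v ] (VBad v (centre B zero) × radius B * (height v * den v * P) ≤ ♯ 2 * D * k * k₄)
    W-unique {i} {B} {w₁} {w₂} F₁ F₂ p₁ p₂ = by-sign (thd (w₁ ⊗ w₂)) ≡.refl
      where
      by-sign : ∀ q → thd (w₁ ⊗ w₂) ≡ q → _
      by-sign (+ zero) q≡ = inj₁ (TwoW.parallel F₁ F₂ q≡ p₁ p₂)
      by-sign (+[1+ n ]) q≡ = inj₂ (w₁ ⊗ w₂ , TwoW.bad F₁ F₂ 1≤q , TwoW.slow F₁ F₂ 1≤q)
        where
        1≤q : 1# ≤ den (w₁ ⊗ w₂)
        1≤q = ≤-respʳ (reflexive (≡.cong fromℤ (≡.sym q≡))) (1≤fromℕ {suc n} (ℕ.s≤s ℕ.z≤n))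
      by-sign -[1+ n ] q≡ = inj₂ (w₂ ⊗ w₁ , TwoW.bad F₂ F₁ 1≤q , TwoW.slow F₂ F₁ 1≤q)
        where
        1≤q : 1# ≤ den (w₂ ⊗ w₁)
        1≤q = ≤-respʳ (trans (sym (-‿involutive _)) (trans (-‿cong (reflexive (≡.cong fromℤ (≡.sym q≡)))) (sym (den-swap w₁ w₂)))) (1≤fromℕ {suc n} (ℕ.s≤s ℕ.z≤n))

  -- Noticing times, deadlines and the avoidance of bad points.

  linear-root : ∀ {m} n → ¬ (m ≈ 0#) → ∃[ z ] (m * z + n ≈ 0#)
  linear-root {m} n m≉0 = - (n * m ⁻¹) , trans (solve 3 (λ a b c → a :* (:- (b :* c)) :+ b := b :- b :* (a :* c)) refl m n (m ⁻¹))
    (trans (+-congˡ (-‿cong (trans (*-congˡ (⁻¹-inverse m m≉0)) (*-identityʳ n)))) (-‿inverseʳ n))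

  module Timing {β : ℝ} (0<β : 0# < β) (N : NestedBalls β) where
    open NestedBalls N

    -- A turn shrinks the radius by no less than `β`, so the product cannot jump over the range from
    -- `β * T` to `T`.
    crossing : ∀ {x T} n → 0# ≤ x → T < ρ 0 * x → ρ n * x ≤ T → ∃[ m ] (m ℕ.≤ n × β * T ≤ ρ m * x × ρ m * x ≤ T)
    crossing zero 0≤x p q = ⊥-elim (<⇒≱ p q)
    crossing {x} {T} (suc n) 0≤x p q with ≤-or-> (ρ n * x) T
    ... | inj₁ r = let (m , m≤n , a , b) = crossing n 0≤x p r in m , ℕ.m≤n⇒m≤1+n m≤n , a , b
    ... | inj₂ r = suc n , ℕ.≤-refl , (by≤ (0≤+ (*-nonneg (<⇒≤ 0<β) (0≤sub (<⇒≤ r))) (*-nonneg 0≤x (0≤sub (ratio n)))) (solve 5 (λ a b c d e → a :* b := c :* d :+ (c :* (e :* b :- d) :+ b :* (a :- c :* e))) refl (ρ (suc n)) x β T (ρ n))) , q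

    -- After fewer than `l` turns the radius would still be at least `β ^ l` times that of turn `m`.
    deadline : ∀ {x T} l {m n} → 0# ≤ x → T ≤ ρ m * x → ρ n * x < β ^ l * T → l ℕ.+ m ℕ.≤ n
    deadline {x} {T} l {m} {n} 0≤x p q with l ℕ.+ m ℕ.≤? n
    ... | yes r = r
    ... | no ¬r = ⊥-elim (<⇒≱ q (≤-trans (*-monoˡ (β ^ l) (^-nonneg l (<⇒≤ 0<β)) p)
        (by≤ (*-nonneg (0≤sub (≤-trans (ratio* (<⇒≤ 0<β) m l) (antitone (ℕ.<⇒≤ (ℕ.≰⇒> ¬r))))) 0≤x) (solve 4 (λ a b c d → a :* b := c :* (d :* b) :+ (a :- c :* d) :* b) refl (ρ n) x (β ^ l) (ρ m)))))

  -- It is left open which target was picked and cleared; the uniqueness lemmas identify its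
  -- position with that of any other target noticed at the same ball.
  Cleared : ∀ {β} → NestedBalls β → ℕ → (Ball 1 → ℝ → Set) → ℕ → Set
  Cleared {β} N l T n = ∃[ z ] (T (ball n) z × (∀ t → t within ball (l ℕ.+ n) → ¬ (∣ t - z ∣ ≤ β ^ l * ρ n)))
    where open NestedBalls N

  module SidePlay {β : ℝ} (𝒞 : Constants β) (e f g h P : ℝ) (1≤P : 1# ≤ P)
    (e≤D : ∣ e ∣ ≤ Constants.D 𝒞) (g≤D : ∣ g ∣ ≤ Constants.D 𝒞) (1≤De : 1# ≤ Constants.D 𝒞 * ∣ e ∣) where

    open Constants 𝒞
    open SideUniqueness 𝒞 e f g h P 1≤P e≤D g≤D 1≤De public

    private
      0<P = <-≤-trans 0<1 1≤P
      0≤P = <⇒≤ 0<P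

      e≉0 : ¬ (e ≈ 0#)
      e≉0 e≈0 = <⇒≱ 0<1 (≤-trans 1≤De (≤-reflexive (trans (*-congˡ (trans (∣∣-cong e≈0) (∣∣-nonneg ≤-refl))) (zeroʳ D))))

    VTarget WTarget : ℕ → Ball 1 → ℝ → Set
    VTarget i B z = ∃[ v ] (X v z ≈ 0# × VFound i B v)
    WTarget i B z = ∃[ w ] (val w z ≈ 0# × WFound i B w)

    private
      class-from : ∀ {q} n → q ≤ P * P → P * P ≤ S ^ 3 * s n ^ 3 * q → ∃[ i ] (s i ^ 3 * q ≤ P * P × P * P ≤ S ^ 3 * s i ^ 3 * q)
      class-from {q} zero q≤ p = 0 , ≤-respˡ (solve 1 (λ a → a := (con (+ 1)) :^ 3 :* a) refl q) q≤ , p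
      class-from {q} (suc n) q≤ p with ≤-or-> (s (suc n) ^ 3 * q) (P * P)
      ... | inj₁ r = suc n , r , p
      ... | inj₂ r = class-from n q≤ (≤-trans (<⇒≤ r) (≤-reflexive (solve 3 (λ a b c → (a :* b) :^ 3 :* c := a :^ 3 :* b :^ 3 :* c) refl S (s n) q)))

      beyond : ∀ {q} → 1# ≤ q → ∃[ n ] (P * P < s n) → ∃[ n ] (P * P ≤ S ^ 3 * s n ^ 3 * q)
      beyond {q} 1≤q (n , p) = n , ≤-trans (<⇒≤ p) (≤-trans (x≤x*y 0≤σ 1≤σ) (≤-trans (x≤x*y (*-nonneg 0≤σ 0≤σ) 1≤σ)
        (≤-trans (≤-reflexive (solve 1 (λ a → a :* a :* a := a :^ 3) refl (s n))) (≤-trans (x≤y*x (^-nonneg 3 0≤σ) (1≤^ 3 1≤S)) (x≤x*y (*-nonneg (^-nonneg 3 0≤S) (^-nonneg 3 0≤σ)) 1≤q)))))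
        where
        1≤σ = 1≤s n
        0≤σ = <⇒≤ (0<s n)

    class : ∀ {q} → 1# ≤ q → q ≤ P * P → ∃[ i ] (s i ^ 3 * q ≤ P * P × P * P ≤ S ^ 3 * s i ^ 3 * q)
    class 1≤q q≤ = let (n , p) = beyond 1≤q (^-unbounded 1<S (P * P)) in class-from n q≤ p

    module _ (N : NestedBalls β)
      (clearV : ∀ n i z → VTarget i (NestedBalls.ball N n) z → Cleared N (l₀ ℕ.+ i) (VTarget i) n)
      (clearW : ∀ n i z → WTarget i (NestedBalls.ball N n) z → Cleared N (l₀ ℕ.+ i) (WTarget i) n)
      (startV : ∀ i v t → t within NestedBalls.ball N 0 → VBad v t → s i ^ 3 * den v ≤ P * P → k₁ * s i < NestedBalls.ρ N 0 * (height v * den v * P))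
      (startW : ∀ i w t → t within NestedBalls.ball N 0 → WBad i w t → k₄ * s i ^ 2 < NestedBalls.ρ N 0 * (∣ α w ∣ * (P * P)))
      where

      open NestedBalls N
      open Timing 0<β N

      -- The thresholds are those delivered by `W-unique` and `V-unique`. They describe objects
      -- whose noticing time and deadline both lie in the past.
      VAvoid WAvoid : ℕ → Set
      VAvoid n = ∀ v t → t within ball n → VBad v t → ¬ (ρ n * (height v * den v * P) ≤ ♯ 2 * D * k * k₄)
      WAvoid n = ∀ i w t → t within ball n → WBad i w t → ¬ (ρ n * (∣ α w ∣ * (P * P)) ≤ ♯ 2 * S ^ 3 * k₁ * s i)

      private
        radius-bound : ∀ {d K} i n → 0# < K → d * (β * (K * s i)) ≤ ρ n * (β ^ suc l₀ * K) → d ≤ β ^ (l₀ ℕ.+ i) * ρ n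
        radius-bound {d} {K} i n 0<K p = ≤-respʳ (*-congʳ (sym (^-homo-* β l₀ i))) (begin
          d ≈⟨ trans (sym (*-identityʳ d)) (*-congˡ (sym (sβ i))) ⟩
          d * (s i * β ^ i) ≈⟨ sym (*-assoc _ _ _) ⟩
          d * s i * β ^ i ≤⟨ *-monoʳ (β ^ i) (^-nonneg i 0≤β) (*-cancelʳ-≤ (β * K) (*-pos 0<β 0<K)
              (≤-respˡ (solve 4 (λ a b c d → a :* (b :* (c :* d)) := a :* d :* (b :* c)) refl d β K (s i)) (≤-respʳ (solve 4 (λ a b c d → a :* (b :* c :* d) := a :* c :* (b :* d)) refl (ρ n) β (β ^ l₀) K) p))) ⟩
          ρ n * β ^ l₀ * β ^ i ≈⟨ (solve 3 (λ a b c → a :* b :* c := b :* c :* a) refl (ρ n) (β ^ l₀) (β ^ i)) ⟩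
          β ^ l₀ * β ^ i * ρ n ∎)

        -- The `i` additional turns of class `i` cancel one factor `s i` of the noticing scale. For
        -- points this makes the threshold independent of the class; for lines one factor `s i`
        -- remains.
        deadline-value : ∀ K i → β ^ (l₀ ℕ.+ i) * (β * (K * s i)) ≈ β ^ suc l₀ * K
        deadline-value K i = trans (*-congʳ (^-homo-* β l₀ i)) (trans (solve 5 (λ a b c d e → a :* b :* (c :* (d :* e)) := c :* a :* d :* (e :* b)) refl (β ^ l₀) (β ^ i) β K (s i))
          (trans (*-congˡ (sβ i)) (*-identityʳ _)))

        V-radius : ∀ {i n v z t} → X v z ≈ 0# → VFound i (ball n) v → VBad v t → ∣ t - z ∣ ≤ β ^ (l₀ ℕ.+ i) * ρ n
        V-radius {i} {n} {v} {z} {t} root F bad = radius-bound i n 0<k₁ (begin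
          d * (β * (k₁ * s i)) ≤⟨ *-monoˡ d 0≤d (VFound.low F) ⟩
          d * (ρ n * (height v * q * P)) ≤⟨ x≤y*x (*-nonneg 0≤d (*-nonneg 0≤ρ (*-nonneg (*-nonneg (0≤height v) 0≤q) 0≤P))) 1≤De ⟩
          D * ∣ e ∣ * (d * (ρ n * (height v * q * P))) ≈⟨ (solve 7 (λ a b c d e f g → a :* b :* (c :* (d :* (e :* f :* g))) := a :* d :* (g :* (f :* b :* c) :* e)) refl D (∣ e ∣) d (ρ n) (height v) q P) ⟩
          D * ρ n * (P * (q * ∣ e ∣ * d) * height v) ≈⟨ *-congˡ (*-congʳ (*-congˡ (sym X≈))) ⟩
          D * ρ n * (P * ∣ X v t ∣ * height v) ≤⟨ *-monoˡ (D * ρ n) (*-nonneg 0≤D 0≤ρ) (VBad.near bad) ⟩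
          D * ρ n * c₀ ≈⟨ (solve 3 (λ a b c → a :* b :* c := b :* (c :* a)) refl D (ρ n) c₀) ⟩
          ρ n * (c₀ * D) ≤⟨ *-monoˡ (ρ n) 0≤ρ c₀D≤ ⟩
          ρ n * (β ^ suc l₀ * k₁) ∎)
          where
          d = ∣ t - z ∣
          q = den v
          0≤d = 0≤∣∣ (t - z)
          0≤ρ = <⇒≤ (0<ρ n)
          0≤q = ≤-trans 0≤1 (VBad.1≤den bad)
          X≈ : ∣ X v t ∣ ≈ q * ∣ e ∣ * d
          X≈ = trans (∣∣-cong (trans (X-shift v t z) (trans (+-congʳ root) (+-identityˡ _)))) (trans (∣*∣ (q * e) (t - z)) (*-congʳ (trans (∣*∣ q e) (*-congʳ (∣∣-nonneg 0≤q)))))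

        W-radius : ∀ {i n w z t} → val w z ≈ 0# → WFound i (ball n) w → WBad i w t → ∣ t - z ∣ ≤ β ^ (l₀ ℕ.+ i) * ρ n
        W-radius {i} {n} {w} {z} {t} root F bad = radius-bound i n 0<k₄ (*-cancelʳ-≤ (s i) (0<s i) (begin
          d * (β * (k₄ * s i)) * s i ≈⟨ (solve 4 (λ a b c d → a :* (b :* (c :* d)) :* d := a :* (b :* (c :* d :^ 2))) refl d β k₄ (s i)) ⟩
          d * (β * (k₄ * s i ^ 2)) ≤⟨ *-monoˡ d 0≤d (WFound.low F) ⟩
          d * (ρ n * (∣ α w ∣ * (P * P))) ≈⟨ (solve 4 (λ a b c d → a :* (b :* (c :* (d :* d))) := b :* (c :* a :* (d :* d))) refl d (ρ n) (∣ α w ∣) P) ⟩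
          ρ n * (∣ α w ∣ * d * (P * P)) ≈⟨ *-congˡ (*-congʳ (sym val≈)) ⟩
          ρ n * (∣ val w t ∣ * (P * P)) ≤⟨ *-monoˡ (ρ n) 0≤ρ (WBad.near bad) ⟩
          ρ n * (k * s i) ≤⟨ *-monoˡ (ρ n) 0≤ρ (*-monoʳ (s i) (<⇒≤ (0<s i)) k≤) ⟩
          ρ n * (β ^ suc l₀ * k₄ * s i) ≈⟨ sym (*-assoc _ _ _) ⟩
          ρ n * (β ^ suc l₀ * k₄) * s i ∎))
          where
          d = ∣ t - z ∣
          0≤d = 0≤∣∣ (t - z)
          0≤ρ = <⇒≤ (0<ρ n)
          val≈ : ∣ val w t ∣ ≈ ∣ α w ∣ * d
          val≈ = trans (∣∣-cong (trans (val-shift w t z) (trans (+-congʳ root) (+-identityˡ _)))) (∣*∣ (α w) (t - z))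

        V-root : ∀ {v} → 1# ≤ den v → ∃[ z ] (X v z ≈ 0#)
        V-root {v} 1≤q = let (z , p) = linear-root (den v * f - fromℤ (fst v)) (λ qe≈0 → e≉0 (*-zero-cancel (trans (*-comm e _) qe≈0) (pos≉0 (<-≤-trans 0<1 1≤q)))) in
          z , trans (expand (den v) (fromℤ (fst v)) z) p
          where
          expand : ∀ q p z → q * (e * z + f) - p ≈ q * e * z + (q * f - p)
          expand q p z = (solve 5 (λ a b c d e → a :* (b :* c :+ d) :- e := a :* b :* c :+ (a :* d :- e)) refl q e z f p)

        W-root : ∀ {w} → ¬ (α w ≈ 0#) → ∃[ z ] (val w z ≈ 0#)
        W-root {w} α≉0 = let (z , p) = linear-root (fromℤ (fst w) * f + fromℤ (snd w) * h + fromℤ (thd w)) α≉0 in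
          z , trans (expand (fromℤ (fst w)) (fromℤ (snd w)) (fromℤ (thd w)) z) p
          where
          expand : ∀ a b c z → a * (e * z + f) + b * (g * z + h) + c ≈ (a * e + b * g) * z + (a * f + b * h + c)
          expand a b c z = (solve 8 (λ a b c d e f g h → a :* (b :* c :+ d) :+ e :* (f :* c :+ g) :+ h := (a :* b :+ e :* f) :* c :+ (a :* d :+ e :* g :+ h)) refl a e z f b g h c)

        earlier : ∀ {l m n} → 1 ℕ.≤ l → l ℕ.+ m ℕ.≤ n → m ℕ.< n
        earlier {l} {m} 1≤l p = ℕ.≤-trans (ℕ.+-monoˡ-≤ m 1≤l) p

        1≤l : ∀ i → 1 ℕ.≤ l₀ ℕ.+ i
        1≤l i = ℕ.≤-trans 1≤l₀ (ℕ.m≤m+n l₀ i)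

        module Step (n : ℕ) (IH : ∀ {m} → m ℕ.< n → VAvoid m × WAvoid m) where

          -- Such a point was noticed at some turn `m` and its deadline has passed. The target
          -- picked then either has the same root, so that `t` would lie in an interval already
          -- left, or spans with `v` an overdue bad line, which was avoided at turn `m`.
          V-step : VAvoid n
          V-step v t t∈ bad slow = found (class 1≤q (VBad.den≤ bad))
            where
            1≤q = VBad.1≤den bad
            x = height v * den v * P
            0≤x : 0# ≤ x
            0≤x = *-nonneg (*-nonneg (0≤height v) (≤-trans 0≤1 1≤q)) 0≤P
            found : ∃[ i ] (s i ^ 3 * den v ≤ P * P × P * P ≤ S ^ 3 * s i ^ 3 * den v) → ⊥
            found (i , c≤ , ≤c) = at-crossing (crossing n 0≤x (startV i v t (nested-≤ ℕ.z≤n t∈) bad c≤) (≤-trans slow (≤-trans (<⇒≤ Dkk₄<)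
                (≤-trans (by≤ (*-nonneg (0≤sub (β^≤1 (suc l₀))) 0≤k₁) (solve 2 (λ a b → a := b :* a :+ ((con (+ 1)) :- b) :* a) refl k₁ (β ^ suc l₀))) (x≤x*y 0≤k₁ (1≤s i))))))
              where
              at-crossing : ∃[ m ] (m ℕ.≤ n × β * (k₁ * s i) ≤ ρ m * x × ρ m * x ≤ k₁ * s i) → ⊥
              at-crossing (m , m≤n , low , up) = contradict (V-root {v} 1≤q)
                where
                F : VFound i (ball m) v
                F = record { class≤ = c≤ ; ≤class = ≤c ; low = low ; up = up ; witness = t , nested-≤ m≤n t∈ , bad }
                past : l₀ ℕ.+ i ℕ.+ m ℕ.≤ n
                past = deadline (l₀ ℕ.+ i) 0≤x low (≤-<-trans slow (<-≤-trans Dkk₄< (≤-reflexive (sym (deadline-value k₁ i)))))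
                contradict : ∃[ z ] (X v z ≈ 0#) → ⊥
                contradict (z , root) = with-target (clearV m i z (v , root , F))
                  where
                  with-target : Cleared N (l₀ ℕ.+ i) (VTarget i) m → ⊥
                  with-target (z′ , (v′ , root′ , F′) , cleared) with V-unique F F′ root root′
                  ... | inj₁ z≈z′ = cleared t (nested-≤ past t∈) (≤-respˡ (∣∣-cong (+-congˡ (-‿cong z≈z′))) (V-radius root F bad))
                  ... | inj₂ (wbad , wslow) = proj₂ (IH (earlier (1≤l i) past)) i (v ⊗ v′) (c m) (centre-within (ball m)) wbad wslow

          W-step : WAvoid n
          W-step i w t t∈ bad slow = at-crossing (crossing n 0≤x start (≤-trans slow (≤-trans (<⇒≤ slow<) k₄s≤)))
            where
            x = ∣ α w ∣ * (P * P)
            0≤x : 0# ≤ x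
            0≤x = *-nonneg (0≤∣∣ _) (0≤□ P)
            start = startW i w t (nested-≤ ℕ.z≤n t∈) bad
            -- `startW` also excludes lines parallel to the given one, so that `val w` has a root at
            -- which a target can be placed.
            α≉0 : ¬ (α w ≈ 0#)
            α≉0 q = <⇒≱ start (≤-trans (≤-reflexive (trans (*-congˡ (trans (*-congʳ (trans (∣∣-cong q) (∣∣-nonneg ≤-refl))) (zeroˡ _))) (zeroʳ _))) (*-nonneg 0≤k₄ (^-nonneg 2 (<⇒≤ (0<s i)))))
            2S³k₁<k : ♯ 2 * S ^ 3 * k₁ < k
            2S³k₁<k = <-≤-trans (≰⇒> λ p → <⇒≱ (*-pos (*-pos (♯-pos 5) (^-pos 3 (<-trans 0<1 1<S))) 0<k₁)
                (by≤ (0≤sub p) (solve 2 (λ a b → con (+ 0) := (con (+ 6)) :* a :^ 3 :* b :+ ((con (+ 2)) :* a :^ 3 :* b :- (con (+ 8)) :* a :^ 3 :* b)) refl S k₁)))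
              (≤-trans (x≤y*x (*-nonneg (*-nonneg (0≤# 8) (^-nonneg 3 0≤S)) 0≤k₁) (1≤x*y (1≤^ 2 1≤D) 1≤S)) (≤-trans (≤-reflexive (solve 3 (λ a b c → a :^ 2 :* b :* ((con (+ 8)) :* b :^ 3 :* c) := (con (+ 8)) :* a :^ 2 :* b :^ 4 :* c) refl D S k₁)) D²S⁴k₁≤))
            slow< : ♯ 2 * S ^ 3 * k₁ * s i < β ^ suc l₀ * k₄ * s i
            slow< = ≰⇒> λ p → <⇒≱ 2S³k₁<k (≤-trans k≤ (*-cancelʳ-≤ (s i) (0<s i) p))
            k₄s≤ : β ^ suc l₀ * k₄ * s i ≤ k₄ * s i ^ 2
            k₄s≤ = ≤-trans (*-monoʳ (s i) (<⇒≤ (0<s i)) ((by≤ (*-nonneg (0≤sub (β^≤1 (suc l₀))) 0≤k₄) (solve 2 (λ a b → a := b :* a :+ ((con (+ 1)) :- b) :* a) refl k₄ (β ^ suc l₀)))))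
              (by≤ (*-nonneg (*-nonneg 0≤k₄ (<⇒≤ (0<s i))) (0≤sub (1≤s i))) (solve 2 (λ a b → a :* b :^ 2 := a :* b :+ a :* b :* (b :- (con (+ 1)))) refl k₄ (s i)))
            at-crossing : ∃[ m ] (m ℕ.≤ n × β * (k₄ * s i ^ 2) ≤ ρ m * x × ρ m * x ≤ k₄ * s i ^ 2) → ⊥
            at-crossing (m , m≤n , low , up) = contradict (W-root {w} α≉0)
              where
              F : WFound i (ball m) w
              F = record { low = low ; up = up ; witness = t , nested-≤ m≤n t∈ , bad }
              value : β ^ (l₀ ℕ.+ i) * (β * (k₄ * s i ^ 2)) ≈ β ^ suc l₀ * k₄ * s i
              value = trans (solve 4 (λ a b c d → a :* (b :* (c :* d :^ 2)) := a :* (b :* (c :* d)) :* d) refl (β ^ (l₀ ℕ.+ i)) β k₄ (s i)) (*-congʳ (deadline-value k₄ i))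
              past : l₀ ℕ.+ i ℕ.+ m ℕ.≤ n
              past = deadline (l₀ ℕ.+ i) 0≤x low (≤-<-trans slow (<-≤-trans slow< (≤-reflexive (sym value))))
              contradict : ∃[ z ] (val w z ≈ 0#) → ⊥
              contradict (z , root) = with-target (clearW m i z (w , root , F))
                where
                with-target : Cleared N (l₀ ℕ.+ i) (WTarget i) m → ⊥
                with-target (z′ , (w′ , root′ , F′) , cleared) with W-unique F F′ root root′
                ... | inj₁ z≈z′ = cleared t (nested-≤ past t∈) (≤-respˡ (∣∣-cong (+-congˡ (-‿cong z≈z′))) (W-radius root F bad))
                ... | inj₂ (v , vbad , vslow) = proj₁ (IH (earlier (1≤l i) past)) v (c m) (centre-within (ball m)) vbad vslow

      -- V- and W-targets are cleared by a simultaneous induction on the turn, as the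
      -- uniqueness of either kind relies on the other kind having been avoided before.
      avoided : ∀ n → VAvoid n × WAvoid n
      avoided = <-rec (λ n → VAvoid n × WAvoid n) λ n IH → Step.V-step n IH , Step.W-step n IH

  -- Powers with real exponents, and the Diophantine condition.

  div-mul : ∀ {x y} → 0# < y → x / y * y ≈ x
  div-mul {x} {y} 0<y = trans (solve 3 (λ a b c → a :* b :* c := a :* (c :* b)) refl x (y ⁻¹) y) (trans (*-congˡ (x⁻¹x 0<y)) (*-identityʳ x))

  ⁻¹-anti-1 : ∀ {x} → 1# ≤ x → x ⁻¹ ≤ 1#
  ⁻¹-anti-1 {x} 1≤x = ≤-respˡ (*-identityˡ _) (≤-respʳ (x⁻¹x 0<x) (*-monoʳ (x ⁻¹) (<⇒≤ (⁻¹-pos 0<x)) 1≤x))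
    where
    0<x = <-≤-trans 0<1 1≤x

  positive-part : ∀ {κ} → 0# < κ → ∃[ κ′ ] (0# < κ′ × κ′ ≤ 1# × κ′ ≤ κ)
  positive-part {κ} 0<κ = κ * u , *-pos 0<κ (⁻¹-pos 0<1+κ) ,
    ≤-trans (*-monoʳ u 0≤u (by≤ 0≤1 (solve 1 (λ a → (con (+ 1)) :+ a := a :+ (con (+ 1))) refl κ))) (≤-reflexive (x⁻¹x 0<1+κ)) ,
    ≤-trans (*-monoˡ κ (<⇒≤ 0<κ) (⁻¹-anti-1 (by≤ (<⇒≤ 0<κ) (solve 1 (λ a → (con (+ 1)) :+ a := (con (+ 1)) :+ a) refl κ)))) (≤-reflexive (*-identityʳ κ))
    where
    0<1+κ = +-pos 0<1 (<⇒≤ 0<κ)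
    u = (1# + κ) ⁻¹
    0≤u = <⇒≤ (⁻¹-pos 0<1+κ)

  module _ {x : ℝ} (1≤x : 1# ≤ x) where

    private
      0≤x = ≤-trans 0≤1 1≤x

      0≤^ℤ : ∀ n → 0# ≤ x ^ℤ n
      0≤^ℤ (+ n) = ^-nonneg n 0≤x
      0≤^ℤ -[1+ n ] = <⇒≤ (⁻¹-pos (^-pos (suc n) (<-≤-trans 0<1 1≤x)))

    -- `Y` is the power of `x` with exponent `suc n / suc j`. Raising to a common power reduces the
    -- comparison to natural exponents; for negative `r` the left side is at most `1#` and `Y` at
    -- least `1#`.
    ^ℚ≤ : ∀ {t Y} j n → 0# ≤ Y → Y ^ suc j ≈ x ^ suc n → t * fromℕ (suc j) ≤ fromℕ (suc n) → ∀ r → fromℚ r ≤ t → x ^ℚ r ≤ Y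
    ^ℚ≤ {t} {Y} j n 0≤Y Y≈ t≤ (mkℚ -[1+ k ] d _) r≤t = root-lub d (0≤^ℤ -[1+ k ]) 0≤Y λ y 0≤y y≤ →
      ≤-trans (^-cancel d 0≤1 (≤-trans y≤ (≤-trans (⁻¹-anti-1 (1≤^ (suc k) 1≤x)) (≤-reflexive (sym (1^ (suc d)))))))
              (^-cancel j 0≤Y (≤-trans (≤-reflexive (1^ (suc j))) (≤-trans (1≤^ (suc n) 1≤x) (≤-reflexive (sym Y≈)))))
    ^ℚ≤ {t} {Y} j n 0≤Y Y≈ t≤ (mkℚ (+ k) d _) r≤t = root-lub d (0≤^ℤ (+ k)) 0≤Y λ y 0≤y y≤ →
      ^-cancel j 0≤Y (^-cancel d (^-nonneg (suc j) 0≤Y) (begin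
        (y ^ suc j) ^ suc d ≈⟨ ^-assocʳ y (suc j) (suc d) ⟩
        y ^ (suc j ℕ.* suc d) ≈⟨ reflexive (≡.cong (y ^_) (ℕ.*-comm (suc j) (suc d))) ⟩
        y ^ (suc d ℕ.* suc j) ≈⟨ sym (^-assocʳ y (suc d) (suc j)) ⟩
        (y ^ suc d) ^ suc j ≤⟨ ^-mono (suc j) (^-nonneg (suc d) 0≤y) y≤ ⟩
        (x ^ k) ^ suc j ≈⟨ ^-assocʳ x k (suc j) ⟩
        x ^ (k ℕ.* suc j) ≤⟨ ^-monoʳ {x} {k ℕ.* suc j} {suc n ℕ.* suc d} 1≤x (fromℕ-cancel {k ℕ.* suc j} {suc n ℕ.* suc d} k≤) ⟩
        x ^ (suc n ℕ.* suc d) ≈⟨ sym (^-assocʳ x (suc n) (suc d)) ⟩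
        (x ^ suc n) ^ suc d ≈⟨ ^-congˡ (suc d) (sym Y≈) ⟩
        (Y ^ suc j) ^ suc d ∎))
      where
      k≤ : fromℕ (k ℕ.* suc j) ≤ fromℕ (suc n ℕ.* suc d)
      k≤ = begin
        fromℕ (k ℕ.* suc j) ≈⟨ fromℕ-* k (suc j) ⟩
        fromℕ k * fromℕ (suc j) ≈⟨ *-congʳ (sym (div-mul (fromℕ-pos d))) ⟩
        fromℕ k / fromℕ (suc d) * fromℕ (suc d) * fromℕ (suc j) ≤⟨ *-monoʳ (fromℕ (suc j)) (0≤♯ (suc j)) (*-monoʳ (fromℕ (suc d)) (0≤♯ (suc d)) r≤t) ⟩
        t * fromℕ (suc d) * fromℕ (suc j) ≈⟨ (solve 3 (λ a b c → a :* b :* c := a :* c :* b) refl t (fromℕ (suc d)) (fromℕ (suc j))) ⟩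
        t * fromℕ (suc j) * fromℕ (suc d) ≤⟨ *-monoʳ (fromℕ (suc d)) (0≤♯ (suc d)) t≤ ⟩
        fromℕ (suc n) * fromℕ (suc d) ≈⟨ sym (fromℕ-* (suc n) (suc d)) ⟩
        fromℕ (suc n ℕ.* suc d) ∎

    ^ℝ≤ : ∀ {t Y} j n → 0# ≤ Y → Y ^ suc j ≈ x ^ suc n → t * fromℕ (suc j) ≤ fromℕ (suc n) → x ^ℝ t ≤ Y
    ^ℝ≤ j n 0≤Y Y≈ t≤ = sup-lub _ 0≤Y λ (r , r≤t) → ^ℚ≤ j n 0≤Y Y≈ t≤ r r≤t

  -- A quantitative form of the Diophantine condition without real exponents.
  SimultaneousBound : (a b : ℝ) (j : ℕ) (κ : ℝ) → Set
  SimultaneousBound a b j κ = ∀ A B C {M} → ¬ (B ≡ + 0) → 0# ≤ M →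
    ∣ fromℤ A + fromℤ B * a ∣ ≤ M → ∣ fromℤ C + fromℤ B * b ∣ ≤ M → κ ≤ ∣ fromℤ B ∣ ^ suc (j ℕ.+ j) * M ^ suc j

  private
    module Simultaneous {a b ε c : ℝ} {N j : ℕ} (0<c : 0# < c) (j-large : 1# ≤ ε * fromℕ (suc j))
      (lower : ∀ q → N ℕ.≤ q → c ≤ (fromℕ q ^ℝ (fromℕ 2 - ε)) * (⟨ fromℕ q * a ⟩ ⊔ ⟨ fromℕ q * b ⟩)) where

      -- The origin of the exponents in `SimultaneousBound`: the quotient of `suc (j + j)` by
      -- `suc j` is at least `2 - ε` but still less than 2.
      exponent : (fromℕ 2 - ε) * fromℕ (suc j) ≤ fromℕ (suc (j ℕ.+ j))
      exponent = ≤-respʳ (+-congˡ (sym (fromℕ-+ j j))) (bound {fromℕ j} j-large)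
        where
        bound : ∀ {y} → 1# ≤ ε * (1# + y) → (1# + (1# + 0#) - ε) * (1# + y) ≤ 1# + (y + y)
        bound {y} p = (by≤ (0≤sub p) (solve 2 (λ a b → (con (+ 1)) :+ (a :+ a) := ((con (+ 1)) :+ ((con (+ 1)) :+ (con (+ 0))) :- b) :* ((con (+ 1)) :+ a) :+ (b :* ((con (+ 1)) :+ a) :- (con (+ 1)))) refl y ε))

      large : ∀ q {M} → N ℕ.≤ q → 1 ℕ.≤ q → 0# ≤ M → ⟨ fromℕ q * a ⟩ ≤ M → ⟨ fromℕ q * b ⟩ ≤ M → c ^ suc j ≤ fromℕ q ^ suc (j ℕ.+ j) * M ^ suc j
      large q {M} N≤q 1≤q 0≤M pa pb = begin
        c ^ suc j ≤⟨ ^-mono (suc j) (<⇒≤ 0<c) (≤-trans (lower q N≤q)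
            (≤-trans (*-monoʳ _ (≤-trans (0≤⟨⟩ _) (x≤x⊔y _ _)) (^ℝ≤ (1≤fromℕ 1≤q) j (j ℕ.+ j) (root-nonneg j 0≤qⁿ) (root-^ j 0≤qⁿ) exponent))
              (*-monoˡ Y (root-nonneg j 0≤qⁿ) (⊔-lub pa pb)))) ⟩
        (Y * M) ^ suc j ≈⟨ ^-distrib-* Y M (suc j) ⟩
        Y ^ suc j * M ^ suc j ≈⟨ *-congʳ (root-^ j 0≤qⁿ) ⟩
        fromℕ q ^ suc (j ℕ.+ j) * M ^ suc j ∎
        where
        0≤qⁿ = ^-nonneg (suc (j ℕ.+ j)) (0≤♯ q)
        Y = root (suc j) (fromℕ q ^ suc (j ℕ.+ j))

      n = suc N

      close : ∀ x A B {M} → ∣ fromℤ A + fromℤ B * x ∣ ≤ M → ⟨ fromℕ (n ℕ.* ℤ.∣ B ∣) * x ⟩ ≤ fromℕ n * M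
      close x A B {M} p = ≤-trans (⟨⟩≤ _ (proj₁ (multiple A B))) (≤-trans (≤-reflexive (proj₂ (multiple A B)))
        (≤-trans (≤-reflexive (trans (∣*∣ (fromℕ n) _) (*-congʳ (∣∣-nonneg (0≤♯ n))))) (*-monoˡ (fromℕ n) (0≤♯ n) p)))
        where
        pos-form : ∀ y A B → y * B * x - - (y * A) ≈ y * (A + B * x)
        pos-form y A B = (solve 4 (λ a b c d → a :* b :* c :- (:- (a :* d)) := a :* (d :+ b :* c)) refl y B x A)
        neg-form : ∀ y A B → y * B * x - y * A ≈ - (y * (A + - B * x))
        neg-form y A B = (solve 4 (λ a b c d → a :* b :* c :- a :* d := :- (a :* (d :+ (:- b) :* c))) refl y B x A)
        multiple : ∀ A B → ∃[ i ] (∣ fromℕ (n ℕ.* ℤ.∣ B ∣) * x - fromℤ i ∣ ≈ ∣ fromℕ n * (fromℤ A + fromℤ B * x) ∣)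
        multiple A (+ B) = ℤ.- (+ n ℤ.* A) , ∣∣-cong (trans (+-cong (*-congʳ (fromℕ-* n B)) (-‿cong (trans (fromℤ-neg (+ n ℤ.* A)) (-‿cong (fromℤ-* (+ n) A)))))
          (pos-form (fromℕ n) (fromℤ A) (fromℕ B)))
        multiple A -[1+ B ] = + n ℤ.* A , trans (∣∣-cong (trans (+-cong (*-congʳ (fromℕ-* n (suc B))) (-‿cong (fromℤ-* (+ n) A)))
          (neg-form (fromℕ n) (fromℤ A) (fromℕ (suc B))))) (∣-∣ _)

      scale : ℝ
      scale = fromℕ n ^ suc (j ℕ.+ j) * fromℕ n ^ suc j

      0<scale : 0# < scale
      0<scale = *-pos (^-pos (suc (j ℕ.+ j)) (fromℕ-pos N)) (^-pos (suc j) (fromℕ-pos N))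

      κ : ℝ
      κ = c ^ suc j / scale

      0<κ : 0# < κ
      0<κ = *-pos (^-pos (suc j) 0<c) (⁻¹-pos 0<scale)

      -- Small denominators are covered by passing to a multiple.
      lower-bound : SimultaneousBound a b j κ
      lower-bound A B C {M} B≢0 0≤M pa pb = *-cancelʳ-≤ scale 0<scale (begin
        κ * scale ≈⟨ div-mul 0<scale ⟩
        c ^ suc j ≤⟨ large (n ℕ.* ℤ.∣ B ∣) N≤ 1≤ (*-nonneg (0≤♯ n) 0≤M) (close a A B pa) (close b C B pb) ⟩
        fromℕ (n ℕ.* ℤ.∣ B ∣) ^ suc (j ℕ.+ j) * (fromℕ n * M) ^ suc j ≈⟨ *-cong
            (trans (^-congˡ (suc (j ℕ.+ j)) (trans (fromℕ-* n ℤ.∣ B ∣) (*-congˡ (sym (∣fromℤ∣ B))))) (^-distrib-* (fromℕ n) ∣ fromℤ B ∣ (suc (j ℕ.+ j))))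
            (^-distrib-* (fromℕ n) M (suc j)) ⟩
        fromℕ n ^ suc (j ℕ.+ j) * ∣ fromℤ B ∣ ^ suc (j ℕ.+ j) * (fromℕ n ^ suc j * M ^ suc j) ≈⟨ regroup (fromℕ n ^ suc (j ℕ.+ j)) (∣ fromℤ B ∣ ^ suc (j ℕ.+ j)) (fromℕ n ^ suc j) (M ^ suc j) ⟩
        ∣ fromℤ B ∣ ^ suc (j ℕ.+ j) * M ^ suc j * scale ∎)
        where
        regroup : ∀ x y z w → x * y * (z * w) ≈ y * w * (x * z)
        regroup x y z w = (solve 4 (λ a b c d → a :* b :* (c :* d) := b :* d :* (a :* c)) refl x y z w)
        1≤B : 1 ℕ.≤ ℤ.∣ B ∣
        1≤B = ℕ.n≢0⇒n>0 λ e → B≢0 (ℤ.∣i∣≡0⇒i≡0 e)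
        n≤ : n ℕ.≤ n ℕ.* ℤ.∣ B ∣
        n≤ = ℕ.≤-trans (ℕ.≤-reflexive (≡.sym (ℕ.*-identityʳ n))) (ℕ.*-monoʳ-≤ n 1≤B)
        N≤ = ℕ.≤-trans (ℕ.n≤1+n N) n≤
        1≤ = ℕ.≤-trans (ℕ.s≤s ℕ.z≤n) n≤

  simultaneous-bound : ∀ {a b} → DiophantineCondition a b → ∃[ j ] ∃[ κ ] (0# < κ × (SimultaneousBound a b j κ))
  simultaneous-bound {a} {b} (ε , 0<ε , p) = choose (archimedean (ε ⁻¹)) (liminf⁻ ℕ._≤_ _ p)
    where
    choose : ∃[ j ] (ε ⁻¹ < fromℕ j) →
      ∃[ N ] ∃[ c ] (0# < c × (∀ q → N ℕ.≤ q → c ≤ (fromℕ q ^ℝ (fromℕ 2 - ε)) * (⟨ fromℕ q * a ⟩ ⊔ ⟨ fromℕ q * b ⟩))) → _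
    choose (j , ε⁻¹<j) (N , c , 0<c , lower) = j , D.κ , D.0<κ , D.lower-bound
      where
      j-large : 1# ≤ ε * fromℕ (suc j)
      j-large = ≤-respˡ (x⁻¹x 0<ε) (*-monoˡ ε (<⇒≤ 0<ε) (≤-trans (<⇒≤ ε⁻¹<j) (fromℕ-mono (ℕ.n≤1+n j))))
      module D = Simultaneous {a} {b} {ε} {c} {N} {j} 0<c j-large lower

  -- Iteration of the growth condition.

  module _ {Q : ℕ → ℝ} (adm : IsAdmissible Q) where
    open IsAdmissible adm renaming (positive to 0<Q)

    Q-mono : ∀ {m} j → Q m ≤ Q (j ℕ.+ m)
    Q-mono zero = ≤-refl
    Q-mono {m} (suc j) = ≤-trans (Q-mono j) (<⇒≤ (increasing (j ℕ.+ m)))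

    1<Q : ∀ m → 1# < Q m
    1<Q m = <-≤-trans 1<Q₀ (≡.subst (λ k → Q 0 ≤ Q k) (ℕ.+-identityʳ m) (Q-mono m))

    private
      module Growth {τ : ℝ} (1<τ : 1# < τ) (0<inf : 0# < inf (λ m → Q (suc m) / (Q m ^ℝ τ)))
        (k : ℕ) (k-large : 1# ≤ (τ - 1#) * fromℕ (suc k)) where

        c : ℝ
        c = inf (λ m → Q (suc m) / (Q m ^ℝ τ))

        -- The exponent `1 + 1 / (k + 1)`, which `k-large` places below `τ`.
        r : ℚ
        r = mkℚ (+ suc (suc k)) k (≡.subst (λ n → Coprime n (suc k)) (ℕ.+-comm (suc k) 1) (coprime-+ {1} {suc k} (1-coprimeTo (suc k))))

        r≤τ : fromℚ r ≤ τ
        r≤τ = *-cancelʳ-≤ (fromℕ (suc k)) (fromℕ-pos k) (≤-respˡ (sym (div-mul (fromℕ-pos k))) (bound {fromℕ (suc k)} k-large))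
          where
          bound : ∀ {y} → 1# ≤ (τ - 1#) * y → 1# + y ≤ τ * y
          bound {y} p = (by≤ (0≤sub p) (solve 2 (λ a b → a :* b := (con (+ 1)) :+ b :+ ((a :- (con (+ 1))) :* b :- (con (+ 1)))) refl τ y))

        module _ (m : ℕ) where
          0≤Qⁿ : 0# ≤ Q m ^ suc (suc k)
          0≤Qⁿ = ^-nonneg (suc (suc k)) (<⇒≤ (0<Q m))

          Y Z : ℝ
          Y = root (suc k) (Q m ^ suc (suc k))
          Z = Q m ^ℝ τ

          c≤ : c ≤ Q (suc m) * Z ⁻¹
          c≤ = 0<inf⇒lb (λ m → Q (suc m) / (Q m ^ℝ τ)) 0<inf m

          -- If `Z` were zero, so would be its inverse by convention, and the infimum would not be
          -- positive. As infinite suprema are also encoded by zero, this shows at the same time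
          -- that the power is a genuine supremum.
          Z≉0 : ¬ (Z ≈ 0#)
          Z≉0 q = <⇒≱ 0<inf (≤-trans c≤ (≤-reflexive (trans (*-congˡ (⁻¹-zero Z q)) (zeroʳ _))))

          Y≤Z : Y ≤ Z
          Y≤Z = ¬sup≈0⇒ub (λ ((r , _) : ∃[ r ] (fromℚ r ≤ τ)) → Q m ^ℚ r) Z≉0 (r , r≤τ)

          0≤Y : 0# ≤ Y
          0≤Y = root-nonneg k 0≤Qⁿ

          0<Z : 0# < Z
          0<Z = ≤-trans 0≤Y Y≤Z , λ q → Z≉0 (sym q)

          cY≤ : c * Y ≤ Q (suc m)
          cY≤ = ≤-trans (*-mono (<⇒≤ 0<inf) c≤ 0≤Y Y≤Z) (≤-reflexive (div-mul 0<Z))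

          one-step : c ^ suc k * Q m ^ suc (suc k) ≤ Q (suc m) ^ suc k
          one-step = ≤-trans (≤-reflexive (trans (*-congˡ (sym (root-^ k 0≤Qⁿ))) (sym (^-distrib-* c Y (suc k)))))
            (^-mono (suc k) (*-nonneg (<⇒≤ 0<inf) 0≤Y) cY≤)

        c₁ : ℝ
        c₁ = c ^ suc k * c ^ suc k
        0<c₁ : 0# < c₁
        0<c₁ = *-pos (^-pos (suc k) 0<inf) (^-pos (suc k) 0<inf)

        d : ℕ
        d = suc (k ℕ.+ suc k)

        m₀ : ℕ
        m₀ = proj₁ (unbounded (c₁ ⁻¹))

        -- In `one-step` only one power of `Q m` is gained, and absorbing the constant would use it
        -- up. After squaring there are two: one absorbs `c₁`, the other remains.
        step : ∀ m → m₀ ℕ.≤ m → Q m ^ suc d ≤ Q (suc m) ^ d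
        step m m₀≤m = begin
          Q m ^ suc d ≤⟨ x≤y*x (^-nonneg (suc d) (<⇒≤ (0<Q m))) 1≤ ⟩
          c₁ * Q m * Q m ^ suc d ≈⟨ *-congˡ (reflexive (≡.cong (Q m ^_) (≡.cong suc (≡.cong suc (ℕ.+-suc k k))))) ⟩
          c₁ * Q m * Q m ^ suc (suc (suc k ℕ.+ k)) ≈⟨ (solve 3 (λ a b c → a :* b :* (b :* (b :* c)) := a :* (b :* b :* (b :* c))) refl c₁ (Q m) (Q m ^ (suc k ℕ.+ k))) ⟩
          c₁ * (Q m * Q m * (Q m * Q m ^ (suc k ℕ.+ k))) ≈⟨ *-congˡ (*-congˡ (*-congˡ (^-homo-* (Q m) (suc k) k))) ⟩
          c₁ * (Q m * Q m * (Q m * (Q m ^ suc k * Q m ^ k))) ≈⟨ (solve 3 (λ a b c → a :* a :* (b :* b :* (b :* (b :* c :* c))) := a :* (b :* (b :* c)) :* (a :* (b :* (b :* c)))) refl (c ^ suc k) (Q m) (Q m ^ k)) ⟩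
          c ^ suc k * Q m ^ suc (suc k) * (c ^ suc k * Q m ^ suc (suc k)) ≤⟨ *-mono 0≤ (one-step m) 0≤ (one-step m) ⟩
          Q (suc m) ^ suc k * Q (suc m) ^ suc k ≈⟨ sym (^-homo-* (Q (suc m)) (suc k) (suc k)) ⟩
          Q (suc m) ^ d ∎
          where
          0≤ = *-nonneg (<⇒≤ (^-pos (suc k) 0<inf)) (^-nonneg (suc (suc k)) (<⇒≤ (0<Q m)))
          1≤ : 1# ≤ c₁ * Q m
          1≤ = ≤-trans (≤-reflexive (sym (x⁻¹x 0<c₁))) (*-monoˡ c₁ (<⇒≤ 0<c₁) (proj₂ (unbounded (c₁ ⁻¹)) m m₀≤m))

        -- Every further index gains one more power at the fixed root `d`, so `M * d` indices
        -- suffice for the exponent `M`.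
        steps : ∀ m → m₀ ℕ.≤ m → ∀ i → Q m ^ (i ℕ.+ d) ≤ Q (i ℕ.+ m) ^ d
        steps m m₀≤m zero = ≤-refl
        steps m m₀≤m (suc i) = ≤-trans (*-mono (<⇒≤ (0<Q m)) (Q-mono i) (^-nonneg (i ℕ.+ d) (<⇒≤ (0<Q m))) (steps m m₀≤m i))
          (step (i ℕ.+ m) (ℕ.≤-trans m₀≤m (ℕ.m≤n+m m i)))

        power : ∀ M m → m₀ ℕ.≤ m → Q m ^ M ≤ Q (M ℕ.* d ℕ.+ m)
        power M m m₀≤m = ^-cancel {Q m ^ M} {Q (M ℕ.* d ℕ.+ m)} (k ℕ.+ suc k) (<⇒≤ (0<Q _)) (≤-trans (≤-reflexive (^-assocʳ (Q m) M d))
          (≤-trans (^-monoʳ {Q m} {M ℕ.* d} {M ℕ.* d ℕ.+ d} (<⇒≤ (1<Q m)) (ℕ.m≤m+n _ d)) (steps m m₀≤m (M ℕ.* d))))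

    growth-power : ∀ M → ∃[ K ] ∃[ m₀ ] (∀ m → m₀ ℕ.≤ m → Q m ^ M ≤ Q (K ℕ.+ m))
    growth-power M = choose growth
      where
      choose : ∃[ τ ] (1# < τ × 0# < inf (λ m → Q (suc m) / (Q m ^ℝ τ))) → _
      choose (τ , 1<τ , 0<inf) = with-k (archimedean ((τ - 1#) ⁻¹))
        where
        0<τ-1 : 0# < τ - 1#
        0<τ-1 = ≰⇒> λ q → <⇒≱ 1<τ (by≤ (0≤sub q) (solve 1 (λ a → con (+ 1) := a :+ ((con (+ 0)) :- (a :- (con (+ 1))))) refl τ))
        with-k : ∃[ k ] ((τ - 1#) ⁻¹ < fromℕ k) → _
        with-k (k , p) = M ℕ.* G.d , G.m₀ , G.power M
          where
          module G = Growth 1<τ 0<inf k (≤-respˡ (x⁻¹x 0<τ-1) (*-monoˡ (τ - 1#) (<⇒≤ 0<τ-1) (≤-trans (<⇒≤ p) (fromℕ-mono (ℕ.n≤1+n k)))))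

  -- The radii at which a given index can matter.

  module SideWindow {β : ℝ} (𝒞 : Constants β) (e f g h P : ℝ) (1≤P : 1# ≤ P)
    (e≤D : ∣ e ∣ ≤ Constants.D 𝒞) (g≤D : ∣ g ∣ ≤ Constants.D 𝒞) (1≤De : 1# ≤ Constants.D 𝒞 * ∣ e ∣) (k₁≤1 : Constants.k₁ 𝒞 ≤ 1#) where

    open Constants 𝒞
    open DualConstants 𝒞
    open SidePlay 𝒞 e f g h P 1≤P e≤D g≤D 1≤De public

    private
      PP = P * P
      0<P = <-≤-trans 0<1 1≤P
      0≤P = <⇒≤ 0<P
      0<PP : 0# < PP
      0<PP = *-pos 0<P 0<P
      0≤PP = <⇒≤ 0<PP
      P≤PP : P ≤ PP
      P≤PP = x≤x*y 0≤P 1≤P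

    V-class : ∀ {i B v} → VFound i B v → s i ≤ PP
    V-class {i} {B} {v} F = bound (VFound.witness F)
      where
      bound : ∃[ t ] (t within B × VBad v t) → s i ≤ PP
      bound (_ , _ , bad) = ≤-trans (≤-trans (x≤x*y 0≤σ (1≤x*y 1≤σ 1≤σ)) (≤-reflexive (solve 1 (λ a → a :* (a :* a) := a :^ 3) refl (s i))))
        (≤-trans (x≤x*y (^-nonneg 3 0≤σ) (VBad.1≤den bad)) (VFound.class≤ F))
        where
        1≤σ = 1≤s i
        0≤σ = <⇒≤ (0<s i)

    -- Here `r` plays the role of `1 / ρ`. The bound `up` gives `P ≤ r * s i`, while the class gives
    -- `s i ^ 3 ≤ P * P`; eliminating `s i` leaves a bound for `P`.
    V-late : ∀ {i v ρ r} → 0# ≤ ρ → 1# ≤ r → 1# ≤ r * ρ → 1# ≤ den v → s i ^ 3 * den v ≤ PP → ρ * (height v * den v * P) ≤ k₁ * s i → P ≤ r ^ 3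
    V-late {i} {v} {ρ} {r} 0≤ρ 1≤r 1≤rρ 1≤q c≤ up = *-cancelʳ-≤ PP 0<PP (begin
      P * PP ≈⟨ (solve 1 (λ a → a :* (a :* a) := a :^ 3) refl P) ⟩
      P ^ 3 ≤⟨ ^-mono 3 0≤P P≤rs ⟩
      (r * s i) ^ 3 ≈⟨ ^-distrib-* r (s i) 3 ⟩
      r ^ 3 * s i ^ 3 ≤⟨ *-monoˡ (r ^ 3) (^-nonneg 3 0≤r) (≤-trans (x≤x*y (^-nonneg 3 (<⇒≤ (0<s i))) 1≤q) c≤) ⟩
      r ^ 3 * PP ∎)
      where
      0≤r = ≤-trans 0≤1 1≤r
      P≤rs : P ≤ r * s i
      P≤rs = begin
        P ≤⟨ x≤y*x 0≤P (1≤x*y (1≤height v) 1≤q) ⟩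
        height v * den v * P ≤⟨ x≤y*x (*-nonneg (*-nonneg (0≤height v) (≤-trans 0≤1 1≤q)) 0≤P) 1≤rρ ⟩
        r * ρ * (height v * den v * P) ≈⟨ *-assoc r ρ _ ⟩
        r * (ρ * (height v * den v * P)) ≤⟨ *-monoˡ r 0≤r (≤-trans up (≤-trans (*-monoʳ (s i) (<⇒≤ (0<s i)) k₁≤1) (≤-reflexive (*-identityˡ _)))) ⟩
        r * s i ∎

    -- The denominator is at most `P * P`, and the field `L≤` of `VBad` bounds the height by a
    -- multiple of `P`.
    V-early : ∀ {i B v} → VFound i B v → β * k₁ ≤ ♯ 2 * D * (radius B * (PP * PP))
    V-early {i} {B} {v} F = bound (VFound.witness F)
      where
      bound : ∃[ t ] (t within B × VBad v t) → β * k₁ ≤ ♯ 2 * D * (radius B * (PP * PP))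
      bound (_ , _ , bad) = begin
        β * k₁ ≤⟨ *-monoˡ β 0≤β (x≤x*y 0≤k₁ (1≤s i)) ⟩
        β * (k₁ * s i) ≤⟨ VFound.low F ⟩
        radius B * (height v * den v * P) ≤⟨ *-monoˡ (radius B) (<⇒≤ (positive B)) (*-monoʳ P 0≤P (*-mono (0≤height v) height≤ (≤-trans 0≤1 (VBad.1≤den bad)) (VBad.den≤ bad))) ⟩
        radius B * (♯ 2 * D * P * PP * P) ≈⟨ (solve 3 (λ a b c → a :* ((con (+ 2)) :* b :* c :* (c :* c) :* c) := (con (+ 2)) :* b :* (a :* (c :* c :* (c :* c)))) refl (radius B) D P) ⟩
        ♯ 2 * D * (radius B * (PP * PP)) ∎
        where
        height≤ : height v ≤ ♯ 2 * D * P
        height≤ = ⊔-lub (≤-trans (*-monoˡ P 0≤P (VBad.L≤ bad)) (≤-reflexive (*-comm P _)))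
          (1≤x*y (≤-trans 1≤D (by≤ 0≤D (solve 1 (λ a → (con (+ 2)) :* a := a :+ a) refl D))) 1≤P)

    private
      module _ {i w t} (bad : WBad i w t) where

        s²≤P : s i ^ 2 ≤ P
        s²≤P = ≤-trans (x≤y*x (^-nonneg 2 (<⇒≤ (0<s i))) (WBad.1≤snd bad)) bs²≤P
          where
          bs²≤P : ∣ fromℤ (snd w) ∣ * s i ^ 2 ≤ P
          bs²≤P = ≤-trans (WBad.snd≤ bad) (by≤ (*-nonneg (0≤sub ((by≤ (0≤+ (0≤sub 2k≤1) 0≤k) (solve 1 (λ a → con (+ 1) := a :+ ((con (+ 1)) :- (con (+ 2)) :* a :+ a)) refl k)))) 0≤P) (solve 2 (λ a b → a := b :* a :+ ((con (+ 1)) :- b) :* a) refl P k))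

    W-class : ∀ {i B w} → WFound i B w → s i ≤ PP
    W-class {i} {B} {w} F = bound (WFound.witness F)
      where
      bound : ∃[ t ] (t within B × WBad i w t) → s i ≤ PP
      bound (_ , _ , bad) = ≤-trans (≤-trans (x≤x*y (<⇒≤ (0<s i)) (1≤s i)) (≤-reflexive (solve 1 (λ a → a :* a := a :^ 2) refl (s i)))) (≤-trans (s²≤P bad) P≤PP)

    W-early : ∀ {i B w} → WFound i B w → β * k₁ ≤ ♯ 2 * D * (radius B * (PP * PP))
    W-early {i} {B} {w} F = bound (WFound.witness F)
      where
      bound : ∃[ t ] (t within B × WBad i w t) → β * k₁ ≤ ♯ 2 * D * (radius B * (PP * PP))
      bound (_ , _ , bad) = ≤-trans (by≤ (*-nonneg 0≤β (0≤sub k₁≤1)) (solve 2 (λ a b → a := a :* b :+ a :* ((con (+ 1)) :- b)) refl β k₁)) (*-cancelʳ-≤ k 0<k (begin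
        β * k ≤⟨ *-monoˡ β 0≤β (≤-trans k≤k₄ (x≤x*y 0≤k₄ (1≤^ 2 (1≤s i)))) ⟩
        β * (k₄ * s i ^ 2) ≤⟨ WFound.low F ⟩
        radius B * (∣ α w ∣ * PP) ≤⟨ *-monoˡ (radius B) (<⇒≤ (positive B)) (*-monoʳ PP 0≤PP (≤-trans (≤-trans (x≤y*x (0≤∣∣ _) (WBad.1≤snd bad)) (x≤x*y (*-nonneg (0≤∣∣ _) (0≤∣∣ _)) (1≤^ 5 (1≤s i)))) (WBad.product bad))) ⟩
        radius B * (k * PP * PP) ≤⟨ x≤y*x (*-nonneg (<⇒≤ (positive B)) (*-nonneg (*-nonneg 0≤k 0≤PP) 0≤PP)) (≤-trans 1≤D (by≤ 0≤D (solve 1 (λ a → (con (+ 2)) :* a := a :+ a) refl D))) ⟩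
        ♯ 2 * D * (radius B * (k * PP * PP)) ≈⟨ (solve 4 (λ a b c d → (con (+ 2)) :* a :* (b :* (c :* (d :* d) :* (d :* d))) := (con (+ 2)) :* a :* (b :* (d :* d :* (d :* d))) :* c) refl D (radius B) k P) ⟩
        ♯ 2 * D * (radius B * (PP * PP)) * k ∎))

    -- The number `μ` bounds both slope and value of the line. As the coefficient b is at most of
    -- order P and `μ` of order r/P², an exponent 2 would bound only b² μ, which is of order r and
    -- free of P. The exponents `suc (j + j)` and `suc j` leave one power of P over. If `μ` is at
    -- least 1, then `P ≤ r` at once.
    W-late : ∀ {κ j i w t ρ r} → κ ≤ 1# → (∀ μ → 0# ≤ μ → μ < 1# → 1# ≤ ∣ fromℤ (snd w) ∣ → ∣ α w ∣ ≤ μ → ∣ val w t ∣ ≤ μ → κ ≤ ∣ fromℤ (snd w) ∣ ^ suc (j ℕ.+ j) * μ ^ suc j) →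
      WBad i w t → 0# ≤ ρ → 1# ≤ r → 1# ≤ r * ρ → ρ * (∣ α w ∣ * PP) ≤ k₄ * s i ^ 2 → κ * P ≤ r ^ suc j
    W-late {κ} {j} {i} {w} {t} {ρ} {r} κ≤1 dual bad 0≤ρ 1≤r 1≤rρ up with ≤-or-> 1# μ
      where
      μ = k₄ * s i ^ 2 * r * PP ⁻¹
    ... | inj₁ 1≤μ = ≤-trans (≤-trans (by≤ (*-nonneg (0≤sub κ≤1) 0≤P) (solve 2 (λ a b → a := b :* a :+ ((con (+ 1)) :- b) :* a) refl P κ)) P≤r) (x≤x*y 0≤r (1≤^ j 1≤r))
      where
      0≤r = ≤-trans 0≤1 1≤r
      P≤r : P ≤ r
      P≤r = *-cancelˡ-≤ P 0<P (begin
        PP ≤⟨ x≤y*x 0≤PP 1≤μ ⟩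
        k₄ * s i ^ 2 * r * PP ⁻¹ * PP ≈⟨ div-mul 0<PP ⟩
        k₄ * s i ^ 2 * r ≤⟨ *-monoʳ r 0≤r (≤-trans (*-monoʳ (s i ^ 2) (^-nonneg 2 (<⇒≤ (0<s i))) ((by≤ (0≤+ (0≤sub 4k₄≤1) (*-nonneg (0≤# 3) 0≤k₄)) (solve 1 (λ a → con (+ 1) := a :+ ((con (+ 1)) :- (con (+ 4)) :* a :+ (con (+ 3)) :* a)) refl k₄)))) (≤-trans (≤-reflexive (*-identityˡ _)) (s²≤P bad))) ⟩
        P * r ∎)
    ... | inj₂ μ<1 = *-cancelʳ-≤ (P ^ suc (j ℕ.+ j)) (^-pos (suc (j ℕ.+ j)) 0<P) (begin
        κ * P * P ^ n ≈⟨ *-assoc κ P _ ⟩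
        κ * (P * P ^ n) ≈⟨ *-congˡ (sym PPⁿ) ⟩
        κ * PP ^ suc j ≤⟨ *-monoʳ (PP ^ suc j) (^-nonneg (suc j) 0≤PP) (dual μ 0≤μ μ<1 (WBad.1≤snd bad) α≤ val≤) ⟩
        b ^ n * μ ^ suc j * PP ^ suc j ≈⟨ trans (*-assoc _ _ _) (*-congˡ (sym (^-distrib-* μ PP (suc j)))) ⟩
        b ^ n * (μ * PP) ^ suc j ≤⟨ *-monoˡ (b ^ n) (^-nonneg n 0≤b) (^-mono (suc j) (*-nonneg 0≤μ 0≤PP) μPP≤) ⟩
        b ^ n * (σ² * r) ^ suc j ≈⟨ trans (*-congˡ (^-distrib-* σ² r (suc j))) (sym (*-assoc _ _ _)) ⟩
        b ^ n * σ² ^ suc j * r ^ suc j ≤⟨ *-monoʳ (r ^ suc j) (^-nonneg (suc j) 0≤r) (*-monoˡ (b ^ n) (^-nonneg n 0≤b) (^-monoʳ {σ²} {suc j} {n} 1≤σ² (ℕ.s≤s (ℕ.m≤m+n j j)))) ⟩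
        b ^ n * σ² ^ n * r ^ suc j ≈⟨ *-congʳ (sym (^-distrib-* b σ² n)) ⟩
        (b * σ²) ^ n * r ^ suc j ≤⟨ *-monoʳ (r ^ suc j) (^-nonneg (suc j) 0≤r) (^-mono n (*-nonneg 0≤b 0≤σ²) bσ²≤P) ⟩
        P ^ n * r ^ suc j ≈⟨ *-comm _ _ ⟩
        r ^ suc j * P ^ n ∎)
      where
      n = suc (j ℕ.+ j)
      μ = k₄ * s i ^ 2 * r * PP ⁻¹
      b = ∣ fromℤ (snd w) ∣
      σ² = s i ^ 2
      0≤b = 0≤∣∣ (fromℤ (snd w))
      0≤r = ≤-trans 0≤1 1≤r
      1≤σ² : 1# ≤ σ²
      1≤σ² = 1≤^ 2 (1≤s i)
      0≤σ² = ≤-trans 0≤1 1≤σ²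
      0≤μ : 0# ≤ μ
      0≤μ = *-nonneg (*-nonneg (*-nonneg 0≤k₄ 0≤σ²) 0≤r) (<⇒≤ (⁻¹-pos 0<PP))
      μPP : μ * PP ≈ k₄ * σ² * r
      μPP = div-mul 0<PP
      μPP≤ : μ * PP ≤ σ² * r
      μPP≤ = ≤-trans (≤-reflexive μPP) (*-monoʳ r 0≤r (≤-trans (*-monoʳ σ² 0≤σ² ((by≤ (0≤+ (0≤sub 4k₄≤1) (*-nonneg (0≤# 3) 0≤k₄)) (solve 1 (λ a → con (+ 1) := a :+ ((con (+ 1)) :- (con (+ 4)) :* a :+ (con (+ 3)) :* a)) refl k₄)))) (≤-reflexive (*-identityˡ _))))
      bσ²≤P : b * σ² ≤ P
      bσ²≤P = ≤-trans (WBad.snd≤ bad) (by≤ (*-nonneg (0≤sub ((by≤ (0≤+ (0≤sub 2k≤1) 0≤k) (solve 1 (λ a → con (+ 1) := a :+ ((con (+ 1)) :- (con (+ 2)) :* a :+ a)) refl k)))) 0≤P) (solve 2 (λ a b → a := b :* a :+ ((con (+ 1)) :- b) :* a) refl P k))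
      PPⁿ : PP ^ suc j ≈ P * P ^ n
      PPⁿ = trans (^-distrib-* P P (suc j)) (trans (sym (^-homo-* P (suc j) (suc j))) (reflexive (≡.cong (λ m → P ^ suc m) (ℕ.+-suc j j))))
      α≤ : ∣ α w ∣ ≤ μ
      α≤ = *-cancelʳ-≤ PP 0<PP (begin
        ∣ α w ∣ * PP ≤⟨ x≤y*x (*-nonneg (0≤∣∣ _) 0≤PP) 1≤rρ ⟩
        r * ρ * (∣ α w ∣ * PP) ≈⟨ *-assoc r ρ _ ⟩
        r * (ρ * (∣ α w ∣ * PP)) ≤⟨ *-monoˡ r 0≤r up ⟩
        r * (k₄ * σ²) ≈⟨ trans (*-comm r _) (sym μPP) ⟩
        μ * PP ∎)
      val≤ : ∣ val w t ∣ ≤ μ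
      val≤ = *-cancelʳ-≤ PP 0<PP (begin
        ∣ val w t ∣ * PP ≤⟨ WBad.near bad ⟩
        k * s i ≤⟨ *-mono 0≤k k≤k₄ (<⇒≤ (0<s i)) (≤-trans (x≤x*y (<⇒≤ (0<s i)) (1≤s i)) (≤-reflexive (solve 1 (λ a → a :* a := a :^ 2) refl (s i)))) ⟩
        k₄ * σ² ≤⟨ x≤x*y (*-nonneg 0≤k₄ 0≤σ²) 1≤r ⟩
        k₄ * σ² * r ≈⟨ sym μPP ⟩
        μ * PP ∎)

  -- The list of fresh targets and its window of indices.

  least-ℕ : ∀ (A : ℕ → Set) → ∃ A → ∃[ m ] (A m × (∀ {n} → A n → m ℕ.≤ n))
  least-ℕ A (n , An) = <-rec (λ n → A n → ∃[ m ] (A m × (∀ {n} → A n → m ℕ.≤ n))) descend n An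
    where
    descend : ∀ n → (∀ {m} → m ℕ.< n → A m → ∃[ m ] (A m × (∀ {n} → A n → m ℕ.≤ n))) → A n → ∃[ m ] (A m × (∀ {n} → A n → m ℕ.≤ n))
    descend n IH An with lem {∃[ m ] (m ℕ.< n × A m)}
    ... | yes (m , m<n , Am) = IH m<n Am
    ... | no none = n , An , λ {k} Ak → ℕ.≮⇒≥ λ k<n → none (k , k<n , Ak)

  load : List (ℝ × ℕ) → ℝ
  load xs = mass (targets (λ _ → 0#) xs)

  load-++ : ∀ xs ys → load (xs ++ ys) ≈ load xs + load ys
  load-++ [] ys = sym (+-identityˡ _)
  load-++ (x ∷ xs) ys = trans (+-congˡ (load-++ xs ys)) (sym (+-assoc _ _ _))

  load-++≤ : ∀ {x y} xs ys → load xs ≤ x → load ys ≤ y → load (xs ++ ys) ≤ x + y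
  load-++≤ xs ys p q = ≤-respˡ (sym (load-++ xs ys)) (+-mono-≤ p q)

  abstract
    -- Any element will do, since the targets of one cell that matter for the induction share their
    -- root. Being abstract, the classical choice never unfolds.
    pick : (ℝ → Set) → ℕ → List (ℝ × ℕ)
    pick T l with lem {∃ T}
    ... | yes (z , _) = (z , l) ∷ []
    ... | no _ = []

    load-pick : ∀ T l → load (pick T l) ≤ θ ^ l
    load-pick T l with lem {∃ T}
    ... | yes _ = ≤-reflexive (+-identityʳ _)
    ... | no _ = ^-nonneg l (<⇒≤ 0<θ)

    pick-∈ : ∀ {T l} → ∃ T → ∃[ z ] (T z × (z , l) ∈ₗ pick T l)
    pick-∈ {T} {l} t with lem {∃ T}
    ... | yes (z , Tz) = z , Tz , here ≡.refl
    ... | no ¬t = ⊥-elim (¬t t)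

  -- κ² X^(4J+1) ≤ (κ p)² ≤ r^(2J) ≤ C^(2J) X^(4J). The growth exponent exceeds 4J by one so that a
  -- power of `X` survives the cancellation and `X` is bounded.
  window-core : ∀ {κ C X p r} J → 0# ≤ κ → 1# ≤ X → 0# ≤ p → 0# ≤ r → 0# ≤ C → X ^ suc (J ℕ.* 4) ≤ p * p → κ * p ≤ r ^ J → r ≤ C * (X * X) →
    κ * κ * X ≤ C ^ J * C ^ J
  window-core {κ} {C} {X} {p} {r} J 0≤κ 1≤X 0≤p 0≤r 0≤C growth late r≤ = *-cancelʳ-≤ (X ^ (J ℕ.* 4)) (^-pos (J ℕ.* 4) (<-≤-trans 0<1 1≤X)) (begin
    κ * κ * X * X ^ (J ℕ.* 4) ≈⟨ *-assoc (κ * κ) X _ ⟩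
    κ * κ * X ^ suc (J ℕ.* 4) ≤⟨ *-monoˡ (κ * κ) (0≤□ κ) growth ⟩
    κ * κ * (p * p) ≈⟨ (solve 2 (λ a b → a :* a :* (b :* b) := a :* b :* (a :* b)) refl κ p) ⟩
    κ * p * (κ * p) ≤⟨ *-mono 0≤κp late 0≤κp late ⟩
    r ^ J * r ^ J ≤⟨ *-mono (^-nonneg J 0≤r) rJ≤ (^-nonneg J 0≤r) rJ≤ ⟩
    (C * (X * X)) ^ J * (C * (X * X)) ^ J ≈⟨ *-cong (^-distrib-* C (X * X) J) (^-distrib-* C (X * X) J) ⟩
    C ^ J * (X * X) ^ J * (C ^ J * (X * X) ^ J) ≈⟨ (solve 2 (λ a b → a :* b :* (a :* b) := a :* a :* (b :* b)) refl (C ^ J) ((X * X) ^ J)) ⟩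
    C ^ J * C ^ J * ((X * X) ^ J * (X * X) ^ J) ≈⟨ *-congˡ (trans (sym (^-distrib-* (X * X) (X * X) J)) (trans (^-congˡ J (solve 1 (λ a → a :* a :* (a :* a) := a :^ 4) refl X))
        (trans (^-assocʳ X 4 J) (reflexive (≡.cong (X ^_) (ℕ.*-comm 4 J)))))) ⟩
    C ^ J * C ^ J * X ^ (J ℕ.* 4) ∎)
    where
    0≤κp = *-nonneg 0≤κ 0≤p
    rJ≤ = ^-mono J 0≤r r≤

  inverse-bound : ∀ {b d ρ X} → 0# < b → 0# < ρ → 1# ≤ X → b ≤ d * (ρ * (X * X)) → 1# + ρ ⁻¹ ≤ (1# + d * b ⁻¹) * (X * X)
  inverse-bound {b} {d} {ρ} {X} 0<b 0<ρ 1≤X early = ≤-trans (+-mono-≤ (1≤x*y 1≤X 1≤X) ρ⁻¹≤) (≤-reflexive (solve 3 (λ a b c → a :* a :+ b :* c :* (a :* a) := ((con (+ 1)) :+ b :* c) :* (a :* a)) refl X d (b ⁻¹)))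
    where
    ρ⁻¹≤ : ρ ⁻¹ ≤ d * b ⁻¹ * (X * X)
    ρ⁻¹≤ = *-cancelˡ-≤ b 0<b (begin
      b * ρ ⁻¹ ≤⟨ *-monoʳ (ρ ⁻¹) (<⇒≤ (⁻¹-pos 0<ρ)) early ⟩
      d * (ρ * (X * X)) * ρ ⁻¹ ≈⟨ (solve 4 (λ a b c d → a :* (b :* (c :* c)) :* d := a :* (c :* c) :* (b :* d)) refl d ρ X (ρ ⁻¹)) ⟩
      d * (X * X) * (ρ * ρ ⁻¹) ≈⟨ *-congˡ (trans (x⁻¹x 0<ρ) (sym (x⁻¹x 0<b))) ⟩
      d * (X * X) * (b * b ⁻¹) ≈⟨ (solve 4 (λ a b c d → a :* (b :* b) :* (c :* d) := c :* (a :* d :* (b :* b))) refl d X b (b ⁻¹)) ⟩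
      b * (d * b ⁻¹ * (X * X)) ∎)

  module Construction {β : ℝ} (𝒞 : Constants β) (k₁≤1 : Constants.k₁ 𝒞 ≤ 1#) (e f g h : Bool → ℝ)
    (e≤D : ∀ b → ∣ e b ∣ ≤ Constants.D 𝒞) (g≤D : ∀ b → ∣ g b ∣ ≤ Constants.D 𝒞) (1≤De : ∀ b → 1# ≤ Constants.D 𝒞 * ∣ e b ∣)
    (P : ℕ → ℝ) (1≤P : ∀ m → 1# ≤ P m) (P-mono : ∀ {m n} → m ℕ.≤ n → P m ≤ P n) (P-unbounded : ∀ M → ∃[ m ] (∀ n → m ℕ.≤ n → M ≤ P n))
    (K : ℕ) (K-light : ♯ 96 * fromℕ K * θ ^ Constants.l₀ 𝒞 ≤ 1#) where

    open Constants 𝒞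

    module A (b : Bool) (m : ℕ) = SideWindow 𝒞 (e b) (f b) (g b) (h b) (P m) (1≤P m) (e≤D b) (g≤D b) (1≤De b) k₁≤1

    PP : ℕ → ℝ
    PP m = P m * P m

    0≤P : ∀ m → 0# ≤ P m
    0≤P m = ≤-trans 0≤1 (1≤P m)

    1≤PP : ∀ m → 1# ≤ PP m
    1≤PP m = 1≤x*y (1≤P m) (1≤P m)

    -- The index m is relevant for targets in balls of radius ρ only if Early m ρ.
    Early : ℕ → ℝ → Set
    Early m ρ = β * k₁ ≤ ♯ 2 * D * (ρ * (PP m * PP m))

    abstract
      first : ∀ (B : Ball 1) → ∃[ m ] (Early m (radius B) × (∀ {n} → Early n (radius B) → m ℕ.≤ n))
      first B = least-ℕ (λ m → Early m (radius B)) (some (P-unbounded (radius B ⁻¹)))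
        where
        some : ∃[ m ] (∀ n → m ℕ.≤ n → radius B ⁻¹ ≤ P n) → ∃[ m ] Early m (radius B)
        some (m , p) = m , ≤-trans (≤-trans (by≤ (*-nonneg (0≤sub β≤1) 0≤k₁) (solve 2 (λ a b → a := b :* a :+ ((con (+ 1)) :- b) :* a) refl k₁ β)) k₁≤1)
          (≤-trans (≤-respˡ (x⁻¹x (positive B)) (*-monoˡ (radius B) 0≤ρ (≤-trans (p m ℕ.≤-refl) (≤-trans (x≤x*y (0≤P m) (1≤P m)) (x≤x*y (*-nonneg (0≤P m) (0≤P m)) (1≤PP m))))))
            (x≤y*x (*-nonneg 0≤ρ (*-nonneg (*-nonneg (0≤P m) (0≤P m)) (*-nonneg (0≤P m) (0≤P m)))) (≤-trans 1≤D (by≤ 0≤D (solve 1 (λ a → (con (+ 2)) :* a := a :+ a) refl D)))))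
          where
          0≤ρ : 0# ≤ radius B
          0≤ρ = <⇒≤ (positive B)

      classes : ∀ m → ∃[ n ] (PP m < s n)
      classes m = ^-unbounded 1<S (PP m)

    I : ℕ → ℕ
    I m = proj₁ (classes m)

    V W′ : Bool → ℕ → ℕ → Ball 1 → ℝ → Set
    V b m = A.VTarget b m
    W′ b m = A.WTarget b m

    row : Ball 1 → ℕ → ℕ → List (ℝ × ℕ)
    row B m i = (pick (V true m i B) (l₀ ℕ.+ i) ++ pick (V false m i B) (l₀ ℕ.+ i)) ++ (pick (W′ true m i B) (l₀ ℕ.+ i) ++ pick (W′ false m i B) (l₀ ℕ.+ i))

    cells : Ball 1 → ℕ → ℕ → ℕ → List (ℝ × ℕ)
    cells B m i zero = []
    cells B m i (suc n) = row B m i ++ cells B m (suc i) n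

    window : Ball 1 → ℕ → ℕ → List (ℝ × ℕ)
    window B m zero = []
    window B m (suc n) = cells B m 0 (I m) ++ window B (suc m) n

    new : Ball 1 → List (ℝ × ℕ)
    new B = window B (proj₁ (first B)) K

    private
      load-row : ∀ B m i → load (row B m i) ≤ ♯ 4 * θ ^ (l₀ ℕ.+ i)
      load-row B m i = ≤-trans (load-++≤ (pick (V true m i B) l ++ pick (V false m i B) l) (pick (W′ true m i B) l ++ pick (W′ false m i B) l)
          (load-++≤ (pick (V true m i B) l) (pick (V false m i B) l) (load-pick _ l) (load-pick _ l))
          (load-++≤ (pick (W′ true m i B) l) (pick (W′ false m i B) l) (load-pick _ l) (load-pick _ l)))
        (≤-reflexive (four (θ ^ l)))
        where
        l = l₀ ℕ.+ i
        four : ∀ x → x + x + (x + x) ≈ ♯ 4 * x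
        four x = (solve 1 (λ a → a :+ a :+ (a :+ a) := (con (+ 4)) :* a) refl x)

      -- The bound is that of the whole geometric tail, with `1 / (1 - θ) = 3` and four cells per
      -- class, so the number `n` of classes does not enter.
      load-cells : ∀ B m i n → load (cells B m i n) ≤ ♯ 12 * θ ^ (l₀ ℕ.+ i)
      load-cells B m i zero = *-nonneg (0≤# 12) (^-nonneg (l₀ ℕ.+ i) (<⇒≤ 0<θ))
      load-cells B m i (suc n) = ≤-trans (load-++≤ (row B m i) (cells B m (suc i) n) (load-row B m i) (load-cells B m (suc i) n))
        (≤-reflexive (trans (+-congˡ (*-congˡ (reflexive (≡.cong (θ ^_) (ℕ.+-suc l₀ i))))) (geometric (θ ^ (l₀ ℕ.+ i)))))
        where
        geometric : ∀ x → ♯ 4 * x + ♯ 12 * (θ * x) ≈ ♯ 12 * x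
        geometric x = trans (solve 2 (λ a b → (con (+ 4)) :* a :+ (con (+ 12)) :* (b :* a) := (con (+ 4)) :* a :+ (con (+ 4)) :* ((con (+ 3)) :* b) :* a) refl x θ) (trans (+-congˡ (*-congʳ (*-congˡ 3θ≈2))) (solve 1 (λ a → (con (+ 4)) :* a :+ (con (+ 4)) :* (con (+ 2)) :* a := (con (+ 12)) :* a) refl x))

      load-window : ∀ B m n → load (window B m n) ≤ fromℕ n * (♯ 12 * θ ^ l₀)
      load-window B m zero = ≤-reflexive (sym (zeroˡ _))
      load-window B m (suc n) = ≤-trans (load-++≤ (cells B m 0 (I m)) (window B (suc m) n) (load-cells B m 0 (I m)) (load-window B (suc m) n))
        (≤-reflexive (trans (+-congʳ (*-congˡ (reflexive (≡.cong (θ ^_) (ℕ.+-identityʳ l₀))))) (collect (♯ 12 * θ ^ l₀) (fromℕ n))))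
        where
        collect : ∀ x y → x + y * x ≈ (1# + y) * x
        collect x y = (solve 2 (λ a b → a :+ b :* a := ((con (+ 1)) :+ b) :* a) refl x y)

    -- The 96 of `K-light` is 8 times 12: the share of fresh targets in the potential argument, and
    -- the load of one index in units of `θ ^ l₀`.
    light : ∀ B → ♯ 8 * load (new B) ≤ 1#
    light B = ≤-trans (*-monoˡ (♯ 8) (0≤# 8) (load-window B _ K)) (≤-respˡ (regroup (fromℕ K) (θ ^ l₀)) K-light)
      where
      regroup : ∀ x y → ♯ 96 * x * y ≈ ♯ 8 * (x * (♯ 12 * y))
      regroup x y = (solve 2 (λ a b → (con (+ 96)) :* a :* b := (con (+ 8)) :* (a :* ((con (+ 12)) :* b))) refl x y)

    private
      row-V : ∀ b {B m i} → ∃ (V b m i B) → ∃[ z ] (V b m i B z × (z , l₀ ℕ.+ i) ∈ₗ row B m i)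
      row-V true x = let (z , p , q) = pick-∈ x in z , p , ∈-++⁺ˡ (∈-++⁺ˡ q)
      row-V false {B} {m} {i} x = let (z , p , q) = pick-∈ x in z , p , ∈-++⁺ˡ (∈-++⁺ʳ (pick (V true m i B) (l₀ ℕ.+ i)) q)

      row-W : ∀ b {B m i} → ∃ (W′ b m i B) → ∃[ z ] (W′ b m i B z × (z , l₀ ℕ.+ i) ∈ₗ row B m i)
      row-W true {B} {m} {i} x = let (z , p , q) = pick-∈ x in z , p , ∈-++⁺ʳ (pick (V true m i B) (l₀ ℕ.+ i) ++ pick (V false m i B) (l₀ ℕ.+ i)) (∈-++⁺ˡ q)
      row-W false {B} {m} {i} x = let (z , p , q) = pick-∈ x in z , p , ∈-++⁺ʳ (pick (V true m i B) (l₀ ℕ.+ i) ++ pick (V false m i B) (l₀ ℕ.+ i)) (∈-++⁺ʳ (pick (W′ true m i B) (l₀ ℕ.+ i)) q)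

      row⊆cells : ∀ {B m i x} i₀ n → i₀ ℕ.≤ i → i ℕ.< i₀ ℕ.+ n → x ∈ₗ row B m i → x ∈ₗ cells B m i₀ n
      row⊆cells {i = i} i₀ zero p q r = ⊥-elim (ℕ.<⇒≱ q (≡.subst (ℕ._≤ i) (≡.sym (ℕ.+-identityʳ i₀)) p))
      row⊆cells {B} {m} {i} i₀ (suc n) p q r with ℕ.m≤n⇒m<n∨m≡n p
      ... | inj₁ i₀<i = ∈-++⁺ʳ (row B m i₀) (row⊆cells (suc i₀) n i₀<i (≡.subst (i ℕ.<_) (ℕ.+-suc i₀ n) q) r)
      ... | inj₂ ≡.refl = ∈-++⁺ˡ r

      cells⊆window : ∀ {B m x} m₀ n → m₀ ℕ.≤ m → m ℕ.< m₀ ℕ.+ n → x ∈ₗ cells B m 0 (I m) → x ∈ₗ window B m₀ n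
      cells⊆window {m = m} m₀ zero p q r = ⊥-elim (ℕ.<⇒≱ q (≡.subst (ℕ._≤ m) (≡.sym (ℕ.+-identityʳ m₀)) p))
      cells⊆window {B} {m} m₀ (suc n) p q r with ℕ.m≤n⇒m<n∨m≡n p
      ... | inj₁ m₀<m = ∈-++⁺ʳ (cells B m₀ 0 (I m₀)) (cells⊆window (suc m₀) n m₀<m (≡.subst (m ℕ.<_) (ℕ.+-suc m₀ n) q) r)
      ... | inj₂ ≡.refl = ∈-++⁺ˡ r

      index : ∀ {m i} → s i ≤ PP m → i ℕ.< I m
      index {m} {i} p with suc i ℕ.≤? I m
      ... | yes q = q
      ... | no ¬q = ⊥-elim (<⇒≱ (proj₂ (classes m)) (≤-trans (^-monoʳ 1≤S (ℕ.≮⇒≥ ¬q)) p))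

    row⊆new : ∀ {B m i x} → Early m (radius B) → m ℕ.< proj₁ (first B) ℕ.+ K → s i ≤ PP m → x ∈ₗ row B m i → x ∈ₗ new B
    row⊆new {B} {m} {i} p q r x∈ = cells⊆window (proj₁ (first B)) K (proj₂ (proj₂ (first B)) p) q (row⊆cells 0 (I m) ℕ.z≤n (index r) x∈)

    open Potential 0<β new light public using (strategy; pending)

    -- With r = 1 + 1/ρ, the index m is relevant at radius ρ only if κ P m ≤ r ^ J.
    module Play {j J : ℕ} (3≤J : 3 ℕ.≤ J) (j<J : suc j ℕ.≤ J) {κ : ℝ} (0<κ : 0# < κ) (κ≤1 : κ ≤ 1#) (N : NestedBalls β)
      (avoids : ∀ n t → t within NestedBalls.ball N (suc n) → ¬ (∣ t - proj₁ (median (pending (applyDownFrom (NestedBalls.ball N) n) (NestedBalls.ball N n))) ∣ ≤ β * NestedBalls.ρ N n))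
      (dual : ∀ b m w {t} → t within NestedBalls.ball N 0 → ∀ μ → 0# ≤ μ → μ < 1# → 1# ≤ ∣ fromℤ (snd w) ∣ → ∣ A.α b m w ∣ ≤ μ → ∣ A.val b m w t ∣ ≤ μ →
        κ ≤ ∣ fromℤ (snd w) ∣ ^ suc (j ℕ.+ j) * μ ^ suc j)
      (m₀ : ℕ) (growth : ∀ m → m₀ ℕ.≤ m → PP m ^ suc (J ℕ.* 4) ≤ PP (K ℕ.+ m)) where

      open NestedBalls N

      private
        cleared = Potential.cleared 0<β new light N avoids

      r : ℝ → ℝ
      r ρ = 1# + ρ ⁻¹

      module _ {ρ : ℝ} (0<ρ : 0# < ρ) where
        1≤r : 1# ≤ r ρ
        1≤r = (by≤ (<⇒≤ (⁻¹-pos 0<ρ)) (solve 1 (λ a → (con (+ 1)) :+ a := (con (+ 1)) :+ a) refl (ρ ⁻¹)))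

        1≤rρ : 1# ≤ r ρ * ρ
        1≤rρ = ≤-respˡ (x⁻¹x 0<ρ) (by≤ (<⇒≤ 0<ρ) (solve 2 (λ a b → ((con (+ 1)) :+ a) :* b := b :* a :+ b) refl (ρ ⁻¹) ρ))

      Late : ℕ → ℝ → Set
      Late m ρ = κ * P m ≤ r ρ ^ J

      private
        late-V : ∀ b {m i v ρ} → 0# < ρ → 1# ≤ A.den b m v → s i ^ 3 * A.den b m v ≤ PP m → ρ * (A.height b m v * A.den b m v * P m) ≤ k₁ * s i → Late m ρ
        late-V b {m} {i} {v} 0<ρ p q u = ≤-trans (by≤ (*-nonneg (0≤sub κ≤1) (0≤P m)) (solve 2 (λ a b → a := b :* a :+ ((con (+ 1)) :- b) :* a) refl (P m) κ))
          (≤-trans (A.V-late b m {i} {v} (<⇒≤ 0<ρ) (1≤r 0<ρ) (1≤rρ 0<ρ) p q u) (^-monoʳ {m = 3} {J} (1≤r 0<ρ) 3≤J))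

        late-W : ∀ b {m i w t ρ} → t within ball 0 → A.WBad b m i w t → 0# < ρ → ρ * (∣ A.α b m w ∣ * PP m) ≤ k₄ * s i ^ 2 → Late m ρ
        late-W b {m} {i} {w} {t} t∈ bad 0<ρ u = ≤-trans (A.W-late b m {κ} {j} {i} {w} {t} κ≤1 (dual b m w t∈) bad (<⇒≤ 0<ρ) (1≤r 0<ρ) (1≤rρ 0<ρ) u)
          (^-monoʳ {m = suc j} {J} (1≤r 0<ρ) j<J)

        C : ℝ
        C = 1# + ♯ 2 * D * (β * k₁) ⁻¹

        0<βk₁ = *-pos 0<β 0<k₁

        0≤C : 0# ≤ C
        0≤C = 0≤+ 0≤1 (*-nonneg (*-nonneg (0≤# 2) 0≤D) (<⇒≤ (⁻¹-pos 0<βk₁)))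

        -- At most K consecutive indices are relevant at a given radius.
        incompatible : ∀ m {ρ} → 0# < ρ → m₀ ℕ.≤ m → C ^ J * C ^ J < κ * κ * PP m → Early m ρ → ¬ Late (K ℕ.+ m) ρ
        incompatible m 0<ρ m₀≤m large early late = <⇒≱ large (window-core J (<⇒≤ 0<κ) (1≤PP m) (0≤P (K ℕ.+ m)) (≤-trans 0≤1 (1≤r 0<ρ)) 0≤C
          (growth m m₀≤m) late (inverse-bound 0<βk₁ 0<ρ (1≤PP m) early))

        early-mono : ∀ {m n ρ} → 0# ≤ ρ → m ℕ.≤ n → Early m ρ → Early n ρ
        early-mono {m} {n} {ρ} 0≤ρ m≤n p = ≤-trans p (*-monoˡ (♯ 2 * D) (*-nonneg (0≤# 2) 0≤D) (*-monoˡ ρ 0≤ρ (*-mono 0≤PP PP≤ 0≤PP PP≤)))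
          where
          0≤PP = ≤-trans 0≤1 (1≤PP m)
          PP≤ = *-mono (0≤P m) (P-mono m≤n) (0≤P m) (P-mono m≤n)

      -- The second condition makes `incompatible` applicable; the third ensures that nothing is
      -- noticeable at Bob's first ball. Both involve data of the play, which is harmless because
      -- only a tail of the indices counts.
      Large : ℕ → Set
      Large m = m₀ ℕ.≤ m × C ^ J * C ^ J < κ * κ * PP m × r (ρ 0) ^ J < κ * P (K ℕ.+ m)

      large : ∃[ m ] Large m
      large = combine (P-unbounded ((C ^ J * C ^ J + 1#) * (κ * κ) ⁻¹)) (P-unbounded ((r (ρ 0) ^ J + 1#) * κ ⁻¹))
        where
        beyond : ∀ {y x z} → 0# < y → (x + 1#) * y ⁻¹ ≤ z → x < y * z
        beyond {y} {x} {z} 0<y p = <-≤-trans (≰⇒> λ q → <⇒≱ 0<1 (by≤ (0≤sub q) (solve 1 (λ a → con (+ 0) := (con (+ 1)) :+ (a :- (a :+ (con (+ 1))))) refl x)))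
          (≤-trans (≤-reflexive (trans (sym (div-mul 0<y)) (*-comm _ y))) (*-monoˡ y (<⇒≤ 0<y) p))
        combine : ∃[ m ] (∀ n → m ℕ.≤ n → (C ^ J * C ^ J + 1#) * (κ * κ) ⁻¹ ≤ P n) → ∃[ m ] (∀ n → m ℕ.≤ n → (r (ρ 0) ^ J + 1#) * κ ⁻¹ ≤ P n) → ∃[ m ] Large m
        combine (n₁ , p₁) (n₂ , p₂) = m , ℕ.≤-trans (ℕ.m≤m+n m₀ n₁) (ℕ.m≤m+n (m₀ ℕ.+ n₁) n₂) ,
          beyond (*-pos 0<κ 0<κ) (≤-trans (p₁ m (ℕ.≤-trans (ℕ.m≤n+m n₁ m₀) (ℕ.m≤m+n (m₀ ℕ.+ n₁) n₂))) (x≤x*y (0≤P m) (1≤P m))) ,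
          beyond 0<κ (p₂ (K ℕ.+ m) (ℕ.≤-trans (ℕ.m≤n+m n₂ (m₀ ℕ.+ n₁)) (ℕ.m≤n+m m K)))
          where
          m = m₀ ℕ.+ n₁ ℕ.+ n₂

      private
        -- If the index lay beyond the window, `m′` would not precede the first early index and
        -- would be early itself, while `K + m′` is late.
        in-window : ∀ {m n} → Large m → ∀ {m′} → m ℕ.≤ m′ → Late (K ℕ.+ m′) (ρ n) → K ℕ.+ m′ ℕ.< proj₁ (first (ball n)) ℕ.+ K
        in-window {m} {n} (m₀≤m , large , _) {m′} m≤m′ late = decidable-stable (suc (K ℕ.+ m′) ℕ.≤? proj₁ (first (ball n)) ℕ.+ K) λ ¬p →
          incompatible m′ (0<ρ n) (ℕ.≤-trans m₀≤m m≤m′)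
            (<-≤-trans large (*-monoˡ (κ * κ) (0≤□ κ) (*-mono (0≤P m) (P-mono m≤m′) (0≤P m) (P-mono m≤m′))))
            (early-mono (<⇒≤ (0<ρ n)) (first≤ ¬p) (proj₁ (proj₂ (first (ball n))))) late
          where
          first≤ : ¬ (K ℕ.+ m′ ℕ.< proj₁ (first (ball n)) ℕ.+ K) → proj₁ (first (ball n)) ℕ.≤ m′
          first≤ ¬p = ℕ.+-cancelʳ-≤ K _ _ (≡.subst (proj₁ (first (ball n)) ℕ.+ K ℕ.≤_) (ℕ.+-comm K m′) (ℕ.≮⇒≥ ¬p))

      module _ {m₁ : ℕ} (large : Large m₁) {m′ : ℕ} (m₁≤ : m₁ ℕ.≤ m′) (b : Bool) where
        private
          m = K ℕ.+ m′

          not-late : ¬ Late m (ρ 0)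
          not-late p = <⇒≱ (proj₂ (proj₂ large)) (≤-trans (*-monoˡ κ (<⇒≤ 0<κ) (P-mono (ℕ.+-monoʳ-≤ K m₁≤))) p)

          clearV : ∀ n i z → V b m i (ball n) z → Cleared N (l₀ ℕ.+ i) (V b m i) n
          clearV n i z (v , root , F) = let (z′ , x′ , z′∈) = row-V b (z , v , root , F) in z′ , x′ ,
            λ t → cleared n {z′} {l₀ ℕ.+ i} {t} (row⊆new (A.V-early b m F) (in-window {n = n} large m₁≤ late) (A.V-class b m F) z′∈)
            where
            late : Late m (ρ n)
            late = late-V b {m} {i} {v} (0<ρ n) (A.VBad.1≤den (proj₂ (proj₂ (A.VFound.witness F)))) (A.VFound.class≤ F) (A.VFound.up F)

          clearW : ∀ n i z → W′ b m i (ball n) z → Cleared N (l₀ ℕ.+ i) (W′ b m i) n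
          clearW n i z (w , root , F) = let (z′ , x′ , z′∈) = row-W b (z , w , root , F) in z′ , x′ ,
            λ t → cleared n {z′} {l₀ ℕ.+ i} {t} (row⊆new (A.W-early b m F) (in-window {n = n} large m₁≤ late) (A.W-class b m F) z′∈)
            where
            late : Late m (ρ n)
            late = late-W b {m} {i} {w} (nested-≤ ℕ.z≤n (proj₁ (proj₂ (A.WFound.witness F)))) (proj₂ (proj₂ (A.WFound.witness F))) (0<ρ n) (A.WFound.up F)

          startV : ∀ i v t → t within ball 0 → A.VBad b m v t → s i ^ 3 * A.den b m v ≤ PP m → k₁ * s i < ρ 0 * (A.height b m v * A.den b m v * P m)
          startV i v t _ bad c≤ = ≰⇒> λ up → not-late (late-V b {m} {i} {v} (0<ρ 0) (A.VBad.1≤den bad) c≤ up)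

          startW : ∀ i w t → t within ball 0 → A.WBad b m i w t → k₄ * s i ^ 2 < ρ 0 * (∣ A.α b m w ∣ * PP m)
          startW i w t t∈ bad = ≰⇒> λ up → not-late (late-W b {m} {i} {w} {t} t∈ bad (0<ρ 0) up)

        -- For a fixed bad point the product in `VAvoid` is a constant times the radius and finally
        -- drops below the threshold.
        never-bad : TendsToZero ρ → ∀ {t} → (∀ n → t within ball n) → ∀ v → ¬ A.VBad b m v t
        never-bad ρ→0 {t} t∈ v bad = eventually (ρ→0 (τ * x⁻¹) (*-pos 0<τ 0<x⁻¹))
          where
          τ = ♯ 2 * D * k * k₄
          x = A.height b m v * A.den b m v * P m
          0<x : 0# < x
          0<x = <-≤-trans 0<1 (1≤x*y (1≤x*y (A.1≤height b m v) (A.VBad.1≤den bad)) (1≤P m))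
          x⁻¹ = x ⁻¹
          0<x⁻¹ = ⁻¹-pos 0<x
          0<τ : 0# < τ
          0<τ = *-pos (*-pos (*-pos (♯-pos 1) (<-≤-trans 0<1 1≤D)) 0<k) 0<k₄
          eventually : ∃[ n ] (∀ k → n ℕ.≤ k → ∣ ρ k ∣ < τ * x⁻¹) → ⊥
          eventually (n , small) = proj₁ (A.avoided b m N clearV clearW startV startW n) v t (t∈ n) bad
            (≤-trans (*-monoʳ x (<⇒≤ 0<x) (≤-trans (x≤∣x∣ (ρ n)) (<⇒≤ (small n ℕ.≤-refl)))) (≤-reflexive (div-mul 0<x)))

  -- A solution of the inequalities between the constants.

  constants : ∀ {β D} → 0# < β → β < 1# → 1# ≤ D → ∀ l₀ → 1 ℕ.≤ l₀ → ∃[ 𝒞 ] (Constants.l₀ {β} 𝒞 ≡ l₀ × Constants.D 𝒞 ≡ D × Constants.k₁ 𝒞 ≤ 1# × Constants.c₀ 𝒞 ≤ 1#)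
  constants {β} {D} 0<β β<1 1≤D l₀ 1≤l₀ = 𝒞 , ≡.refl , ≡.refl , k₁≤1 , c₀≤1
    where
    0<D = <-≤-trans 0<1 1≤D
    0≤D = <⇒≤ 0<D
    0≤β = <⇒≤ 0<β
    S = β ⁻¹
    Sβ : S * β ≈ 1#
    Sβ = trans (*-comm S β) (x⁻¹x 0<β)
    0<S = ⁻¹-pos 0<β
    1<S : 1# < S
    1<S = ≰⇒> λ S≤1 → <⇒≱ β<1 (≤-trans (≤-reflexive (sym Sβ)) (≤-trans (*-monoʳ β 0≤β S≤1) (≤-reflexive (*-identityˡ β))))
    β≤1 = <⇒≤ β<1
    B = β ^ suc l₀
    0<B : 0# < B
    0<B = ^-pos (suc l₀) 0<β
    B≤1 : B ≤ 1#
    B≤1 = ^≤1 (suc l₀) 0≤β β≤1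
    0<32D³ : 0# < ♯ 32 * D ^ 3
    0<32D³ = *-pos (♯-pos 31) (^-pos 3 0<D)
    0<8D² : 0# < ♯ 8 * D ^ 2
    0<8D² = *-pos (♯-pos 7) (^-pos 2 0<D)
    -- `kk₄≤` bounds `c₀` from below and `c₀D≤` from above. Taking equality in `kk₄≤`, `k≤` and
    -- `D²S⁴k₁≤` expresses `c₀`, `k` and `k₁` through `k₄`. Equality in `c₀D≤`, which is `main`,
    -- then determines `k₄` and produces the factor `♯ 32 * D ^ 3`; `Dkk₄<` follows since 2 is less
    -- than 4.
    u v k₄ k k₁ : ℝ
    u = (♯ 32 * D ^ 3) ⁻¹
    v = (♯ 8 * D ^ 2) ⁻¹
    k₄ = B * β ^ 4 * u
    k = B * k₄
    k₁ = β ^ 4 * k * v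
    0<u = ⁻¹-pos 0<32D³
    0<v = ⁻¹-pos 0<8D²
    0<k₄ = *-pos (*-pos 0<B (^-pos 4 0<β)) 0<u
    0<k = *-pos 0<B 0<k₄
    0<k₁ = *-pos (*-pos (^-pos 4 0<β) 0<k) 0<v
    0≤k = <⇒≤ 0<k
    0≤k₄ = <⇒≤ 0<k₄
    v≈ : v ≈ ♯ 4 * u * D
    v≈ = trans (sym (*-identityʳ v)) (trans (*-congˡ (sym (x⁻¹x 0<32D³))) (trans (regroup u v)
      (trans (*-congˡ (x⁻¹x 0<8D²)) (*-identityʳ _))))
      where
      regroup : ∀ u v → v * (♯ 32 * D ^ 3 * u) ≈ ♯ 4 * u * D * (♯ 8 * D ^ 2 * v)
      regroup u v = (solve 3 (λ a b c → a :* ((con (+ 32)) :* b :^ 3 :* c) := (con (+ 4)) :* c :* b :* ((con (+ 8)) :* b :^ 2 :* a)) refl v D u)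
    main : B * k₁ ≈ ♯ 4 * k * k₄ * D
    main = trans (*-congˡ (*-congˡ v≈)) (regroup k B (β ^ 4) u)
      where
      regroup : ∀ k B b u → B * (b * k * (♯ 4 * u * D)) ≈ ♯ 4 * k * (B * b * u) * D
      regroup k B b u = (solve 5 (λ a b c d e → a :* (b :* c :* ((con (+ 4)) :* d :* e)) := (con (+ 4)) :* c :* (a :* b :* d) :* e) refl B b k u D)
    4u≤1 : ♯ 4 * u ≤ 1#
    4u≤1 = ≤-trans (≤-trans (x≤x*y (*-nonneg (0≤# 4) (<⇒≤ 0<u)) 1≤8D³) (≤-reflexive (regroup u))) (≤-reflexive (x⁻¹x 0<32D³))
      where
      1≤8D³ : 1# ≤ ♯ 8 * D ^ 3
      1≤8D³ = 1≤x*y (by≤ (0≤# 7) (solve 1 (λ a → con (+ 8) := (con (+ 1)) :+ (con (+ 7))) refl 0#)) (1≤^ 3 1≤D)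
      regroup : ∀ u → ♯ 4 * u * (♯ 8 * D ^ 3) ≈ ♯ 32 * D ^ 3 * u
      regroup u = (solve 2 (λ a b → (con (+ 4)) :* a :* ((con (+ 8)) :* b :^ 3) := (con (+ 32)) :* b :^ 3 :* a) refl u D)
    2Du≤1 : ♯ 2 * D * u ≤ 1#
    2Du≤1 = ≤-trans (≤-trans (x≤x*y (*-nonneg (*-nonneg (0≤# 2) 0≤D) (<⇒≤ 0<u)) (1≤x*y (by≤ (0≤# 15) (solve 1 (λ a → con (+ 16) := (con (+ 1)) :+ (con (+ 15))) refl 0#)) (1≤^ 2 1≤D)))
      (≤-reflexive (regroup u))) (≤-reflexive (x⁻¹x 0<32D³))
      where
      regroup : ∀ u → ♯ 2 * D * u * (♯ 16 * D ^ 2) ≈ ♯ 32 * D ^ 3 * u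
      regroup u = (solve 2 (λ a b → (con (+ 2)) :* a :* b :* ((con (+ 16)) :* a :^ 2) := (con (+ 32)) :* a :^ 3 :* b) refl D u)
    mul≤1 : ∀ {x y} → 0# ≤ x → x ≤ 1# → 0# ≤ y → y ≤ 1# → x * y ≤ 1#
    mul≤1 p q r t = ≤-trans (*-mono p q r t) (≤-reflexive (*-identityˡ 1#))
    Sk₄-bound : ∀ {x} → 0# ≤ x → x * u ≤ 1# → x * S * k₄ ≤ 1#
    Sk₄-bound {x} 0≤x p = ≤-trans (≤-reflexive (trans (regroup S B (β ^ 3) u) (*-congʳ (trans (*-congʳ Sβ) (*-identityˡ _)))))
      (mul≤1 (*-nonneg (<⇒≤ 0<B) (^-nonneg 3 0≤β)) (mul≤1 (<⇒≤ 0<B) B≤1 (^-nonneg 3 0≤β) (^≤1 3 0≤β β≤1)) (*-nonneg 0≤x (<⇒≤ 0<u)) p)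
      where
      regroup : ∀ S B b u → x * S * (B * (β * b) * u) ≈ S * β * (B * b) * (x * u)
      regroup S B b u = (solve 6 (λ a b c d e f → a :* b :* (c :* (d :* e) :* f) := b :* d :* (c :* e) :* (a :* f)) refl x S B β b u)
    k≤k₄ : k ≤ k₄
    k≤k₄ = ≤-trans (*-monoʳ k₄ 0≤k₄ B≤1) (≤-reflexive (*-identityˡ k₄))
    1≤S = <⇒≤ 1<S
    Sk₄≤1 : ♯ 4 * S * k₄ ≤ 1#
    Sk₄≤1 = Sk₄-bound (0≤# 4) 4u≤1
    4k₄≤1 : ♯ 4 * k₄ ≤ 1#
    4k₄≤1 = ≤-trans (≤-trans (x≤x*y (*-nonneg (0≤# 4) 0≤k₄) 1≤S) (≤-reflexive (regroup S k₄))) Sk₄≤1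
      where
      regroup : ∀ S x → ♯ 4 * x * S ≈ ♯ 4 * S * x
      regroup S x = (solve 2 (λ a b → (con (+ 4)) :* a :* b := (con (+ 4)) :* b :* a) refl x S)
    k≤1 : k ≤ 1#
    k≤1 = ≤-trans k≤k₄ (≤-trans (x≤y*x 0≤k₄ (by≤ (0≤# 3) (solve 1 (λ a → con (+ 4) := (con (+ 1)) :+ (con (+ 3))) refl 0#))) 4k₄≤1)
    v≤1 : v ≤ 1#
    v≤1 = ⁻¹-anti-1 (1≤x*y (by≤ (0≤# 7) (solve 1 (λ a → con (+ 8) := (con (+ 1)) :+ (con (+ 7))) refl 0#)) (1≤^ 2 1≤D))
    k₁≤1 : k₁ ≤ 1#
    k₁≤1 = mul≤1 (*-nonneg (^-nonneg 4 0≤β) 0≤k) (mul≤1 (^-nonneg 4 0≤β) (^≤1 4 0≤β β≤1) 0≤k k≤1) (<⇒≤ 0<v) v≤1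
    c₀≤1 : ♯ 4 * k * k₄ ≤ 1#
    c₀≤1 = ≤-trans (≤-reflexive (regroup k k₄)) (mul≤1 0≤k k≤1 (*-nonneg (0≤# 4) 0≤k₄) 4k₄≤1)
      where
      regroup : ∀ x y → ♯ 4 * x * y ≈ x * (♯ 4 * y)
      regroup x y = (solve 2 (λ a b → (con (+ 4)) :* a :* b := a :* ((con (+ 4)) :* b)) refl x y)
    strict : ♯ 2 * D * k * k₄ < ♯ 4 * k * k₄ * D
    strict = ≰⇒> λ p → <⇒≱ (*-pos (*-pos (*-pos (♯-pos 1) 0<D) 0<k) 0<k₄) (halve k k₄ p)
      where
      halve : ∀ x y → ♯ 4 * x * y * D ≤ ♯ 2 * D * x * y → ♯ 2 * D * x * y ≤ 0#
      halve x y p = (by≤ (0≤sub p) (solve 3 (λ a b c → con (+ 0) := (con (+ 2)) :* a :* b :* c :+ ((con (+ 2)) :* a :* b :* c :- (con (+ 4)) :* b :* c :* a)) refl D x y))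
    S⁴β⁴ : S ^ 4 * β ^ 4 ≈ 1#
    S⁴β⁴ = trans (sym (^-distrib-* S β 4)) (trans (^-congˡ 4 Sβ) (1^ 4))
    𝒞 : Constants β
    𝒞 = record
      { 0<β = 0<β ; S = S ; Sβ = Sβ ; 1<S = 1<S ; l₀ = l₀ ; 1≤l₀ = 1≤l₀
      ; D = D ; k = k ; k₁ = k₁ ; k₄ = k₄ ; c₀ = ♯ 4 * k * k₄
      ; 1≤D = 1≤D ; 0<k = 0<k ; 0<k₁ = 0<k₁ ; 0<k₄ = 0<k₄ ; 0<c₀ = *-pos (*-pos (♯-pos 3) 0<k) 0<k₄
      ; c₀D≤ = ≤-reflexive (sym main)
      ; k≤ = ≤-refl
      ; Dkk₄< = <-≤-trans strict (≤-reflexive (sym main))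
      ; D²S⁴k₁≤ = ≤-reflexive (trans (regroup (S ^ 4) (β ^ 4) k v) (trans (*-cong (*-congˡ S⁴β⁴) (x⁻¹x 0<8D²)) (trans (*-identityʳ _) (*-identityʳ k))))
      ; DSk≤1 = ≤-trans (*-monoˡ (♯ 2 * D * S) (*-nonneg (*-nonneg (0≤# 2) 0≤D) (<⇒≤ 0<S)) k≤k₄) (Sk₄-bound (*-nonneg (0≤# 2) 0≤D) 2Du≤1)
      ; Sk₄≤1 = Sk₄≤1
      ; kk₄≤ = ≤-refl
      }
      where
      regroup : ∀ S b k v → ♯ 8 * D ^ 2 * S * (b * k * v) ≈ k * (S * b) * (♯ 8 * D ^ 2 * v)
      regroup S b k v = (solve 5 (λ a b c d e → (con (+ 8)) :* a :^ 2 :* b :* (c :* d :* e) := d :* (b :* c) :* ((con (+ 8)) :* a :^ 2 :* e)) refl D S b k v)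

  -- `X` is the error that is smaller after weighting by `g` and `e`. Then `L` is at most a multiple
  -- of `Y`, and so is `X` itself, so both P²|X||L| and (P|X|)² are controlled by the given product
  -- P²|X||Y|.
  near-side : ∀ {D c₀ c P e g X Y L} → 1# ≤ D → 0# ≤ P → 0# ≤ c₀ → ♯ 2 * D * c ≤ c₀ → D * D * c ≤ c₀ * c₀ →
    ∣ e ∣ ≤ D → 1# ≤ D * ∣ g ∣ → L ≈ g * X - e * Y → ∣ g ∣ * ∣ X ∣ ≤ ∣ e ∣ * ∣ Y ∣ → ∣ Y ∣ ≤ 1# → P * P * (∣ X ∣ * ∣ Y ∣) ≤ c →
    (∣ L ∣ ≤ ♯ 2 * D) × (P * ∣ X ∣ * ((P * ∣ L ∣) ⊔ 1#) ≤ c₀)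
  near-side {D} {c₀} {c} {P} {e} {g} {X} {Y} {L} 1≤D 0≤P 0≤c₀ 2Dc≤ D²c≤ e≤D 1≤Dg L≈ gX≤eY Y≤1 small =
    ≤-trans L≤ (≤-trans (*-monoˡ (♯ 2 * D) 0≤2D Y≤1) (≤-reflexive (*-identityʳ _))) ,
    ≤⊔-scale (*-nonneg 0≤P 0≤x) (≤-trans (by≤ (*-nonneg (*-nonneg (0≤□ P) 0≤x) (0≤sub L≤)) (solve 5 (λ a b c d e → (con (+ 2)) :* a :* (b :* b :* (c :* d)) := b :* c :* (b :* e) :+ b :* b :* c :* ((con (+ 2)) :* a :* d :- e)) refl D P x y (∣ L ∣)))
        (≤-trans (*-monoˡ (♯ 2 * D) 0≤2D small) 2Dc≤))
      (≤-respˡ (sym (*-identityʳ _)) (^-cancel 1 0≤c₀ (≤-respˡ (solve 2 (λ a b → a :* b :* (a :* b) := (a :* b) :^ 2) refl P x) (≤-respʳ (solve 1 (λ a → a :* a := a :^ 2) refl c₀)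
        (≤-trans square (≤-trans (*-monoˡ (D * D) (0≤□ D) small) D²c≤))))))
    where
    x = ∣ X ∣
    y = ∣ Y ∣
    0≤x = 0≤∣∣ X
    0≤y = 0≤∣∣ Y
    0≤D = ≤-trans 0≤1 1≤D
    0≤2D = *-nonneg (0≤# 2) 0≤D
    eY≤ : ∣ e ∣ * y ≤ D * y
    eY≤ = *-monoʳ y 0≤y e≤D
    L≤ : ∣ L ∣ ≤ ♯ 2 * D * y
    L≤ = ≤-trans (∣-∣≤₂ L≈ (∣*∣≤ {g} {X} ≤-refl ≤-refl) (∣*∣≤ {e} {Y} ≤-refl ≤-refl))
      (by≤ (0≤+ (0≤+ (0≤sub gX≤eY) (0≤sub eY≤)) (0≤sub eY≤)) (solve 5 (λ a b c d e → (con (+ 2)) :* a :* b := c :* d :+ e :* b :+ (e :* b :- c :* d :+ (a :* b :- e :* b) :+ (a :* b :- e :* b))) refl D y (∣ g ∣) x (∣ e ∣)))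
    x≤ : x ≤ D * D * y
    x≤ = ≤-trans (x≤y*x 0≤x 1≤Dg) (by≤ (*-nonneg 0≤D (0≤sub (≤-trans gX≤eY eY≤))) (solve 4 (λ a b c d → a :* a :* b := a :* c :* d :+ a :* (a :* b :- c :* d)) refl D y (∣ g ∣) x))
    square : P * x * (P * x) ≤ D * D * (P * P * (x * y))
    square = (by≤ (*-nonneg (*-nonneg (0≤□ P) 0≤x) (0≤sub x≤)) (solve 4 (λ a b c d → a :* a :* (b :* b :* (c :* d)) := b :* c :* (b :* c) :+ b :* b :* c :* (a :* a :* d :- c)) refl D P x y))

  -- The two parametrisations of the line, and rational lines close to it.

  intercept : ∀ {α v c t μ T} → v ≈ c + α * t → ∣ t ∣ ≤ T → ∣ α ∣ ≤ μ → ∣ v ∣ ≤ μ → ∣ c ∣ ≤ (1# + T) * μ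
  intercept {α} {v} {c} {t} {μ} {T} v≈ t≤ α≤ v≤ = ≤-trans (∣-∣≤₂ {z = α * t} (trans (solve 3 (λ a b c → a := a :+ b :* c :- b :* c) refl c α t) (+-congʳ (sym v≈))) v≤ (∣*∣≤ {α} {t} α≤ t≤))
    (≤-reflexive (solve 2 (λ a b → a :+ a :* b := ((con (+ 1)) :+ b) :* a) refl μ T))

  extract-factor : ∀ {κ x y B μ T} m n → 0# ≤ x → x ≤ y * B → 0# ≤ μ → 1# ≤ T → 0# < y ^ n * T ^ m → κ ≤ x ^ n * (T * μ) ^ m → κ / (y ^ n * T ^ m) ≤ B ^ n * μ ^ m
  extract-factor {κ} {x} {y} {B} {μ} {T} m n 0≤x x≤ 0≤μ 1≤T 0<d p = *-cancelʳ-≤ (y ^ n * T ^ m) 0<d (begin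
    κ / (y ^ n * T ^ m) * (y ^ n * T ^ m) ≈⟨ div-mul 0<d ⟩
    κ ≤⟨ p ⟩
    x ^ n * (T * μ) ^ m ≤⟨ *-monoʳ ((T * μ) ^ m) (^-nonneg m (*-nonneg (≤-trans 0≤1 1≤T) 0≤μ)) (^-mono n 0≤x x≤) ⟩
    (y * B) ^ n * (T * μ) ^ m ≈⟨ *-cong (^-distrib-* y B n) (^-distrib-* T μ m) ⟩
    y ^ n * B ^ n * (T ^ m * μ ^ m) ≈⟨ regroup (y ^ n) (B ^ n) (T ^ m) (μ ^ m) ⟩
    B ^ n * μ ^ m * (y ^ n * T ^ m) ∎)
    where
    regroup : ∀ x y z w → x * y * (z * w) ≈ y * w * (x * z)
    regroup x y z w = (solve 4 (λ a b c d → a :* b :* (c :* d) := b :* d :* (a :* c)) refl x y z w)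

  -- The two ways of parametrising the line: by x, with the rational points near
  -- which x is well approximated, and with the roles of x and y exchanged.
  module LineSides (a b : ℝ) (a≉0 : ¬ (a ≈ 0#)) where

    e f g h : Bool → ℝ
    e true = 1#
    e false = a
    f true = 0#
    f false = b
    g true = a
    g false = 1#
    h true = b
    h false = 0#

    D : ℝ
    D = 1# + (∣ a ∣ + ∣ a ⁻¹ ∣)

    1≤D : 1# ≤ D
    1≤D = (by≤ (0≤+ (0≤∣∣ a) (0≤∣∣ (a ⁻¹))) (solve 2 (λ a b → (con (+ 1)) :+ (a :+ b) := (con (+ 1)) :+ (a :+ b)) refl (∣ a ∣) (∣ a ⁻¹ ∣)))

    private
      0≤D = ≤-trans 0≤1 1≤D

      ∣1∣ : ∣ 1# ∣ ≈ 1#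
      ∣1∣ = ∣∣-nonneg 0≤1

      a≤D : ∣ a ∣ ≤ D
      a≤D = (by≤ (0≤+ 0≤1 (0≤∣∣ (a ⁻¹))) (solve 2 (λ a b → (con (+ 1)) :+ (a :+ b) := a :+ ((con (+ 1)) :+ b)) refl (∣ a ∣) (∣ a ⁻¹ ∣)))

      1≤Da : 1# ≤ D * ∣ a ∣
      1≤Da = ≤-trans (≤-reflexive (sym (trans (sym (∣*∣ (a ⁻¹) a)) (trans (∣∣-cong (trans (*-comm _ a) (⁻¹-inverse a a≉0))) ∣1∣))))
        (*-monoʳ ∣ a ∣ (0≤∣∣ a) (by≤ (0≤+ 0≤1 (0≤∣∣ a)) (solve 2 (λ a b → (con (+ 1)) :+ (a :+ b) := b :+ ((con (+ 1)) :+ a)) refl (∣ a ∣) (∣ a ⁻¹ ∣))))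

    e≤D : ∀ s → ∣ e s ∣ ≤ D
    e≤D true = ≤-trans (≤-reflexive ∣1∣) 1≤D
    e≤D false = a≤D

    g≤D : ∀ s → ∣ g s ∣ ≤ D
    g≤D true = a≤D
    g≤D false = ≤-trans (≤-reflexive ∣1∣) 1≤D

    1≤De : ∀ s → 1# ≤ D * ∣ e s ∣
    1≤De true = ≤-respʳ (*-congˡ (sym ∣1∣)) (≤-respʳ (sym (*-identityʳ D)) 1≤D)
    1≤De false = 1≤Da

    1≤Dg : ∀ s → 1# ≤ D * ∣ g s ∣
    1≤Dg true = 1≤Da
    1≤Dg false = ≤-respʳ (*-congˡ (sym ∣1∣)) (≤-respʳ (sym (*-identityʳ D)) 1≤D)

    -- Rational lines with small coefficients are neither nearly parallel nor close to the given line.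
    DualBound : ℕ → (T κ : ℝ) → Set
    DualBound j T κ = ∀ s w {t} → ∣ t ∣ ≤ T → ∀ μ → 0# ≤ μ → μ < 1# → 1# ≤ ∣ fromℤ (snd w) ∣ → ∣ fromℤ (fst w) * e s + fromℤ (snd w) * g s ∣ ≤ μ →
      ∣ fromℤ (fst w) * (e s * t + f s) + fromℤ (snd w) * (g s * t + h s) + fromℤ (thd w) ∣ ≤ μ → κ ≤ ∣ fromℤ (snd w) ∣ ^ suc (j ℕ.+ j) * μ ^ suc j

    module _ {j : ℕ} {κ₀ : ℝ} (0<κ₀ : 0# < κ₀) (lower : SimultaneousBound a b j κ₀)
      {T : ℝ} (0≤T : 0# ≤ T) where

      private
        n : ℕ
        n = suc (j ℕ.+ j)
        Ξ : ℝ
        Ξ = (♯ 2 * D) ^ n * (1# + T) ^ suc j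

        1≤2D : 1# ≤ ♯ 2 * D
        1≤2D = ≤-trans 1≤D (by≤ 0≤D (solve 1 (λ a → (con (+ 2)) :* a := a :+ a) refl D))

        1≤1+T : 1# ≤ 1# + T
        1≤1+T = (by≤ 0≤T (solve 1 (λ a → (con (+ 1)) :+ a := (con (+ 1)) :+ a) refl T))

        0<Ξ : 0# < Ξ
        0<Ξ = <-≤-trans 0<1 (1≤x*y (1≤^ n 1≤2D) (1≤^ (suc j) 1≤1+T))

        conclude : ∀ {x B μ} → 0# ≤ x → x ≤ ♯ 2 * D * B → 0# ≤ μ → κ₀ ≤ x ^ n * ((1# + T) * μ) ^ suc j → κ₀ / Ξ ≤ B ^ n * μ ^ suc j
        conclude 0≤x x≤ 0≤μ p = extract-factor (suc j) n 0≤x x≤ 0≤μ 1≤1+T 0<Ξ p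

        widen : ∀ {x μ} → 0# ≤ μ → x ≤ μ → x ≤ (1# + T) * μ
        widen 0≤μ p = ≤-trans p (x≤y*x 0≤μ 1≤1+T)

        nonzero-int : ∀ i → 1# ≤ ∣ fromℤ i ∣ → ¬ (i ≡ + 0)
        nonzero-int .(+ 0) p ≡.refl = <⇒≱ 0<1 (≤-trans p (≤-reflexive (∣∣-nonneg ≤-refl)))

      -- A small slope and a small value at a bounded parameter make the intercept small, and slope
      -- and intercept are the forms in `SimultaneousBound`. With the coordinates exchanged, the
      -- other coefficient acts as the denominator: `μ < 1#` keeps it from vanishing, and `A≤`
      -- compares it with the given one.
      dual-bound : DualBound j T (κ₀ / Ξ)
      dual-bound true (vec A B C) {t} t≤ μ 0≤μ μ<1 1≤B α≤ v≤ = conclude (0≤∣∣ (fromℤ B)) (x≤y*x (0≤∣∣ _) 1≤2D) 0≤μ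
        (lower A B C (nonzero-int B 1≤B) (*-nonneg (≤-trans 0≤1 1≤1+T) 0≤μ) (widen 0≤μ (≤-respˡ (∣∣-cong (slope (fromℤ A) (fromℤ B))) α≤))
          (intercept (value (fromℤ A) (fromℤ B) (fromℤ C)) t≤ α≤ v≤))
        where
        slope : ∀ A B → A * 1# + B * a ≈ A + B * a
        slope A B = (solve 3 (λ a b c → a :* (con (+ 1)) :+ b :* c := a :+ b :* c) refl A B a)
        value : ∀ A B C → A * (1# * t + 0#) + B * (a * t + b) + C ≈ C + B * b + (A * 1# + B * a) * t
        value A B C = (solve 6 (λ a b c d e f → a :* ((con (+ 1)) :* b :+ (con (+ 0))) :+ c :* (d :* b :+ e) :+ f := f :+ c :* e :+ (a :* (con (+ 1)) :+ c :* d) :* b) refl A t B a b C)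
      dual-bound false (vec A B C) {t} t≤ μ 0≤μ μ<1 1≤B α≤ v≤ = conclude (0≤∣∣ (fromℤ A)) A≤ 0≤μ
        (lower B A C A≢0 (*-nonneg (≤-trans 0≤1 1≤1+T) 0≤μ) (widen 0≤μ (≤-respˡ (∣∣-cong (slope (fromℤ A) (fromℤ B))) α≤))
          (intercept (value (fromℤ A) (fromℤ B) (fromℤ C)) t≤ α≤ v≤))
        where
        slope : ∀ A B → A * a + B * 1# ≈ B + A * a
        slope A B = (solve 3 (λ a b c → a :* b :+ c :* (con (+ 1)) := c :+ a :* b) refl A a B)
        value : ∀ A B C → A * (a * t + b) + B * (1# * t + 0#) + C ≈ C + A * b + (A * a + B * 1#) * t
        value A B C = (solve 6 (λ a b c d e f → a :* (b :* c :+ d) :+ e :* ((con (+ 1)) :* c :+ (con (+ 0))) :+ f := f :+ a :* d :+ (a :* b :+ e :* (con (+ 1))) :* c) refl A a t b B C)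
        Aa≤ : ∣ fromℤ A * a ∣ ≤ μ + ∣ fromℤ B ∣
        Aa≤ = ∣-∣≤₂ (isolate (fromℤ A) (fromℤ B)) α≤ ≤-refl
          where
          isolate : ∀ A B → A * a ≈ A * a + B * 1# - B
          isolate A B = (solve 3 (λ a b c → a :* b := a :* b :+ c :* (con (+ 1)) :- c) refl A a B)
        A≤ : ∣ fromℤ A ∣ ≤ ♯ 2 * D * ∣ fromℤ B ∣
        A≤ = ≤-trans (x≤y*x (0≤∣∣ _) 1≤Da) (≤-trans (≤-reflexive (trans (*-assoc D _ _) (*-congˡ (trans (*-comm _ _) (sym (∣*∣ (fromℤ A) a))))))
          (≤-trans (*-monoˡ D 0≤D Aa≤) (double (≤-trans (<⇒≤ μ<1) 1≤B))))
          where
          double : ∀ {x} → μ ≤ x → D * (μ + x) ≤ ♯ 2 * D * x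
          double {x} p = (by≤ (*-nonneg 0≤D (0≤sub p)) (solve 3 (λ a b c → (con (+ 2)) :* a :* b := a :* (c :+ b) :+ a :* (b :- c)) refl D x μ))
        A≢0 : ¬ (A ≡ + 0)
        A≢0 A≡0 = <⇒≱ μ<1 (≤-trans 1≤B (≤-trans (≤-reflexive (∣∣-cong (vanish (reflexive (≡.cong fromℤ A≡0))))) α≤))
          where
          vanish : ∀ {A B} → A ≈ 0# → B ≈ A * a + B * 1#
          vanish {A} {B} p = sym (trans (+-congʳ (trans (*-congʳ p) (zeroˡ a))) (solve 1 (λ a → (con (+ 0)) :+ a :* (con (+ 1)) := a) refl B))

      dual-constant : ∃[ κ ] (0# < κ × κ ≤ 1# × DualBound j T κ)
      dual-constant = let (κ , 0<κ , κ≤1 , κ≤) = positive-part (*-pos 0<κ₀ (⁻¹-pos 0<Ξ)) in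
        κ , 0<κ , κ≤1 , λ s w t≤ μ 0≤μ μ<1 1≤B α≤ v≤ → ≤-trans κ≤ (dual-bound s w t≤ μ 0≤μ μ<1 1≤B α≤ v≤)

    -- The first entry belongs to the coordinate whose error is `X`, so the numerators are exchanged
    -- along with the parametrisation.
    vector : Bool → (p r q : ℤ) → ℤ³
    vector true p r q = vec p r q
    vector false p r q = vec r p q

    module _ (t : ℝ) (p r q : ℤ) where

      private
        Fq = fromℤ q
        Fp = fromℤ p
        Fr = fromℤ r

      side-linear : Bool → ℝ
      side-linear s = g s * (Fq * f s - fromℤ (fst (vector s p r q))) - e s * (Fq * h s - fromℤ (snd (vector s p r q)))

      side-distance : Bool → ℝ
      side-distance s = Fq * (e s * t + f s) - fromℤ (fst (vector s p r q))

      some-side : ∀ {c₀ P c} → 0# ≤ P → 0# ≤ c₀ → ♯ 2 * D * c ≤ c₀ → D * D * c ≤ c₀ * c₀ →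
        ∣ Fq * t - Fp ∣ ≤ 1# → ∣ Fq * (a * t + b) - Fr ∣ ≤ 1# → P * P * (∣ Fq * t - Fp ∣ * ∣ Fq * (a * t + b) - Fr ∣) ≤ c →
        ∃[ s ] ((∣ side-linear s ∣ ≤ ♯ 2 * D) × (P * ∣ side-distance s ∣ * ((P * ∣ side-linear s ∣) ⊔ 1#) ≤ c₀))
      some-side 0≤P 0≤c₀ 2Dc≤ D²c≤ X≤1 Y≤1 small with ≤-total (∣ a ∣ * ∣ X ∣) (∣ 1# ∣ * ∣ Y ∣)
        where
        X = Fq * t - Fp
        Y = Fq * (a * t + b) - Fr
      ... | inj₁ le = true , proj₁ near , ≤-respˡ (*-congʳ (*-congˡ (∣∣-cong (X≈ Fq Fp)))) (proj₂ near)
        where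
        X≈ : ∀ q p → q * t - p ≈ q * (1# * t + 0#) - p
        X≈ q p = (solve 3 (λ a b c → a :* b :- c := a :* ((con (+ 1)) :* b :+ (con (+ 0))) :- c) refl q t p)
        L≈ : ∀ q p r → a * (q * 0# - p) - 1# * (q * b - r) ≈ a * (q * t - p) - 1# * (q * (a * t + b) - r)
        L≈ q p r = (solve 6 (λ a b c d e f → a :* (b :* (con (+ 0)) :- c) :- (con (+ 1)) :* (b :* d :- e) := a :* (b :* f :- c) :- (con (+ 1)) :* (b :* (a :* f :+ d) :- e)) refl a q p b r t)
        near = near-side {X = Fq * t - Fp} {Fq * (a * t + b) - Fr} 1≤D 0≤P 0≤c₀ 2Dc≤ D²c≤ (e≤D true) (1≤Dg true) (L≈ Fq Fp Fr) le Y≤1 small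
      ... | inj₂ le = false , near-side {X = Fq * (a * t + b) - Fr} {Fq * t - Fp} 1≤D 0≤P 0≤c₀ 2Dc≤ D²c≤ (e≤D false) (1≤Dg false) (L≈ Fq Fp Fr) le X≤1
          (≤-respˡ (*-congˡ (*-comm ∣ Fq * t - Fp ∣ ∣ Fq * (a * t + b) - Fr ∣)) small)
        where
        L≈ : ∀ q p r → 1# * (q * b - r) - a * (q * 0# - p) ≈ 1# * (q * (a * t + b) - r) - a * (q * t - p)
        L≈ q p r = (solve 6 (λ a b c d e f → (con (+ 1)) :* (a :* b :- c) :- d :* (a :* (con (+ 0)) :- e) := (con (+ 1)) :* (a :* (d :* f :+ b) :- c) :- d :* (a :* f :- e)) refl q b r a p t)

  -- The limit point of a play.

  module Winning {Q : ℕ → ℝ} (adm : IsAdmissible Q) (a b : ℝ) (a≉0 : ¬ (a ≈ 0#)) {j : ℕ} {κ₀ : ℝ} (0<κ₀ : 0# < κ₀)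
    (lower : SimultaneousBound a b j κ₀)
    (K m₀ : ℕ) (growth : ∀ m → m₀ ℕ.≤ m → Q m ^ suc ((3 ℕ.+ j) ℕ.* 4) ≤ Q (K ℕ.+ m))
    {β : ℝ} (𝒞 : Constants β) (D≡ : Constants.D 𝒞 ≡ LineSides.D a b a≉0) (k₁≤1 : Constants.k₁ 𝒞 ≤ 1#) (c₀≤1 : Constants.c₀ 𝒞 ≤ 1#)
    (K-light : ♯ 96 * fromℕ K * θ ^ Constants.l₀ 𝒞 ≤ 1#) where

    open Constants 𝒞 using (0<β; D; c₀; 0<c₀; 1≤D)
    open LineSides a b a≉0 using (e; f; g; h; e≤D; g≤D; 1≤De; DualBound; dual-constant; vector; side-linear; side-distance; some-side)

    P : ℕ → ℝ
    P m = root 2 (Q m)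

    private
      0≤Q : ∀ m → 0# ≤ Q m
      0≤Q m = ≤-trans 0≤1 (<⇒≤ (1<Q adm m))

      0≤P : ∀ m → 0# ≤ P m
      0≤P m = root-nonneg 1 (0≤Q m)

      P²≈Q : ∀ m → P m ^ 2 ≈ Q m
      P²≈Q m = root-^ 1 (0≤Q m)

      PP≈Q : ∀ m → P m * P m ≈ Q m
      PP≈Q m = trans (solve 1 (λ a → a :* a := a :^ 2) refl (P m)) (P²≈Q m)

      1≤P : ∀ m → 1# ≤ P m
      1≤P m = root-ub 1 (0≤Q m) 1# 0≤1 (≤-trans (≤-reflexive (1^ 2)) (<⇒≤ (1<Q adm m)))

      P-mono : ∀ {m n} → m ℕ.≤ n → P m ≤ P n
      P-mono {m} {n} m≤n = ^-cancel 1 (0≤P n) (≤-respˡ (sym (P²≈Q m)) (≤-respʳ (sym (P²≈Q n))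
        (≡.subst (λ k → Q m ≤ Q k) (ℕ.m∸n+n≡m m≤n) (Q-mono adm (n ℕ.∸ m)))))

      P-unbounded : ∀ M → ∃[ m ] (∀ n → m ℕ.≤ n → M ≤ P n)
      P-unbounded M = let (m , p) = IsAdmissible.unbounded adm (∣ M ∣ ^ 2) in
        m , λ n m≤n → ≤-trans (x≤∣x∣ M) (^-cancel 1 (0≤P n) (≤-respʳ (sym (P²≈Q n)) (p n m≤n)))

      module Con = Construction 𝒞 k₁≤1 e f g h
        (λ s → ≡.subst (∣ e s ∣ ≤_) (≡.sym D≡) (e≤D s)) (λ s → ≡.subst (∣ g s ∣ ≤_) (≡.sym D≡) (g≤D s))
        (λ s → ≡.subst (λ D → 1# ≤ D * ∣ e s ∣) (≡.sym D≡) (1≤De s)) P 1≤P P-mono P-unbounded K K-light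

    σ : Strategy 1 β
    σ = Con.strategy

    w : ℝ
    w = (♯ 2 * (D * D)) ⁻¹

    -- The value c₀²/(2D²) meets both requirements of `near-side`; the linear one, `2Dc≤`, uses that
    -- `c₀` is at most 1 and `D` at least 1.
    c : ℝ
    c = c₀ * c₀ * w

    private
      0<D = <-≤-trans 0<1 1≤D
      0≤D = <⇒≤ 0<D
      0≤c₀ = <⇒≤ 0<c₀

      0<2D² : 0# < ♯ 2 * (D * D)
      0<2D² = *-pos (♯-pos 1) (*-pos 0<D 0<D)

      0≤w : 0# ≤ w
      0≤w = <⇒≤ (⁻¹-pos 0<2D²)

      2D²w : ♯ 2 * (D * D) * w ≈ 1#
      2D²w = x⁻¹x 0<2D²

    0<c : 0# < c
    0<c = *-pos (*-pos 0<c₀ 0<c₀) (⁻¹-pos 0<2D²)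

    private
      2Dc≤ : ♯ 2 * D * c ≤ c₀
      2Dc≤ = bound w 0≤w 2D²w
        where
        bound : ∀ w → 0# ≤ w → ♯ 2 * (D * D) * w ≈ 1# → ♯ 2 * D * (c₀ * c₀ * w) ≤ c₀
        bound w 0≤w e = (by≤ (0≤+ (0≤+ (*-nonneg 0≤c₀ (0≤sub c₀≤1)) (*-nonneg (*-nonneg (*-nonneg (0≤# 2) 0≤D) (*-nonneg (0≤□ c₀) 0≤w)) (0≤sub 1≤D))) (*-nonneg (0≤□ c₀) (0≤sub (≤-reflexive e)))) (solve 3 (λ a b c → a := (con (+ 2)) :* b :* (a :* a :* c) :+ (a :* ((con (+ 1)) :- a) :+ (con (+ 2)) :* b :* (a :* a :* c) :* (b :- (con (+ 1))) :+ a :* a :* ((con (+ 1)) :- (con (+ 2)) :* (b :* b) :* c))) refl c₀ D w))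

      D²c≤ : D * D * c ≤ c₀ * c₀
      D²c≤ = bound w 0≤w 2D²w
        where
        bound : ∀ w → 0# ≤ w → ♯ 2 * (D * D) * w ≈ 1# → D * D * (c₀ * c₀ * w) ≤ c₀ * c₀
        bound w 0≤w e = (by≤ (0≤+ (*-nonneg (0≤□ c₀) (0≤sub (≤-reflexive e))) (*-nonneg (0≤□ D) (*-nonneg (0≤□ c₀) 0≤w))) (solve 3 (λ a b c → a :* a := b :* b :* (a :* a :* c) :+ (a :* a :* ((con (+ 1)) :- (con (+ 2)) :* (b :* b) :* c) :+ b :* b :* (a :* a :* c))) refl c₀ D w))

    module _ {U : Pred (Point 1) 0ℓ} (B : ℕ → Ball 1) (legal : LegalPlay σ U B) (shrinking : TendsToZero (radius ∘ B)) where

      N : NestedBalls β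
      N = record
        { ball = B
        ; nested = λ n {t} p → closed⇒within (B n) (λ _ → t) (LegalPlay.nested legal n {λ _ → t} (within⇒closed (B (suc n)) (λ _ → t) p))
        ; ratio = LegalPlay.size legal
        }

      open NestedBalls N using (limit; nested-≤; ρ; 0<ρ)

      private
        avoids : ∀ n t → t within B (suc n) → ¬ (∣ t - proj₁ (median (Con.pending (applyDownFrom B n) (B n))) ∣ ≤ β * ρ n)
        avoids n t p q = LegalPlay.avoids legal n (λ _ → t) (within⇒closed (B (suc n)) (λ _ → t) p) (within⇒removed 0<β (B n) _ (λ _ → t) q)

        -- A bound for all parameters in Bob's first ball. It enters the constant of the dual bound,
        -- hence the index from which the estimate holds, but neither the strategy nor `c`.
        T : ℝ
        T = ∣ centre (B 0) zero ∣ + ρ 0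

        0≤T : 0# ≤ T
        0≤T = 0≤+ (0≤∣∣ _) (<⇒≤ (0<ρ 0))

        bounded : ∀ {t} → t within B 0 → ∣ t ∣ ≤ T
        bounded {t} p = ∣+∣≤₂ (split (centre (B 0) zero)) ≤-refl p
          where
          split : ∀ c → t ≈ c + (t - c)
          split c = (solve 2 (λ a b → a := b :+ (a :- b)) refl t c)

        growthPP : ∀ m → m₀ ℕ.≤ m → (P m * P m) ^ suc ((3 ℕ.+ j) ℕ.* 4) ≤ P (K ℕ.+ m) * P (K ℕ.+ m)
        growthPP m p = ≤-respˡ (sym (^-congˡ (suc ((3 ℕ.+ j) ℕ.* 4)) (PP≈Q m))) (≤-respʳ (sym (PP≈Q (K ℕ.+ m))) (growth m p))

        t = proj₁ limit
        t∈ = proj₂ limit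

      Survives : Set
      Survives = ∃[ N ] (∀ m → N ℕ.≤ m → c ≤ scaledMin (t , a * t + b) (Q m))

      private
        module Final {κ : ℝ} (0<κ : 0# < κ) (κ≤1 : κ ≤ 1#)
          (dual : DualBound j T κ) where

          open Con.Play {j} {3 ℕ.+ j} (ℕ.m≤m+n 3 j) (ℕ.s≤s (ℕ.m≤n+m j 2)) 0<κ κ≤1 N avoids (λ s m w {u} u∈ → dual s w (bounded {u} u∈)) m₀ growthPP
            using (Large; large; never-bad)

          module _ {m₁ m′ : ℕ} (lg : Large m₁) (m₁≤ : m₁ ℕ.≤ m′) where
            m : ℕ
            m = K ℕ.+ m′

            good : ∀ q → 1 ℕ.≤ q → fromℕ q ≤ Q m → ∀ p r → ∣ fromℕ q * t - fromℤ p ∣ ≤ 1# → ∣ fromℕ q * (a * t + b) - fromℤ r ∣ ≤ 1# →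
              c ≤ P m * P m * (∣ fromℕ q * t - fromℤ p ∣ * ∣ fromℕ q * (a * t + b) - fromℤ r ∣)
            good q 1≤q q≤ p r X≤1 Y≤1 = ≮⇒≥ λ lt → bad (some-side t p r (+ q) {c₀} {P m} {c} (0≤P m) 0≤c₀
                (≡.subst (λ D → ♯ 2 * D * c ≤ c₀) D≡ 2Dc≤) (≡.subst (λ D → D * D * c ≤ c₀ * c₀) D≡ D²c≤) X≤1 Y≤1 (<⇒≤ lt))
              where
              bad : ∃[ s ] ((∣ side-linear t p r (+ q) s ∣ ≤ ♯ 2 * LineSides.D a b a≉0) ×
                (P m * ∣ side-distance t p r (+ q) s ∣ * ((P m * ∣ side-linear t p r (+ q) s ∣) ⊔ 1#) ≤ c₀)) → ⊥
              bad (true , L≤ , near) = never-bad lg m₁≤ true shrinking t∈ (vec p r (+ q)) (record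
                { 1≤den = 1≤fromℕ 1≤q ; den≤ = ≤-respʳ (sym (PP≈Q m)) q≤ ; L≤ = ≡.subst (λ D → _ ≤ ♯ 2 * D) (≡.sym D≡) L≤ ; near = near })
              bad (false , L≤ , near) = never-bad lg m₁≤ false shrinking t∈ (vec r p (+ q)) (record
                { 1≤den = 1≤fromℕ 1≤q ; den≤ = ≤-respʳ (sym (PP≈Q m)) q≤ ; L≤ = ≡.subst (λ D → _ ≤ ♯ 2 * D) (≡.sym D≡) L≤ ; near = near })

            product≥ : ∀ q → 1 ℕ.≤ q → fromℕ q ≤ Q m → c ≤ Q m * (⟨ fromℕ q * t ⟩ * ⟨ fromℕ q * (a * t + b) ⟩)
            product≥ q 1≤q q≤ = nearest (⟨⟩-attained (fromℕ q * t)) (⟨⟩-attained (fromℕ q * (a * t + b)))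
              where
              nearest : ∃[ p ] (⟨ fromℕ q * t ⟩ ≈ ∣ fromℕ q * t - fromℤ p ∣ × ∣ fromℕ q * t - fromℤ p ∣ ≤ 1#) →
                ∃[ r ] (⟨ fromℕ q * (a * t + b) ⟩ ≈ ∣ fromℕ q * (a * t + b) - fromℤ r ∣ × ∣ fromℕ q * (a * t + b) - fromℤ r ∣ ≤ 1#) →
                c ≤ Q m * (⟨ fromℕ q * t ⟩ * ⟨ fromℕ q * (a * t + b) ⟩)
              nearest (p , p≈ , p≤) (r , r≈ , r≤) = ≤-respʳ (*-cong (PP≈Q m) (*-cong (sym p≈) (sym r≈))) (good q 1≤q q≤ p r p≤ r≤)

            scaled≥ : c ≤ scaledMin (t , a * t + b) (Q m)
            scaled≥ = ≤-trans (≤-reflexive (trans (sym (div-mul 0<Q)) (*-comm (c / Q m) (Q m)))) (*-monoˡ (Q m) (<⇒≤ 0<Q)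
              (inf-glb (λ ((q , _) : ∃[ q ] (1 ℕ.≤ q × fromℕ q ≤ Q m)) → ⟨ fromℕ q * t ⟩ * ⟨ fromℕ q * (a * t + b) ⟩)
                (1 , ℕ.≤-refl , ≤-trans (≤-reflexive fromℕ1) (<⇒≤ (1<Q adm m)))
                λ (q , 1≤q , q≤) → *-cancelˡ-≤ (Q m) 0<Q (≤-trans (≤-reflexive (trans (*-comm (Q m) (c / Q m)) (div-mul 0<Q))) (product≥ q 1≤q q≤))))
              where
              0<Q : 0# < Q m
              0<Q = <-trans 0<1 (1<Q adm m)

          survives : Survives
          survives = from large
            where
            from : ∃[ m₁ ] Large m₁ → Survives
            -- The argument treats indices of the form `K + m′` with `m′` at least `m₁`, which are
            -- all those from `K + m₁` on.
            from (m₁ , lg) = K ℕ.+ m₁ , λ m K+m₁≤m → ≡.subst (λ m → c ≤ scaledMin (t , a * t + b) (Q m)) (ℕ.m+[n∸m]≡n (ℕ.≤-trans (ℕ.m≤m+n K m₁) K+m₁≤m))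
              (scaled≥ {m₁} {m ℕ.∸ K} lg (≡.subst (ℕ._≤ m ℕ.∸ K) (ℕ.m+n∸m≡n K m₁) (ℕ.∸-monoˡ-≤ K K+m₁≤m)))

        with-dual : ∃[ κ ] (0# < κ × κ ≤ 1# × DualBound j T κ) → Survives
        with-dual (κ , 0<κ , κ≤1 , dual) = Final.survives 0<κ κ≤1 dual

      outcome : ∃[ t ] ((∀ n → t within B n) × ∃[ N ] (∀ m → N ℕ.≤ m → c ≤ scaledMin (t , a * t + b) (Q m)))
      outcome = t , t∈ , with-dual (dual-constant {j} 0<κ₀ lower 0≤T)

  -- Rational lines.

  common-denominator : ∀ {a b} → IsRational a → IsRational b → ∃[ d ] ∃[ p ] ∃[ r ] (1 ℕ.≤ d × fromℕ d * a ≈ fromℤ p × fromℕ d * b ≈ fromℤ r)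
  common-denominator {a} {b} (mkℚ m c _ , a≈) (mkℚ n d _ , b≈) = suc c ℕ.* suc d , m ℤ.* + suc d , n ℤ.* + suc c , ℕ.s≤s ℕ.z≤n , A , B
    where
    C′ = fromℕ (suc c)
    D′ = fromℕ (suc d)
    A : fromℕ (suc c ℕ.* suc d) * a ≈ fromℤ (m ℤ.* + suc d)
    A = trans (*-cong (fromℕ-* (suc c) (suc d)) a≈) (trans (regroup C′ D′ (fromℤ m / C′)) (trans (*-congʳ (div-mul (fromℕ-pos c))) (sym (fromℤ-* m (+ suc d)))))
      where
      regroup : ∀ x y z → x * y * z ≈ z * x * y
      regroup x y z = (solve 3 (λ a b c → a :* b :* c := c :* a :* b) refl x y z)
    B : fromℕ (suc c ℕ.* suc d) * b ≈ fromℤ (n ℤ.* + suc c)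
    B = trans (*-cong (fromℕ-* (suc c) (suc d)) b≈) (trans (regroup C′ D′ (fromℤ n / D′)) (trans (*-congʳ (div-mul (fromℕ-pos d))) (sym (fromℤ-* n (+ suc c)))))
      where
      regroup : ∀ x y z → x * y * z ≈ z * y * x
      regroup x y z = (solve 3 (λ a b c → a :* b :* c := c :* b :* a) refl x y z)

  module Dirichlet (x : ℝ) (N : ℕ) (1≤N : 1 ℕ.≤ N) where

    Box : ℕ → Fin N → Set
    Box i k = ∃[ z ] (fromℕ (toℕ k) ≤ fromℕ N * (fromℕ i * x - fromℤ z) × fromℕ N * (fromℕ i * x - fromℤ z) ≤ 1# + fromℕ (toℕ k))

    private
      0<N : 0# < fromℕ N
      0<N = <-≤-trans 0<1 (1≤fromℕ 1≤N)

      box : ∀ i → ∃[ k ] Box i k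
      box i = from-floor (floor (fromℕ i * x))
        where
        from-floor : ∃[ z ] (fromℤ z ≤ fromℕ i * x × fromℕ i * x < fromℤ z + 1#) → ∃[ k ] Box i k
        from-floor (z , z≤ , <z+1) = from-cell (floor⁺ N y (*-nonneg (0≤♯ N) (0≤sub z≤)) y<N)
          where
          y = fromℕ N * (fromℕ i * x - fromℤ z)
          y<N : y < fromℕ N
          y<N = ≰⇒> λ p → <⇒≱ <z+1 (shift (fromℕ i * x) (fromℤ z) (*-cancelˡ-≤ (fromℕ N) 0<N (≤-trans (≤-reflexive (*-identityʳ _)) p)))
            where
            shift : ∀ u z → 1# ≤ u - z → z + 1# ≤ u
            shift u z p = (by≤ (0≤sub p) (solve 2 (λ a b → a := b :+ (con (+ 1)) :+ (a :- b :- (con (+ 1)))) refl u z))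
          from-cell : ∃[ m ] (fromℕ m ≤ y × y < 1# + fromℕ m) → ∃[ k ] Box i k
          from-cell (m , m≤y , y<m+1) = fromℕ< m<N , z , ≡.subst (λ k → fromℕ k ≤ y) (≡.sym (toℕ-fromℕ< m<N)) m≤y ,
              ≡.subst (λ k → y ≤ 1# + fromℕ k) (≡.sym (toℕ-fromℕ< m<N)) (<⇒≤ y<m+1)
            where
            m<N : m ℕ.< N
            m<N = ℕ.≰⇒> λ N≤m → <⇒≱ y<N (≤-trans (fromℕ-mono N≤m) m≤y)

      collide : ∀ {i j k} → i ℕ.< j → j ℕ.≤ N → Box i k → Box j k → ∃[ n ] ∃[ z ] (1 ℕ.≤ n × n ℕ.≤ N × fromℕ N * ∣ fromℕ n * x - fromℤ z ∣ ≤ 1#)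
      collide {i} {j} {k} i<j j≤N (u , lo , hi) (v , lo′ , hi′) = j ℕ.∸ i , v ℤ.- u , ℕ.m<n⇒0<n∸m i<j , ℕ.≤-trans (ℕ.m∸n≤m j i) j≤N ,
        ≤-respˡ (trans (∣∣-cong eq) (trans (∣*∣ (fromℕ N) _) (*-congʳ (∣∣-nonneg (0≤♯ N)))))
          (close {y′} {y} {fromℕ (toℕ k)} lo′ hi′ lo hi)
        where
        y = fromℕ N * (fromℕ i * x - fromℤ u)
        y′ = fromℕ N * (fromℕ j * x - fromℤ v)
        close : ∀ {y z m} → m ≤ y → y ≤ 1# + m → m ≤ z → z ≤ 1# + m → ∣ y - z ∣ ≤ 1#
        close {y} {z} {m} p q r t = ∣∣≤ (by≤ (0≤+ (0≤sub q) (0≤sub r)) (solve 3 (λ a b c → con (+ 1) := a :- b :+ ((con (+ 1)) :+ c :- a :+ (b :- c))) refl y z m)) (by≤ (0≤+ (0≤sub t) (0≤sub p)) (solve 3 (λ a b c → con (+ 1) := (:- (a :- b)) :+ ((con (+ 1)) :+ c :- b :+ (a :- c))) refl y z m))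
        j≈ : fromℕ j ≈ fromℕ (j ℕ.∸ i) + fromℕ i
        j≈ = trans (reflexive (≡.cong fromℕ (≡.sym (ℕ.m∸n+n≡m (ℕ.<⇒≤ i<j))))) (fromℕ-+ (j ℕ.∸ i) i)
        regroup : ∀ M n i v u → M * ((n + i) * x - v) - M * (i * x - u) ≈ M * (n * x - (v - u))
        regroup M n i v u = (solve 6 (λ a b c d e f → a :* ((b :+ c) :* d :- e) :- a :* (c :* d :- f) := a :* (b :* d :- (e :- f))) refl M n i x v u)
        eq : y′ - y ≈ fromℕ N * (fromℕ (j ℕ.∸ i) * x - fromℤ (v ℤ.- u))
        eq = trans (+-congʳ (*-congˡ (+-congʳ (*-congʳ j≈)))) (trans (regroup (fromℕ N) (fromℕ (j ℕ.∸ i)) (fromℕ i) (fromℤ v) (fromℤ u))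
          (*-congˡ (+-congˡ (-‿cong (sym (fromℤ-- v u))))))

    -- The fractional parts of the `suc N` multiples from 0 to `N` fall into `N` boxes of length
    -- 1/N, and two in the same box are subtracted.
    approximation : ∃[ n ] ∃[ z ] (1 ℕ.≤ n × n ℕ.≤ N × fromℕ N * ∣ fromℕ n * x - fromℤ z ∣ ≤ 1#)
    approximation = from-pigeonhole (pigeonhole (ℕ.n<1+n N) (λ i → proj₁ (box (toℕ i))))
      where
      from-pigeonhole : ∃₂ (λ (i j : Fin (suc N)) → toℕ i ℕ.< toℕ j × proj₁ (box (toℕ i)) ≡ proj₁ (box (toℕ j))) → _
      from-pigeonhole (i , j , i<j , same) = collide {toℕ i} {toℕ j} {proj₁ (box (toℕ i))} i<j (ℕ.≤-pred (toℕ<n j)) (proj₂ (box (toℕ i))) (≡.subst (Box (toℕ j)) (≡.sym same) (proj₂ (box (toℕ j))))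

  -- On a rational line, multiples d n of the common denominator d make both distances
  -- comparable to the distance from n x to the integers.
  module RationalLine {a b x y : ℝ} (y≈ : y ≈ a * x + b) {d : ℕ} {p r : ℤ} (1≤d : 1 ℕ.≤ d)
    (da≈ : fromℕ d * a ≈ fromℤ p) (db≈ : fromℕ d * b ≈ fromℤ r) where

    private
      Fd = fromℕ d
      ∣p∣ = ∣ fromℤ p ∣
      0<d : 0# < Fd
      0<d = <-≤-trans 0<1 (1≤fromℕ 1≤d)

    distance-x : ∀ n z → ⟨ fromℕ (d ℕ.* n) * x ⟩ ≤ Fd * ∣ fromℕ n * x - fromℤ z ∣
    distance-x n z = ≤-trans (⟨⟩≤ _ (+ d ℤ.* z)) (≤-reflexive (trans (∣∣-cong (trans (+-cong (*-congʳ (fromℕ-* d n)) (-‿cong (fromℤ-* (+ d) z)))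
        (regroup Fd (fromℕ n) (fromℤ z)))) (trans (∣*∣ Fd _) (*-congʳ (∣∣-nonneg (<⇒≤ 0<d))))))
      where
      regroup : ∀ d n z → d * n * x - d * z ≈ d * (n * x - z)
      regroup d n z = (solve 4 (λ a b c d → a :* b :* c :- a :* d := a :* (b :* c :- d)) refl d n x z)

    -- As `d * a` and `d * b` are integers, `d * n * y` is `p * (n * x)` plus an integer, so only
    -- the error of `n * x` matters, multiplied by `p`.
    distance-y : ∀ n z → ⟨ fromℕ (d ℕ.* n) * y ⟩ ≤ ∣p∣ * ∣ fromℕ n * x - fromℤ z ∣
    distance-y n z = ≤-trans (⟨⟩≤ _ (p ℤ.* z ℤ.+ + n ℤ.* r)) (≤-reflexive (trans (∣∣-cong (trans (+-cong qy (-‿cong (trans (fromℤ-+ (p ℤ.* z) (+ n ℤ.* r)) (+-cong (fromℤ-* p z) (fromℤ-* (+ n) r)))))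
        (regroup (fromℤ p) (fromℕ n) (fromℤ r) (fromℤ z)))) (∣*∣ (fromℤ p) _)))
      where
      expand : ∀ d n → d * n * (a * x + b) ≈ n * (d * a * x + d * b)
      expand d n = (solve 5 (λ a b c d e → a :* b :* (c :* d :+ e) := b :* (a :* c :* d :+ a :* e)) refl d n a x b)
      qy : fromℕ (d ℕ.* n) * y ≈ fromℕ n * (fromℤ p * x + fromℤ r)
      qy = trans (*-cong (fromℕ-* d n) y≈) (trans (expand Fd (fromℕ n)) (*-congˡ (+-cong (*-congʳ da≈) db≈)))
      regroup : ∀ p n r z → n * (p * x + r) - (p * z + n * r) ≈ p * (n * x - z)
      regroup p n r z = (solve 5 (λ a b c d e → a :* (b :* c :+ d) :- (b :* e :+ a :* d) := b :* (a :* c :- e)) refl n p x r z)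

    private
      G : ℝ
      G = ♯ 2 * (Fd * Fd) * ∣p∣

      -- By Q ≤ 2dN and Nδ ≤ 1 the left side is at most 2d²p/N.
      final-bound : ∀ {Q N δ ε d p} → 0# ≤ d → 0# ≤ p → 0# ≤ δ → 0# < N → Q ≤ d * (1# + N) → 1# ≤ N → N * δ ≤ 1# → ♯ 2 * (d * d) * p ≤ ε * N → Q * (d * δ * (p * δ)) ≤ ε
      final-bound {Q} {N} {δ} {ε} {d} {p} 0≤d 0≤p 0≤δ 0<N Q≤ 1≤N Nδ≤1 G≤ = *-cancelʳ-≤ N 0<N (begin
        Q * (d * δ * (p * δ)) * N ≤⟨ *-monoʳ N 0≤N (*-monoʳ (d * δ * (p * δ)) (*-nonneg (*-nonneg 0≤d 0≤δ) (*-nonneg 0≤p 0≤δ)) Q≤′) ⟩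
        ♯ 2 * d * N * (d * δ * (p * δ)) * N ≈⟨ (solve 4 (λ a b c d → (con (+ 2)) :* a :* b :* (a :* c :* (d :* c)) :* b := (con (+ 2)) :* (a :* a) :* d :* (b :* c :* (b :* c))) refl d N δ p) ⟩
        ♯ 2 * (d * d) * p * (N * δ * (N * δ)) ≤⟨ *-monoˡ (♯ 2 * (d * d) * p) (*-nonneg (*-nonneg (0≤# 2) (0≤□ d)) 0≤p) (≤-trans (*-mono 0≤Nδ Nδ≤1 0≤Nδ Nδ≤1) (≤-reflexive (*-identityˡ 1#))) ⟩
        ♯ 2 * (d * d) * p * 1# ≈⟨ *-identityʳ _ ⟩
        ♯ 2 * (d * d) * p ≤⟨ G≤ ⟩
        ε * N ∎)
        where
        0≤N = <⇒≤ 0<N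
        0≤Nδ = *-nonneg 0≤N 0≤δ
        Q≤′ : Q ≤ ♯ 2 * d * N
        Q≤′ = ≤-trans Q≤ (by≤ (*-nonneg 0≤d (0≤sub 1≤N)) (solve 2 (λ a b → (con (+ 2)) :* a :* b := a :* ((con (+ 1)) :+ b) :+ a :* (b :- (con (+ 1)))) refl d N))

      at-scale : ∀ {ε} n₀ → 0# < ε → 1 ℕ.≤ n₀ → G ≤ ε * fromℕ n₀ → ∀ {Q} → Fd * fromℕ n₀ ≤ Q → ∃[ N ] (fromℕ N ≤ Q * Fd ⁻¹ × Q * Fd ⁻¹ < 1# + fromℕ N) → scaledMin (x , y) Q ≤ ε
      at-scale {ε} n₀ 0<ε 1≤n₀ G≤ {Q} Q≥ (N , N≤ , <N+1) = with-approximation (Dirichlet.approximation x N 1≤N)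
        where
        Q/d : Q * Fd ⁻¹ * Fd ≈ Q
        Q/d = div-mul 0<d
        0≤Q : 0# ≤ Q
        0≤Q = ≤-trans (*-nonneg (<⇒≤ 0<d) (0≤♯ n₀)) Q≥
        n₀≤N : n₀ ℕ.≤ N
        n₀≤N = ℕ.≤-pred (fromℕ-<-cancel (≤-<-trans (*-cancelʳ-≤ Fd 0<d (≤-trans (≤-reflexive (*-comm _ Fd)) (≤-trans Q≥ (≤-reflexive (sym Q/d))))) <N+1))
          where
          fromℕ-<-cancel : ∀ {m n} → fromℕ m < fromℕ n → m ℕ.< n
          fromℕ-<-cancel p = ℕ.≰⇒> λ q → <⇒≱ p (fromℕ-mono q)
        1≤N = ℕ.≤-trans 1≤n₀ n₀≤N
        dN≤Q : Fd * fromℕ N ≤ Q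
        dN≤Q = ≤-trans (≤-reflexive (*-comm Fd _)) (≤-trans (*-monoʳ Fd (<⇒≤ 0<d) N≤) (≤-reflexive Q/d))
        Q≤ : Q ≤ Fd * (1# + fromℕ N)
        Q≤ = ≤-trans (≤-reflexive (sym Q/d)) (≤-trans (*-monoʳ Fd (<⇒≤ 0<d) (<⇒≤ <N+1)) (≤-reflexive (*-comm _ Fd)))
        with-approximation : ∃[ n ] ∃[ z ] (1 ℕ.≤ n × n ℕ.≤ N × fromℕ N * ∣ fromℕ n * x - fromℤ z ∣ ≤ 1#) → scaledMin (x , y) Q ≤ ε
        with-approximation (n , z , 1≤n , n≤N , near) = ≤-trans (*-monoˡ Q 0≤Q (≤-trans
            (inf-lb (λ ((q , _) : ∃[ q ] (1 ℕ.≤ q × fromℕ q ≤ Q)) → ⟨ fromℕ q * x ⟩ * ⟨ fromℕ q * y ⟩) 0# (λ _ → *-nonneg (0≤⟨⟩ _) (0≤⟨⟩ _))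
              (d ℕ.* n , ℕ.*-mono-≤ 1≤d 1≤n , ≤-trans (≤-reflexive (fromℕ-* d n)) (≤-trans (*-monoˡ Fd (<⇒≤ 0<d) (fromℕ-mono n≤N)) dN≤Q)))
            (*-mono (0≤⟨⟩ _) (distance-x n z) (0≤⟨⟩ _) (distance-y n z))))
          (final-bound (<⇒≤ 0<d) (0≤∣∣ _) (0≤∣∣ _) (<-≤-trans 0<1 (1≤fromℕ 1≤N)) Q≤ (1≤fromℕ 1≤N) near (≤-trans G≤ (*-monoˡ ε (<⇒≤ 0<ε) (fromℕ-mono n₀≤N))))

    scaledMin-small : ∀ {ε} → 0# < ε → ∃[ M ] (∀ {Q} → M ≤ Q → scaledMin (x , y) Q ≤ ε)
    scaledMin-small {ε} 0<ε = choose (archimedean (G * ε ⁻¹))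
      where
      choose : ∃[ n ] (G * ε ⁻¹ < fromℕ n) → ∃[ M ] (∀ {Q} → M ≤ Q → scaledMin (x , y) Q ≤ ε)
      choose (n , p) = Fd * fromℕ (suc n) , λ {Q} Q≥ → at-scale (suc n) 0<ε (ℕ.s≤s ℕ.z≤n) G≤ Q≥ (cell Q≥ (archimedean (Q * Fd ⁻¹)))
        where
        G≤ : G ≤ ε * fromℕ (suc n)
        G≤ = ≤-trans (≤-reflexive (trans (sym (div-mul 0<ε)) (*-comm _ ε))) (*-monoˡ ε (<⇒≤ 0<ε) (≤-trans (<⇒≤ p) (fromℕ-mono (ℕ.n≤1+n n))))
        cell : ∀ {Q} → Fd * fromℕ (suc n) ≤ Q → ∃[ k ] (Q * Fd ⁻¹ < fromℕ k) → ∃[ N ] (fromℕ N ≤ Q * Fd ⁻¹ × Q * Fd ⁻¹ < 1# + fromℕ N)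
        cell {Q} Q≥ (k , q) = floor⁺ k (Q * Fd ⁻¹) (*-nonneg (≤-trans (*-nonneg (<⇒≤ 0<d) (0≤♯ (suc n))) Q≥) (<⇒≤ (⁻¹-pos 0<d))) q

    not-in-E : ¬ E (x , y)
    not-in-E p = contradict (limsup⁻ _≤_ (λ Q → scaledMin (x , y) Q) p)
      where
      contradict : ∃[ c ] (0# < c × (∀ N → ¬ (∀ Q → N ≤ Q → scaledMin (x , y) Q ≤ c))) → ⊥
      contradict (c , 0<c , h) = let (M , small) = scaledMin-small 0<c in h M λ Q M≤Q → small M≤Q

    not-in-E[] : ∀ {Q} → IsAdmissible Q → ¬ E[ Q ] (x , y)
    not-in-E[] {Q} adm p = contradict (liminf⁻ ℕ._≤_ (λ m → scaledMin (x , y) (Q m)) p)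
      where
      contradict : ∃[ N ] ∃[ c ] (0# < c × (∀ m → N ℕ.≤ m → c ≤ scaledMin (x , y) (Q m))) → ⊥
      -- Half of `c` is used because both bounds on `scaledMin` are weak inequalities.
      contradict (N , c , 0<c , large) = at-half (scaledMin-small (*-pos 0<c (⁻¹-pos (♯-pos 1))))
        where
        at-half : ∃[ M ] (∀ {Q} → M ≤ Q → scaledMin (x , y) Q ≤ c * (♯ 2) ⁻¹) → ⊥
        at-half (M , small) = at-index (IsAdmissible.unbounded adm M)
          where
          at-index : ∃[ n ] (∀ m → n ℕ.≤ m → M ≤ Q m) → ⊥
          at-index (n , big) = <⇒≱ 0<c (by≤ (0≤sub (≤-respʳ (div-mul (♯-pos 1)) (*-monoʳ (♯ 2) (0≤# 2) (≤-trans (large (N ℕ.+ n) (ℕ.m≤m+n N n)) (small (big (N ℕ.+ n) (ℕ.m≤n+m n N))))))) (solve 1 (λ a → con (+ 0) := a :+ (a :- a :* (con (+ 2)))) refl c))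

  -- Choice of the parameters, and the theorem.

  light-delay : ∀ K → ∃[ l ] (1 ℕ.≤ l × ♯ 96 * fromℕ K * θ ^ l ≤ 1#)
  light-delay K = choose (^-unbounded 1<φ (♯ 96 * fromℕ K))
    where
    φ : ℝ
    φ = ♯ 3 * (♯ 2) ⁻¹
    2φ≈3 : φ * ♯ 2 ≈ ♯ 3
    2φ≈3 = div-mul (♯-pos 1)
    1<φ : 1# < φ
    1<φ = ≰⇒> λ p → <⇒≱ 0<1 (contra φ 2φ≈3 p)
      where
      contra : ∀ φ → φ * ♯ 2 ≈ ♯ 3 → φ ≤ 1# → 1# ≤ 0#
      contra φ e p = (by≤ (0≤+ (0≤+ (0≤sub p) (0≤sub p)) (0≤sub (≤-reflexive (sym e)))) (solve 1 (λ a → con (+ 0) := (con (+ 1)) :+ ((con (+ 1)) :- a :+ ((con (+ 1)) :- a) :+ (a :* (con (+ 2)) :- (con (+ 3))))) refl φ))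
    θφ≈1 : θ * φ ≈ 1#
    θφ≈1 = trans (solve 2 (λ a b → (con (+ 2)) :* a :* ((con (+ 3)) :* b) := (con (+ 2)) :* b :* ((con (+ 3)) :* a)) refl ((♯ 3) ⁻¹) ((♯ 2) ⁻¹)) (trans (*-cong (x⁻¹x (♯-pos 1)) (x⁻¹x (♯-pos 2))) (*-identityˡ 1#))
    θ≤1 : θ ≤ 1#
    θ≤1 = ≤-trans (x≤x*y (<⇒≤ 0<θ) (<⇒≤ 1<φ)) (≤-reflexive θφ≈1)
    choose : ∃[ n ] (♯ 96 * fromℕ K < φ ^ n) → ∃[ l ] (1 ℕ.≤ l × ♯ 96 * fromℕ K * θ ^ l ≤ 1#)
    choose (n , p) = suc n , ℕ.s≤s ℕ.z≤n , (begin
      ♯ 96 * fromℕ K * θ ^ suc n ≤⟨ *-mono (*-nonneg (0≤# 96) (0≤♯ K)) (<⇒≤ p) (^-nonneg (suc n) (<⇒≤ 0<θ)) (^-antiʳ (<⇒≤ 0<θ) θ≤1 (ℕ.n≤1+n n)) ⟩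
      φ ^ n * θ ^ n ≈⟨ trans (*-comm _ _) (trans (sym (^-distrib-* θ φ n)) (trans (^-congˡ n θφ≈1) (1^ n))) ⟩
      1# ∎)

  -- This serves both sets: it is a positive lower limit along `Q`, and since the values `Q m` are
  -- unbounded it also forces a positive upper limit over all real bounds.
  Robust : (Q : ℕ → ℝ) (a b t : ℝ) → Set
  Robust Q a b t = ∃[ c ] ∃[ N ] (0# < c × (∀ m → N ℕ.≤ m → c ≤ scaledMin (t , a * t + b) (Q m)))

  module _ {Q : ℕ → ℝ} (adm : IsAdmissible Q) {a b : ℝ} (a≉0 : ¬ (a ≈ 0#)) (dc : DiophantineCondition a b) where

    private
      Play-outcome : (U : Pred (Point 1) 0ℓ) {β : ℝ} → Strategy 1 β → Set
      Play-outcome U σ = ∀ B → LegalPlay σ U B → TendsToZero (radius ∘ B) → ∃[ t ] ((∀ n → t within B n) × Robust Q a b t)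

    -- The choices are made in the order `j`, `K`, `l`, constants: the Diophantine exponent fixes
    -- the growth exponent, this the number of indices per window, this the delay, and the delay the
    -- constants. All precede the play.
    robust-winning : ∀ U β → 0# < β → β < 1# / fromℕ 3 → ∃[ σ ] Play-outcome U {β} σ
    robust-winning U β 0<β β<⅓ = with-bound (simultaneous-bound dc)
      where
      β<1 : β < 1#
      β<1 = <-≤-trans β<⅓ (≤-trans (≤-reflexive (*-identityˡ _)) (⁻¹-anti-1 (1≤fromℕ {3} (ℕ.s≤s ℕ.z≤n))))
      open LineSides a b a≉0 using (D; 1≤D)
      with-bound : ∃[ j ] ∃[ κ ] (0# < κ × (SimultaneousBound a b j κ)) → ∃[ σ ] Play-outcome U {β} σ
      with-bound (j , κ , 0<κ , lower) = with-growth (growth-power adm (suc ((3 ℕ.+ j) ℕ.* 4)))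
        where
        with-growth : ∃[ K ] ∃[ m₀ ] (∀ m → m₀ ℕ.≤ m → Q m ^ suc ((3 ℕ.+ j) ℕ.* 4) ≤ Q (K ℕ.+ m)) → ∃[ σ ] Play-outcome U {β} σ
        with-growth (K , m₀ , growth) = with-delay (light-delay K)
          where
          with-delay : ∃[ l ] (1 ℕ.≤ l × ♯ 96 * fromℕ K * θ ^ l ≤ 1#) → ∃[ σ ] Play-outcome U {β} σ
          with-delay (l , 1≤l , light) = with-constants (constants 0<β β<1 1≤D l 1≤l)
            where
            with-constants : ∃[ 𝒞 ] (Constants.l₀ {β} 𝒞 ≡ l × Constants.D 𝒞 ≡ D × Constants.k₁ 𝒞 ≤ 1# × Constants.c₀ 𝒞 ≤ 1#) → ∃[ σ ] Play-outcome U {β} σ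
            with-constants (𝒞 , l₀≡ , D≡ , k₁≤1 , c₀≤1) = W.σ , λ B legal shrinking →
              let (t , t∈ , N , large) = W.outcome {U} B legal shrinking in t , t∈ , W.c , N , W.0<c , large
              where
              module W = Winning adm a b a≉0 {j} {κ} 0<κ lower K m₀ growth 𝒞 D≡ k₁≤1 c₀≤1
                (≡.subst (λ l → ♯ 96 * fromℕ K * θ ^ l ≤ 1#) (≡.sym l₀≡) light)

    winning-if-robust : ∀ (S : Pred ℝ² 0ℓ) → (∀ t → Robust Q a b t → S (t , a * t + b)) → AbsolutelyWinningOnLine a b S
    winning-if-robust S S∋ _ β 0<β β<⅓ = from (robust-winning _ β 0<β β<⅓)
      where
      from : ∃[ σ ] Play-outcome _ {β} σ → _
      from (σ , outcome) = σ , λ B legal shrinking → let (t , t∈ , robust) = outcome B legal shrinking in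
        (λ _ → t) , (λ n → within⇒closed (B n) (λ _ → t) (t∈ n)) , (t , a * t + b) , (S∋ t robust , refl) , λ _ → refl

    E[]-winning : AbsolutelyWinningOnLine a b (E[ Q ] ∩ Line a b)
    E[]-winning = winning-if-robust (E[ Q ] ∩ Line a b) λ t (c , N , 0<c , large) →
      liminf⁺ ℕ._≤_ (λ m → scaledMin (t , a * t + b) (Q m)) N 0<c large , refl

    E-winning : AbsolutelyWinningOnLine a b (E ∩ Line a b)
    E-winning = winning-if-robust (E ∩ Line a b) λ t (c , N , 0<c , large) →
      limsup⁺ _≤_ (λ q → scaledMin (t , a * t + b) q) 0<c
        (λ M → let (n , big) = IsAdmissible.unbounded adm M in Q (N ℕ.+ n) , big (N ℕ.+ n) (ℕ.m≤n+m n N) , large (N ℕ.+ n) (ℕ.m≤m+n N n)) , refl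

  rational-line-empty : ∀ {Q a b} → IsAdmissible Q → IsRational a → IsRational b → Empty (Line a b ∩ E) × Empty (Line a b ∩ E[ Q ])
  rational-line-empty {Q} {a} {b} adm a∈ℚ b∈ℚ = from (common-denominator a∈ℚ b∈ℚ)
    where
    from : ∃[ d ] ∃[ p ] ∃[ r ] (1 ℕ.≤ d × fromℕ d * a ≈ fromℤ p × fromℕ d * b ≈ fromℤ r) → _
    from (d , p , r , 1≤d , da≈ , db≈) =
      (λ (x , y) (on , in-E) → RationalLine.not-in-E {x = x} {y} on {d} {p} {r} 1≤d da≈ db≈ in-E) ,
      (λ (x , y) (on , in-E) → RationalLine.not-in-E[] {x = x} {y} on {d} {p} {r} 1≤d da≈ db≈ adm in-E)

theorem1p8 : (lem : ExcludedMiddle 0ℓ) (R : Reals) →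
    let open Analysis lem R in
    (Q : ℕ → ℝ) → IsAdmissible Q → (a b : ℝ) →
    (¬ (a ≈ 0#) → DiophantineCondition a b →
      AbsolutelyWinningOnLine a b (E ∩ Line a b) ×
      AbsolutelyWinningOnLine a b (E[ Q ] ∩ Line a b))
    ×
    (IsRational a → IsRational b →
      Empty (Line a b ∩ E) × Empty (Line a b ∩ E[ Q ]))
theorem1p8 lem R Q adm a b =
  (λ a≉0 dc → P.E-winning adm a≉0 dc , P.E[]-winning adm a≉0 dc) ,
  P.rational-line-empty adm
  where module P = Proof lem R
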